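{- $\mathcal{W}^\sharp$ is isomorphic to $\mathcal{W}/\mathcal{J}$ as a Hopf algebra, and for each $n$, $\mathcal{W}_n^\sharp$ is isomorphic to $\mathcal{W}_n/\mathcal{J}_n$ as an algebra for the internal product $*$, with $D_n=S_n^\sharp=\mathbf{N}_{1^n}^\sharp$ as neutral element of $(\mathcal{W}_n^\sharp,*)$.
   Context: Let $\mathbb{K}$ be a field of characteristic $0$. A packed word is a word $u$ over the positive integers whose set of letters is $\{1,\dots,m\}$ for some $m=\max(u)$; $\mathrm{pack}(w)$ is obtained from $w$ by replacing each occurrence of its $k$-th smallest letter by $k$. $\mathcal{W}=\mathbf{WQSym}^*=\bigoplus_n\mathcal{W}_n$ is the graded Hopf algebra with basis $\mathbf{N}_u$ over packed words $u$, $\mathcal{W}_n$ being spanned by those of length $n$. Product: $\mathbf{N}_u\mathbf{N}_v=\sum_w\mathbf{N}_w$, over the words $w$ in the shuffle of $u$ with $v$ shifted by $\max(u)$. Coproduct: $\Delta\mathbf{N}_w=\sum_{w=w'w''}\mathbf{N}_{\mathrm{pack}(w')}\otimes\mathbf{N}_{\mathrm{pack}(w'')}$ (deconcatenation). Internal product: for $u,v$ of the same length $\mathbf{N}_u*\mathbf{N}_v=\mathbf{N}_{\mathrm{pack}(u,v)}$, where $\mathrm{pack}(u,v)$ is the packed word obtained by replacing each biletter $(u_i,v_i)$ by its rank in the lexicographically ordered set of distinct occurring biletters; it is $0$ for different lengths. Write $S_n=\mathbf{N}_{1^n}$ and $S_n^\sharp=\sum_{i=0}^n(-1)^i\frac{\mathbf{N}_1^i}{i!}\mathbf{N}_{1^{n-i}}$.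 For $F\in\mathcal{W}_n$, $F^\sharp:=F*S_n^\sharp$ (extended linearly to $\mathcal{W}$), and $\mathcal{W}^\sharp=\bigoplus_n\mathcal{W}_n^\sharp$ is the image of $F\mapsto F^\sharp$. $\mathcal{J}=\bigoplus_n\mathcal{J}_n$ is the two-sided ideal of $\mathcal{W}$ (for the ordinary product) generated by the $\mathbf{N}_u$ such that some letter occurs exactly once in $u$; it is also an ideal for $*$. -}

module Defs where

open import Algebra.Apartness.Bundles using (HeytingField; HeytingCommutativeRing)
open import Algebra.Bundles using (CommutativeRing)
open import Algebra.Bundles.Raw using (RawRing)
import Algebra.Definitions.RawSemiring as RawSemiringDefs
open import Algebra.Module.Bundles.Raw using (RawLeftModule)
import Algebra.Module.Construct.TensorUnit as TensorUnit
open import Algebra.Module.Morphism.Structures using (module LeftModuleMorphisms)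
open import Algebra.Module.Structures using (IsLeftModule)
open import Algebra.Morphism.Structures using (module RingMorphisms)
open import Algebra.Structures using (IsRing)
open import Data.Bool.Base using (if_then_else_)
open import Data.Fin.Base using (Fin; toℕ)
open import Data.List.Base
  using (List; []; _∷_; _++_; [_]; map; concatMap; cartesianProductWith;
         deduplicate; filter; foldr; inits; length; replicate; tails; zip)
open import Data.List.Extrema.Nat using (max; max≤v⁺; xs≤max)
open import Data.List.Membership.Propositional using (_∈_)
open import Data.List.Membership.Propositional.Properties
  using (∈-map⁺; ∈-map⁻; ∈-deduplicate⁻; ∈-++⁺ˡ; ∈-++⁺ʳ; ∈-++⁻)
import Data.List.Membership.Setoid.Properties as SetoidMembership
open import Data.List.Properties using (≡-dec)
open import Data.List.Relation.Binary.Permutation.Propositional using (↭-sym)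
open import Data.List.Relation.Binary.Permutation.Propositional.Properties
  using (∈-resp-↭)
open import Data.List.Relation.Ternary.Interleaving.Propositional
  using (Interleaving; []; consˡ; consʳ; toPermutation)
open import Data.List.Relation.Unary.All as All using (All; []; _∷_)
open import Data.List.Relation.Unary.All.Properties using (replicate⁺)
open import Data.List.Relation.Unary.AllPairs using ([]; _∷_)
open import Data.List.Relation.Unary.Any as Any using (Any; here; there)
import Data.List.Relation.Unary.Unique.DecSetoid.Properties as UniqueDec
import Data.List.Relation.Unary.Unique.Setoid as UniqueSetoid
open import Data.Nat.Base
  using (ℕ; zero; suc; _∸_; _≤_; _<_; z≤n; s≤s; NonZero; _!)
  renaming (_+_ to _+ℕ_)
open import Data.Nat.Properties as ℕ using (_!≢0)
open import Data.Product.Base as Product using (∃; _×_; _,_; proj₁; proj₂)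
open import Data.Product.Relation.Binary.Lex.NonStrict using (×-decTotalOrder)
open import Data.Sum.Base using (inj₁; inj₂)
open import Function.Base using (_∘_; id)
open import Function.Bundles using (_⇔_; mk⇔; Equivalence)
open import Level using (Level; _⊔_) renaming (suc to lsuc)
open import Relation.Binary.Bundles using (DecTotalOrder)
open import Relation.Binary.Core using (Rel)
open import Relation.Binary.Definitions using (DecidableEquality; tri<; tri≈; tri>)
open import Relation.Binary.PropositionalEquality
  using (_≡_; refl; sym; trans; cong; subst)
open import Relation.Nullary.Decidable using (does; yes; no; map′)
open import Relation.Nullary.Negation using (¬_; contradiction)
open import Relation.Unary using (Pred; _∩_)

------------------------------------------------------------------------
-- Packed words

IsPacked : List ℕ → Set
IsPacked w = ∀ k → k ∈ w ⇔ (1 ≤ k × k ≤ max 0 w)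

record PackedWord : Set where
  constructor packed
  field
    word      : List ℕ
    .isPacked : IsPacked word

open PackedWord public

packedTo : ∀ {w} m → (∀ k → k ∈ w ⇔ (1 ≤ k × k ≤ m)) → IsPacked w
packedTo {w} m letters k = mk⇔
  (λ k∈w → proj₁ (to (letters k) k∈w) , All.lookup (xs≤max 0 w) k∈w)
  (λ (1≤k , k≤max) → from (letters k) (1≤k , ℕ.≤-trans k≤max max≤m))
  where
  open Equivalence
  max≤m : max 0 w ≤ m
  max≤m = max≤v⁺ z≤n (All.tabulate (λ {x} x∈w → proj₂ (to (letters x) x∈w)))

module Packing {a ℓ₁ ℓ₂} (O : DecTotalOrder a ℓ₁ ℓ₂) where
  open DecTotalOrder O
    using (_≈_; _≟_; antisym; reflexive; total; module Eq)
    renaming (Carrier to A; _≤_ to _≼_; _≤?_ to _≼?_; trans to ≼-trans)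
  open UniqueSetoid Eq.setoid using (Unique)

  countBelow : List A → A → ℕ
  countBelow d x = length (filter (_≼? x) d)

  -- The k-th smallest letter of w is the one with k distinct letters ≼ it.
  rank : List A → A → ℕ
  rank w = countBelow (deduplicate _≟_ w)

  private
    count-mono : ∀ d {x y} → x ≼ y → countBelow d x ≤ countBelow d y
    count-mono [] _ = z≤n
    count-mono (z ∷ d) {x} {y} x≼y with z ≼? x | z ≼? y
    ... | yes _   | yes _ = s≤s (count-mono d x≼y)
    ... | yes z≼x | no ¬p = contradiction (≼-trans z≼x x≼y) ¬p
    ... | no _    | yes _ = ℕ.m≤n⇒m≤1+n (count-mono d x≼y)
    ... | no _    | no _  = count-mono d x≼y

    count-strict : ∀ {d x y} → x ∈ d → y ≼ x → ¬ (y ≈ x) →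
                   countBelow d y < countBelow d x
    count-strict {z ∷ d} {x} {y} (here refl) y≼x y≉x with x ≼? y | x ≼? x
    ... | yes x≼y | _     = contradiction (antisym y≼x x≼y) y≉x
    ... | no _    | no ¬p = contradiction (reflexive Eq.refl) ¬p
    ... | no _    | yes _ = s≤s (count-mono d y≼x)
    count-strict {z ∷ d} {x} {y} (there x∈d) y≼x y≉x with z ≼? y | z ≼? x
    ... | yes _   | yes _ = s≤s (count-strict x∈d y≼x y≉x)
    ... | yes z≼y | no ¬p = contradiction (≼-trans z≼y y≼x) ¬p
    ... | no _    | yes _ = ℕ.m≤n⇒m≤1+n (count-strict x∈d y≼x y≉x)
    ... | no _    | no _  = count-strict x∈d y≼x y≉x

    count-pos : ∀ {d x} → Any (x ≈_) d → 1 ≤ countBelow d x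
    count-pos {z ∷ d} {x} p with z ≼? x
    count-pos {z ∷ d} {x} p           | yes _ = s≤s z≤n
    count-pos {z ∷ d} {x} (here x≈z)  | no ¬p =
      contradiction (reflexive (Eq.sym x≈z)) ¬p
    count-pos {z ∷ d} {x} (there x∈d) | no _  = count-pos x∈d

    count≤length : ∀ d x → countBelow d x ≤ length d
    count≤length [] x = z≤n
    count≤length (z ∷ d) x with z ≼? x
    ... | yes _ = s≤s (count≤length d x)
    ... | no _  = ℕ.m≤n⇒m≤1+n (count≤length d x)

    count-yes : ∀ {z x} d → z ≼ x → countBelow (z ∷ d) x ≡ suc (countBelow d x)
    count-yes {z} {x} d z≼x with z ≼? x
    ... | yes _ = refl
    ... | no ¬p = contradiction z≼x ¬p

    count-no : ∀ {z x} d → ¬ (z ≼ x) → countBelow (z ∷ d) x ≡ countBelow d x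
    count-no {z} {x} d z⋠x with z ≼? x
    ... | yes p = contradiction p z⋠x
    ... | no _  = refl

    count-surj : ∀ {d} → Unique d → ∀ k → 1 ≤ k → k ≤ length d →
                 ∃ λ x → x ∈ d × countBelow d x ≡ k
    count-surj {[]} _ zero () _
    count-surj {[]} _ (suc k) _ ()
    count-surj {y ∷ d} (y∉d ∷ uniq) (suc k) _ (s≤s k≤d)
      with ℕ.<-cmp k (countBelow d y)
    ... | tri≈ _ k≡r _ =
      y , here refl , trans (count-yes d (reflexive Eq.refl)) (cong suc (sym k≡r))
    ... | tri< k<r _ _ = x , there x∈d , trans (count-no d y⋠x) eq
      where
      ih = count-surj uniq (suc k) (s≤s z≤n) (ℕ.≤-trans k<r (count≤length d y))
      x = proj₁ ih
      x∈d = proj₁ (proj₂ ih)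
      eq = proj₂ (proj₂ ih)
      y⋠x : ¬ (y ≼ x)
      y⋠x y≼x = ℕ.<-irrefl refl
        (ℕ.<-≤-trans (count-strict x∈d y≼x (All.lookup y∉d x∈d))
                     (subst (_≤ countBelow d y) (sym eq) k<r))
    ... | tri> _ _ r<k = x , there x∈d , trans (count-yes d y≼x) (cong suc eq)
      where
      ih = count-surj uniq k (ℕ.≤-trans (s≤s z≤n) r<k) k≤d
      x = proj₁ ih
      x∈d = proj₁ (proj₂ ih)
      eq = proj₂ (proj₂ ih)
      y≼x : y ≼ x
      y≼x with total y x
      ... | inj₁ p = p
      ... | inj₂ x≼y = contradiction
        (subst (_≤ countBelow d y) eq (count-mono d x≼y)) (ℕ.<⇒≱ r<k)

  ranks-packed : ∀ w → IsPacked (map (rank w) w)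
  ranks-packed w = packedTo (length d) (λ k → mk⇔ (sound k) (complete k))
    where
    d = deduplicate _≟_ w
    sound : ∀ k → k ∈ map (rank w) w → 1 ≤ k × k ≤ length d
    sound k k∈ with ∈-map⁻ (rank w) k∈
    ... | x , x∈w , refl =
      count-pos (SetoidMembership.∈-deduplicate⁺ Eq.setoid _≟_
                   (λ p q → Eq.trans q (Eq.sym p))
                   (Any.map Eq.reflexive x∈w))
      , count≤length d x
    complete : ∀ k → 1 ≤ k × k ≤ length d → k ∈ map (rank w) w
    complete k (1≤k , k≤d)
      with count-surj (UniqueDec.deduplicate-! decSetoid w) k 1≤k k≤d
      where open DecTotalOrder.Eq O using (decSetoid)
    ... | x , x∈d , refl = ∈-map⁺ (rank w) (∈-deduplicate⁻ _≟_ w x∈d)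

  pack : List A → PackedWord
  pack w = packed (map (rank w) w) (ranks-packed w)

open Packing

packWord : List ℕ → PackedWord
packWord = pack ℕ.≤-decTotalOrder

packPair : PackedWord → PackedWord → PackedWord
packPair u v =
  pack (×-decTotalOrder ℕ.≤-decTotalOrder ℕ.≤-decTotalOrder)
       (zip (word u) (word v))

_≟ᵂ_ : DecidableEquality PackedWord
packed u _ ≟ᵂ packed v _ =
  map′ (λ { refl → refl }) (cong word) (≡-dec ℕ._≟_ u v)

shift : List ℕ → List ℕ → List ℕ
shift u = map (max 0 u +ℕ_)

-- One entry per choice of positions for xs; for disjoint alphabets, as below,
-- these are the distinct words of the shuffle.
shuffles : ∀ {a} {A : Set a} (xs ys : List A) → List (∃ (Interleaving xs ys))
shuffles []       []       = [ [] , [] ]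
shuffles (x ∷ xs) []       = map (Product.map (x ∷_) consˡ) (shuffles xs [])
shuffles []       (y ∷ ys) = map (Product.map (y ∷_) consʳ) (shuffles [] ys)
shuffles (x ∷ xs) (y ∷ ys) =
  map (Product.map (x ∷_) consˡ) (shuffles xs (y ∷ ys)) ++
  map (Product.map (y ∷_) consʳ) (shuffles (x ∷ xs) ys)

shuffle-packed : ∀ {u v w} → IsPacked u → IsPacked v →
                 Interleaving u (shift u v) w → IsPacked w
shuffle-packed {u} {v} {w} pu pv il =
  packedTo (m +ℕ n) (λ k → mk⇔ (sound k) (complete k))
  where
  open Equivalence
  m = max 0 u
  n = max 0 v
  sound : ∀ k → k ∈ w → 1 ≤ k × k ≤ m +ℕ n
  sound k k∈w with ∈-++⁻ u (∈-resp-↭ (toPermutation il) k∈w)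
  ... | inj₁ k∈u = Product.map₂ (λ k≤m → ℕ.≤-trans k≤m (ℕ.m≤m+n m n)) (to (pu k) k∈u)
  ... | inj₂ k∈v with ∈-map⁻ (m +ℕ_) k∈v
  ...   | j , j∈v , refl with to (pv j) j∈v
  ...     | 1≤j , j≤n = ℕ.≤-trans 1≤j (ℕ.m≤n+m j m) , ℕ.+-monoʳ-≤ m j≤n
  complete : ∀ k → 1 ≤ k × k ≤ m +ℕ n → k ∈ w
  complete k (1≤k , k≤m+n) = ∈-resp-↭ (↭-sym (toPermutation il)) k∈
    where
    k∈ : k ∈ u ++ shift u v
    k∈ with k ℕ.≤? m
    ... | yes k≤m = ∈-++⁺ˡ (from (pu k) (1≤k , k≤m))
    ... | no k≰m = ∈-++⁺ʳ u (subst (_∈ shift u v) (ℕ.m+[n∸m]≡n m≤k)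
        (∈-map⁺ (m +ℕ_) (from (pv (k ∸ m))
          ( ℕ.m<n⇒0<n∸m (ℕ.≰⇒> k≰m)
          , subst (k ∸ m ≤_) (ℕ.m+n∸m≡n m n) (ℕ.∸-monoˡ-≤ m k≤m+n)))))
      where
      m≤k = ℕ.<⇒≤ (ℕ.≰⇒> k≰m)

shiftedShuffles : PackedWord → PackedWord → List PackedWord
shiftedShuffles (packed u pu) (packed v pv) =
  map (λ (w , il) → packed w (shuffle-packed pu pv il)) (shuffles u (shift u v))

deconcatenations : PackedWord → List (PackedWord × PackedWord)
deconcatenations w =
  map (Product.map packWord packWord) (zip (inits (word w)) (tails (word w)))

ones-packed : ∀ n → IsPacked (replicate n 1)
ones-packed zero    = packedTo 0 (λ k → mk⇔ (λ ()) (λ { (s≤s _ , ()) }))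
ones-packed (suc n) = packedTo 1 (λ k → mk⇔ (sound k) (complete k))
  where
  sound : ∀ k → k ∈ replicate (suc n) 1 → 1 ≤ k × k ≤ 1
  sound k k∈ with All.lookup {P = 1 ≡_} (replicate⁺ (suc n) refl) k∈
  ... | refl = s≤s z≤n , s≤s z≤n
  complete : ∀ k → 1 ≤ k × k ≤ 1 → k ∈ replicate (suc n) 1
  complete k (1≤k , k≤1) = here (ℕ.≤-antisym k≤1 1≤k)

ones : ℕ → PackedWord
ones n = packed (replicate n 1) (ones-packed n)

HasSingleton : PackedWord → Set
HasSingleton u = ∃ λ a → length (filter (a ℕ.≟_) (word u)) ≡ 1

------------------------------------------------------------------------
-- Associative algebras and Hopf algebras over a commutative ring

module HopfAlgebras {c ℓ} (R : CommutativeRing c ℓ) where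

  private module R = CommutativeRing R

  -- The tensor product over R: formal sums of pairs modulo bilinearity. Lists
  -- form only a monoid, so 0 ⊗ n = 0 does not follow from additivity and is
  -- imposed; then (- m) ⊗ n is the inverse of m ⊗ n.
  module _ {a b ℓa ℓb} (M : RawLeftModule R.Carrier a ℓa)
                       (N : RawLeftModule R.Carrier b ℓb) where
    private
      module M = RawLeftModule M
      module N = RawLeftModule N

    data TensorEq : Rel (List (M.Carrierᴹ × N.Carrierᴹ))
                        (c ⊔ a ⊔ b ⊔ ℓa ⊔ ℓb) where
      ≈-refl   : ∀ {s} → TensorEq s s
      ≈-sym    : ∀ {s t} → TensorEq s t → TensorEq t s
      ≈-trans  : ∀ {s t r} → TensorEq s t → TensorEq t r → TensorEq s r
      ++-cong  : ∀ {s s′ t t′} → TensorEq s s′ → TensorEq t t′ →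
                 TensorEq (s ++ t) (s′ ++ t′)
      ++-comm  : ∀ s t → TensorEq (s ++ t) (t ++ s)
      ⊗-cong   : ∀ {m m′ n n′} → m M.≈ᴹ m′ → n N.≈ᴹ n′ →
                 TensorEq [ m , n ] [ m′ , n′ ]
      distribʳ : ∀ m m′ n →
                 TensorEq [ m M.+ᴹ m′ , n ] ((m , n) ∷ (m′ , n) ∷ [])
      distribˡ : ∀ m n n′ →
                 TensorEq [ m , n N.+ᴹ n′ ] ((m , n) ∷ (m , n′) ∷ [])
      balanced : ∀ k m n → TensorEq [ k M.*ₗ m , n ] [ m , k N.*ₗ n ]
      zeroˡ    : ∀ n → TensorEq [ M.0ᴹ , n ] []
      zeroʳ    : ∀ m → TensorEq [ m , N.0ᴹ ] []

    infixr 7 _⊗_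
    _⊗_ : RawLeftModule R.Carrier (a ⊔ b) (c ⊔ a ⊔ b ⊔ ℓa ⊔ ℓb)
    _⊗_ = record
      { Carrierᴹ = List (M.Carrierᴹ × N.Carrierᴹ)
      ; _≈ᴹ_     = TensorEq
      ; _+ᴹ_     = _++_
      ; _*ₗ_     = λ k → map (Product.map₁ (k M.*ₗ_))
      ; 0ᴹ       = []
      ; -ᴹ_      = map (Product.map₁ M.-ᴹ_)
      }

  module _ {x y} {X : Set x} {Y : Set y} where

    infixr 7 _⟨⊗⟩_
    _⟨⊗⟩_ : ∀ {x′ y′} {X′ : Set x′} {Y′ : Set y′} →
            (X → X′) → (Y → Y′) → List (X × Y) → List (X′ × Y′)
    f ⟨⊗⟩ g = map (Product.map f g)

    reassociate : ∀ {z} {Z : Set z} →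
                  List (List (X × Y) × Z) → List (X × List (Y × Z))
    reassociate = concatMap (λ (t , z) → map (λ (x , y) → x , [ y , z ]) t)

  record RawAlgebra a ℓa : Set (c ⊔ lsuc (a ⊔ ℓa)) where
    infix  8 -_
    infixr 7 _*ₗ_
    infixl 7 _*_
    infixl 6 _+_
    infix  4 _≈_
    field
      Carrier : Set a
      _≈_     : Rel Carrier ℓa
      _+_     : Carrier → Carrier → Carrier
      _*_     : Carrier → Carrier → Carrier
      _*ₗ_    : R.Carrier → Carrier → Carrier
      -_      : Carrier → Carrier
      0#      : Carrier
      1#      : Carrier

    rawRing : RawRing a ℓa
    rawRing = record
      { _≈_ = _≈_ ; _+_ = _+_ ; _*_ = _*_ ; -_ = -_ ; 0# = 0# ; 1# = 1# }

    rawLeftModule : RawLeftModule R.Carrier a ℓa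
    rawLeftModule = record
      { _≈ᴹ_ = _≈_ ; _+ᴹ_ = _+_ ; _*ₗ_ = _*ₗ_ ; 0ᴹ = 0# ; -ᴹ_ = -_ }

    -- The linear map induced on the tensor product by a bilinear one.
    ⟦_⟧⊗ : ∀ {x y} {X : Set x} {Y : Set y} →
           (X → Y → Carrier) → List (X × Y) → Carrier
    ⟦ f ⟧⊗ = foldr (λ (x , y) s → f x y + s) 0#

  record IsAlgebra {a ℓa} (A : RawAlgebra a ℓa) : Set (c ⊔ ℓ ⊔ a ⊔ ℓa) where
    open RawAlgebra A
    field
      isRing       : IsRing _≈_ _+_ _*_ -_ 0# 1#
      isLeftModule : IsLeftModule R.ring _≈_ _+_ 0# -_ _*ₗ_
      *ₗ-*-assoc   : ∀ k x y → (k *ₗ x) * y ≈ k *ₗ (x * y)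
      *-*ₗ-comm    : ∀ k x y → x * (k *ₗ y) ≈ k *ₗ (x * y)

  record RawBialgebra a ℓa : Set (c ⊔ lsuc (a ⊔ ℓa)) where
    field
      rawAlgebra : RawAlgebra a ℓa
    open RawAlgebra rawAlgebra public
    field
      Δ : Carrier → List (Carrier × Carrier)
      ε : Carrier → R.Carrier

  record IsHopfAlgebra {a ℓa} (A : RawBialgebra a ℓa) :
                       Set (c ⊔ ℓ ⊔ a ⊔ ℓa) where
    open RawBialgebra A
    private
      M = rawLeftModule
      K = TensorUnit.rawLeftModule {R = R.rawRing}
    open LeftModuleMorphisms using (IsLeftModuleHomomorphism)
    field
      isAlgebra : IsAlgebra rawAlgebra

      Δ-linear  : IsLeftModuleHomomorphism M (M ⊗ M) Δ
      ε-linear  : IsLeftModuleHomomorphism M K ε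
      coassoc   : ∀ x → TensorEq M (M ⊗ M) (reassociate ((Δ ⟨⊗⟩ id) (Δ x)))
                                           ((id ⟨⊗⟩ Δ) (Δ x))
      counitˡ   : ∀ x → ⟦ (λ y z → ε y *ₗ z) ⟧⊗ (Δ x) ≈ x
      counitʳ   : ∀ x → ⟦ (λ y z → ε z *ₗ y) ⟧⊗ (Δ x) ≈ x

      Δ-*-homo  : ∀ x y → TensorEq M M (Δ (x * y))
                    (cartesianProductWith (Product.zip _*_ _*_) (Δ x) (Δ y))
      Δ-1#-homo : TensorEq M M (Δ 1#) [ 1# , 1# ]
      ε-*-homo  : ∀ x y → ε (x * y) R.≈ ε x R.* ε y
      ε-1#-homo : ε 1# R.≈ R.1#

      antipode        : Carrier → Carrier
      antipode-linear : IsLeftModuleHomomorphism M M antipode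
      antipodeˡ       : ∀ x → ⟦ (λ y z → antipode y * z) ⟧⊗ (Δ x) ≈ ε x *ₗ 1#
      antipodeʳ       : ∀ x → ⟦ (λ y z → y * antipode z) ⟧⊗ (Δ x) ≈ ε x *ₗ 1#

  record AlgebraIsomorphism {a b ℓa ℓb} (A : RawAlgebra a ℓa)
                            (B : RawAlgebra b ℓb) :
                            Set (c ⊔ ℓ ⊔ a ⊔ b ⊔ ℓa ⊔ ℓb) where
    private
      module A = RawAlgebra A
      module B = RawAlgebra B
    open LeftModuleMorphisms A.rawLeftModule B.rawLeftModule
    open RingMorphisms A.rawRing B.rawRing
    field
      isAlgebra₁              : IsAlgebra A
      isAlgebra₂              : IsAlgebra B
      ⟦_⟧                     : A.Carrier → B.Carrier
      isRingIsomorphism       : IsRingIsomorphism ⟦_⟧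
      isLeftModuleIsomorphism : IsLeftModuleIsomorphism ⟦_⟧

  -- Preservation of the antipode is automatic for a bialgebra isomorphism, but
  -- is included.
  record HopfAlgebraIsomorphism {a b ℓa ℓb} (A : RawBialgebra a ℓa)
                                (B : RawBialgebra b ℓb) :
                                Set (c ⊔ ℓ ⊔ a ⊔ b ⊔ ℓa ⊔ ℓb) where
    private
      module A = RawBialgebra A
      module B = RawBialgebra B
    field
      isHopfAlgebra₁     : IsHopfAlgebra A
      isHopfAlgebra₂     : IsHopfAlgebra B
      algebraIsomorphism : AlgebraIsomorphism A.rawAlgebra B.rawAlgebra
    open AlgebraIsomorphism algebraIsomorphism public
    private
      module S₁ = IsHopfAlgebra isHopfAlgebra₁
      module S₂ = IsHopfAlgebra isHopfAlgebra₂
    field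
      Δ-homo        : ∀ x → TensorEq B.rawLeftModule B.rawLeftModule
                              ((⟦_⟧ ⟨⊗⟩ ⟦_⟧) (A.Δ x)) (B.Δ ⟦ x ⟧)
      ε-homo        : ∀ x → B.ε ⟦ x ⟧ R.≈ A.ε x
      antipode-homo : ∀ x → ⟦ S₁.antipode x ⟧ B.≈ S₂.antipode ⟦ x ⟧

  record IsSubalgebra {a ℓa p} (A : RawAlgebra a ℓa)
                      (P : Pred (RawAlgebra.Carrier A) p) :
                      Set (c ⊔ a ⊔ p) where
    open RawAlgebra A
    field
      +-closed  : ∀ {x y} → P x → P y → P (x + y)
      *-closed  : ∀ {x y} → P x → P y → P (x * y)
      *ₗ-closed : ∀ k {x} → P x → P (k *ₗ x)
      -‿closed  : ∀ {x} → P x → P (- x)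
      0#-closed : P 0#
      1#-closed : P 1#

  subalgebra : ∀ {a ℓa p} (A : RawAlgebra a ℓa)
               {P : Pred (RawAlgebra.Carrier A) p} →
               IsSubalgebra A P → RawAlgebra (a ⊔ p) ℓa
  subalgebra A {P} closed = record
    { Carrier = ∃ P
    ; _≈_     = λ (x , _) (y , _) → x ≈ y
    ; _+_     = Product.zip _+_ +-closed
    ; _*_     = Product.zip _*_ *-closed
    ; _*ₗ_    = λ k → Product.map (k *ₗ_) (*ₗ-closed k)
    ; -_      = Product.map -_ -‿closed
    ; 0#      = 0# , 0#-closed
    ; 1#      = 1# , 1#-closed
    }
    where
    open RawAlgebra A
    open IsSubalgebra closed

  -- Δ-closed says that Δ P lies in the image of P ⊗ P in A ⊗ A.
  record IsSubbialgebra {a ℓa p} (A : RawBialgebra a ℓa)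
                        (P : Pred (RawBialgebra.Carrier A) p) :
                        Set (c ⊔ a ⊔ ℓa ⊔ p) where
    open RawBialgebra A
    field
      isSubalgebra : IsSubalgebra rawAlgebra P
      Δ-closed     : ∀ x → P x → ∃ λ (t : List (∃ P × ∃ P)) →
                     TensorEq rawLeftModule rawLeftModule
                       ((proj₁ ⟨⊗⟩ proj₁) t) (Δ x)

  subbialgebra : ∀ {a ℓa p} (A : RawBialgebra a ℓa)
                 {P : Pred (RawBialgebra.Carrier A) p} →
                 IsSubbialgebra A P → RawBialgebra (a ⊔ p) ℓa
  subbialgebra A closed = record
    { rawAlgebra = subalgebra rawAlgebra isSubalgebra
    ; Δ          = λ (x , p) → proj₁ (Δ-closed x p)
    ; ε          = λ (x , _) → ε x
    }
    where
    open RawBialgebra A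
    open IsSubbialgebra closed

  -- Quotients are formed by changing the equality only; that the operations
  -- respect it is part of IsAlgebra and IsHopfAlgebra.
  _/ᴬ_ : ∀ {a ℓa p} (A : RawAlgebra a ℓa) →
         Pred (RawAlgebra.Carrier A) p → RawAlgebra a p
  A /ᴬ P = record
    { RawAlgebra A hiding (_≈_; rawRing; rawLeftModule; ⟦_⟧⊗)
    ; _≈_ = λ x y → P (x + - y)
    }
    where open RawAlgebra A

  _/ᴴ_ : ∀ {a ℓa p} (A : RawBialgebra a ℓa) →
         Pred (RawBialgebra.Carrier A) p → RawBialgebra a p
  A /ᴴ P = record { rawAlgebra = rawAlgebra /ᴬ P ; Δ = Δ ; ε = ε }
    where open RawBialgebra A

  module _ {a ℓa} (A : RawAlgebra a ℓa) where
    open RawAlgebra A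

    data Span {s} (S : Pred Carrier s) : Pred Carrier (c ⊔ a ⊔ ℓa ⊔ s) where
      generator : ∀ {x} → S x → Span S x
      zero      : Span S 0#
      add       : ∀ {x y} → Span S x → Span S y → Span S (x + y)
      scale     : ∀ k {x} → Span S x → Span S (k *ₗ x)
      respects  : ∀ {x y} → x ≈ y → Span S x → Span S y

    data Ideal {s} (S : Pred Carrier s) : Pred Carrier (c ⊔ a ⊔ ℓa ⊔ s) where
      generator : ∀ {x} → S x → Ideal S x
      zero      : Ideal S 0#
      add       : ∀ {x y} → Ideal S x → Ideal S y → Ideal S (x + y)
      scale     : ∀ k {x} → Ideal S x → Ideal S (k *ₗ x)
      mulˡ      : ∀ y {x} → Ideal S x → Ideal S (y * x)
      mulʳ      : ∀ y {x} → Ideal S x → Ideal S (x * y)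
      respects  : ∀ {x y} → x ≈ y → Ideal S x → Ideal S y

------------------------------------------------------------------------
-- The Hopf algebra 𝒲 = WQSym*

-- In a Heyting field, x # y holds exactly when x - y is invertible.
CharacteristicZero : ∀ {c ℓ₁ ℓ₂} → HeytingField c ℓ₁ ℓ₂ → Set ℓ₂
CharacteristicZero K = ∀ n → .{{NonZero n}} → (n · 1#) # 0#
  where
  open HeytingField K
  open HeytingCommutativeRing heytingCommutativeRing using (commutativeRing)
  open CommutativeRing commutativeRing using (rawRing)
  open RawSemiringDefs (RawRing.rawSemiring rawRing)
    using () renaming (_×_ to _·_)

module WQSymDual {c ℓ₁ ℓ₂} (K : HeytingField c ℓ₁ ℓ₂)
                 (char0 : CharacteristicZero K) where

  private
    R = HeytingCommutativeRing.commutativeRing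
          (HeytingField.heytingCommutativeRing K)
    module K = HeytingField K
    module KPower = RawSemiringDefs (RawRing.rawSemiring (CommutativeRing.rawRing R))

  open HopfAlgebras R public

  FormalSum : Set c
  FormalSum = List (K.Carrier × PackedWord)

  coefficient : FormalSum → PackedWord → K.Carrier
  coefficient []            w = K.0#
  coefficient ((k , u) ∷ F) w =
    (if does (u ≟ᵂ w) then k else K.0#) K.+ coefficient F w

  N : PackedWord → FormalSum
  N u = [ K.1# , u ]

  infixr 7 _∙_
  _∙_ : K.Carrier → FormalSum → FormalSum
  k ∙ F = map (Product.map₁ (k K.*_)) F

  linear : (PackedWord → FormalSum) → FormalSum → FormalSum
  linear f = concatMap (λ (k , u) → k ∙ f u)

  bilinear : (PackedWord → PackedWord → FormalSum) →
             FormalSum → FormalSum → FormalSum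
  bilinear f F G = linear (λ u → linear (f u) G) F

  W : RawBialgebra c ℓ₁
  W = record
    { rawAlgebra = record
      { Carrier = FormalSum
      ; _≈_     = λ F G → ∀ w → coefficient F w K.≈ coefficient G w
      ; _+_     = _++_
      ; _*_     = bilinear (λ u v → concatMap N (shiftedShuffles u v))
      ; _*ₗ_    = _∙_
      ; -_      = map (Product.map₁ (λ k → K.- k))
      ; 0#      = []
      ; 1#      = N (ones 0)
      }
    ; Δ = concatMap (λ (k , w) →
            map (λ (w′ , w″) → k ∙ N w′ , N w″) (deconcatenations w))
    ; ε = λ F → coefficient F (ones 0)
    }

  open RawBialgebra W public
    using (_≈_; _+_; _*_; _*ₗ_; -_; 0#; 1#; rawAlgebra; rawRing)
  open RawSemiringDefs (RawRing.rawSemiring rawRing) using (_^_; sum)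

  infixl 7 _⋆_
  _⋆_ : FormalSum → FormalSum → FormalSum
  _⋆_ = bilinear (λ u v → if does (length (word u) ℕ.≟ length (word v))
                          then N (packPair u v) else [])

  S : ℕ → FormalSum
  S n = N (ones n)

  -- #⇒invertible inverts the difference i!·1 - 0.
  inverseFactorial : ℕ → K.Carrier
  inverseFactorial i = proj₁ (K.#⇒invertible (char0 (i !) {{i !≢0}}))

  S♯ : ℕ → FormalSum
  S♯ n = sum (λ (j : Fin (suc n)) → let i = toℕ j in
    (((K.- K.1#) KPower.^ i) K.* inverseFactorial i) *ₗ (S 1 ^ i * S (n ∸ i)))

  infix 9 _♯
  _♯ : FormalSum → FormalSum
  _♯ = linear (λ u → N u ⋆ S♯ (length (word u)))

  -- W₍ n ₎, W♯₍ n ₎ and J₍ n ₎ are the degree n parts of 𝒲, 𝒲♯ and 𝒥, all taken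
  -- as subsets of 𝒲.
  W₍_₎ : ℕ → Pred FormalSum _
  W₍ n ₎ = Span rawAlgebra (λ F → ∃ λ u → length (word u) ≡ n × F ≡ N u)

  W♯ : Pred FormalSum _
  W♯ F = ∃ λ G → F ≈ G ♯

  W♯₍_₎ : ℕ → Pred FormalSum _
  W♯₍ n ₎ F = ∃ λ G → W₍ n ₎ G × F ≈ G ♯

  J : Pred FormalSum _
  J = Ideal rawAlgebra (λ F → ∃ λ u → HasSingleton u × F ≡ N u)

  J₍_₎ : ℕ → Pred FormalSum _
  J₍ n ₎ = J ∩ W₍ n ₎

  -- 𝒲 with the internal product and a designated element as unit; only on the
  -- subspaces for which e is neutral is this an algebra.
  internal : FormalSum → RawAlgebra c ℓ₁
  internal e = record
    { RawAlgebra rawAlgebra hiding (_*_; 1#; rawRing; rawLeftModule; ⟦_⟧⊗)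
    ; _*_ = _⋆_
    ; 1#  = e
    }

-- For a packed word u let D N_u be the sum, over the positions p of u, of N_v, where v arises
-- from u by making the letter at p a new letter just below its former value. D is a derivation
-- and a coderivation of 𝒲, and on 𝒲ₙ it is F ↦ F ⋆ (N₁ S₍ₙ₋₁₎). From
-- D (N₁^i S₍ₙ₋ᵢ₎) = i N₁^i S₍ₙ₋ᵢ₎ + N₁^(i+1) S₍ₙ₋ᵢ₋₁₎ one gets
-- F ⋆ (N₁^i S₍ₙ₋ᵢ₎) = D (D - 1) ⋯ (D - i + 1) F, so that D (F ♯) telescopes to 0, and ♯ is the
-- projection onto ker D along the image of D. Marking produces a singleton, whence D 𝒲 ⊆ 𝒥 and
-- F ♯ - F ∈ 𝒥; conversely ♯ kills N_u when u has a singleton, by induction on the number of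
-- pairs of equal letters. So 𝒥 = ker ♯, and as 𝒥 is an ideal for both products and ker D is a
-- subalgebra, ♯ is multiplicative. It commutes with Δ since D ⊗ 1 + 1 ⊗ D can vanish only where
-- D ⊗ 1 and 1 ⊗ D do, their eigenvalues being natural numbers. Thus ♯ is an idempotent
-- endomorphism of the Hopf algebra 𝒲 with image 𝒲♯ and kernel 𝒥; both 𝒲♯ and 𝒲/𝒥 are retracts
-- of 𝒲 and inherit its axioms, and F ↦ F mod 𝒥 and ♯ are inverse isomorphisms between them.

module Submission where

open import Algebra.Apartness.Bundles using (HeytingField; HeytingCommutativeRing)
open import Algebra.Bundles using (CommutativeMonoid; CommutativeRing)
open import Algebra.Bundles.Raw using (RawRing)
import Algebra.Definitions.RawSemiring as RawSemiringDefs
open import Algebra.Module.Bundles using (LeftModule)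
open import Algebra.Module.Bundles.Raw using (RawLeftModule)
import Algebra.Module.Construct.TensorUnit as TensorUnit
import Algebra.Module.Morphism.LeftModuleMonomorphism as LeftModuleMono
open import Algebra.Module.Morphism.Structures using (module LeftModuleMorphisms)
import Algebra.Module.Properties.LeftModule as LeftModuleProperties
open import Algebra.Module.Structures using (IsLeftModule)
import Algebra.Morphism.RingMonomorphism as RingMono
open import Algebra.Morphism.Structures using (module RingMorphisms)
import Algebra.Properties.CommutativeSemigroup as CommutativeSemigroupProperties
import Algebra.Properties.Ring as RingProperties
import Algebra.Properties.Semiring.Mult as SemiringMult
import Algebra.Solver.CommutativeMonoid as CommutativeMonoidSolver
open import Algebra.Structures using (IsRing)
open import Data.Bool.Base using (true; false; if_then_else_)
open import Data.Fin.Base using (Fin; toℕ)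
open import Data.List.Base
  using (List; []; _∷_; _++_; [_]; map; concatMap; cartesianProductWith; foldr; deduplicate;
         filter; length; replicate; zip; inits; tails)
open import Data.List.Extrema.Nat using (max; xs≤max)
open import Data.List.Membership.Propositional using (_∈_)
import Data.List.Membership.Setoid.Properties as SetoidMembership
import Data.List.Properties as List
open import Data.List.Relation.Binary.Pointwise as Pointwise using (Pointwise; []; _∷_)
open import Data.List.Relation.Ternary.Interleaving.Propositional
  using (Interleaving; []; consˡ; consʳ)
open import Data.List.Relation.Unary.All as All using (All; []; _∷_)
import Data.List.Relation.Unary.All.Properties as All
open import Data.List.Relation.Unary.Any as Any using (Any; here; there)
open import Data.Nat.Base
  using (ℕ; zero; suc; _∸_; _⊓_; _≤_; _<_; _≤′_; ≤′-reflexive; ≤′-step; z≤n; s≤s; _!)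
  renaming (_+_ to _+ℕ_)
import Data.Nat.Properties as ℕ
open import Data.Product.Base as Product using (∃; _×_; _,_; proj₁; proj₂)
open import Data.Product.Relation.Binary.Lex.NonStrict using (×-decTotalOrder)
open import Data.Sum.Base as Sum using (_⊎_; inj₁; inj₂)
open import Data.Sum.Relation.Binary.LeftOrder using (⊎-<-decTotalOrder; ₁∼₂; ₁∼₁; ₂∼₂)
open import Data.Sum.Relation.Binary.Pointwise using () renaming (inj₁ to ≈₁; inj₂ to ≈₂)
open import Function.Base using (_∘_; id; flip)
open import Function.Bundles using (_⇔_; mk⇔; Equivalence)
open import Level using (_⊔_; 0ℓ) renaming (suc to lsuc)
open import Relation.Binary.Bundles using (DecTotalOrder)
open import Relation.Binary.PropositionalEquality as ≡ using (_≡_; _≢_)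
import Relation.Binary.Reasoning.Setoid as SetoidReasoning
open import Relation.Nullary.Decidable using (Dec; yes; no; does; recompute; dec-true; dec-false)
open import Relation.Nullary.Negation using (¬_; contradiction)
open import Relation.Unary using (Pred; _∩_)
open import Defs

-- A packed word stands for the order type of a word, and the proof never computes with packed
-- letters. A word over any totally ordered alphabet names a basis element: the product lives over
-- the ordered sum of two alphabets, the internal product and the marking of a position over a
-- lexicographic product, and two names agree as soon as a `Similarity` relates them letter by
-- letter. What remains of each identity concerns sums over shuffles, cuts and markings of plain
-- words. The coefficients (-1)^i / i! turn the sum defining ♯ into the sum of (-1)^i binom(D, i),
-- the expansion of (1 - 1)^D: it is 1 where D has eigenvalue 0 and 0 where the eigenvalue is
-- positive. The eigenspaces themselves are never formed. A tensor is a list modulo a generated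
-- equality, with no basis at hand, so the step for the coproduct works with the polynomials D (D -
-- 1) ⋯ (D - n) that annihilate degree n and with the invertibility of positive integers.

Order : Set₁
Order = DecTotalOrder 0ℓ 0ℓ 0ℓ

ℕᵒ : Order
ℕᵒ = ℕ.≤-decTotalOrder

infixr 6 _×ᵒ_
_×ᵒ_ : Order → Order → Order
_×ᵒ_ = ×-decTotalOrder

infixr 5 _⊎ᵒ_
_⊎ᵒ_ : Order → Order → Order
_⊎ᵒ_ = ⊎-<-decTotalOrder

∣_∣ᵒ : Order → Set
∣_∣ᵒ = DecTotalOrder.Carrier

-- An order isomorphism between subsets of two ordered alphabets, as a relation.
record Similarity (O P : Order) : Set₁ where
  private
    module O = DecTotalOrder O
    module P = DecTotalOrder P
  infix 4 _∼_
  field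
    _∼_     : O.Carrier → P.Carrier → Set
    mono    : ∀ {x x′ y y′} → x ∼ y → x′ ∼ y′ → x O.≤ x′ → y P.≤ y′
    reflect : ∀ {x x′ y y′} → x ∼ y → x′ ∼ y′ → y P.≤ y′ → x O.≤ x′

  ≈-mono : ∀ {x x′ y y′} → x ∼ y → x′ ∼ y′ → x O.≈ x′ → y P.≈ y′
  ≈-mono r s e = P.antisym (mono r s (O.reflexive e)) (mono s r (O.reflexive (O.Eq.sym e)))

  ≈-reflect : ∀ {x x′ y y′} → x ∼ y → x′ ∼ y′ → y P.≈ y′ → x O.≈ x′
  ≈-reflect r s e =
    O.antisym (reflect r s (P.reflexive e)) (reflect s r (P.reflexive (P.Eq.sym e)))

  infix 4 _≋_
  _≋_ : List O.Carrier → List P.Carrier → Set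
  _≋_ = Pointwise _∼_

open Similarity using (mono; reflect)

infix 4 _⊢_∼_ _⊢_≋_
_⊢_∼_ : ∀ {O P} → Similarity O P → ∣ O ∣ᵒ → ∣ P ∣ᵒ → Set
_⊢_∼_ = Similarity._∼_

_⊢_≋_ : ∀ {O P} → Similarity O P → List ∣ O ∣ᵒ → List ∣ P ∣ᵒ → Set
_⊢_≋_ = Similarity._≋_

-- Constructions of similarities

id-∼ : ∀ {O} → Similarity O O
id-∼ = record
  { _∼_     = _≡_
  ; mono    = λ { ≡.refl ≡.refl x≤y → x≤y }
  ; reflect = λ { ≡.refl ≡.refl x≤y → x≤y }
  }

flip-∼ : ∀ {O P} → Similarity O P → Similarity P O
flip-∼ S = record
  { _∼_     = flip (S ⊢_∼_)
  ; mono    = reflect S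
  ; reflect = mono S
  }

infixr 9 _⨾_
_⨾_ : ∀ {O P Q} → Similarity O P → Similarity P Q → Similarity O Q
S ⨾ T = record
  { _∼_     = λ x z → ∃ λ y → (S ⊢ x ∼ y) × (T ⊢ y ∼ z)
  ; mono    = λ (_ , r , s) (_ , r′ , s′) → mono T s s′ ∘ mono S r r′
  ; reflect = λ (_ , r , s) (_ , r′ , s′) → reflect S r r′ ∘ reflect T s s′
  }

flip-≋ : ∀ {O P} (S : Similarity O P) {u v} → S ⊢ u ≋ v → flip-∼ S ⊢ v ≋ u
flip-≋ S = Pointwise.symmetric id

⨾-≋ : ∀ {O P Q} (S : Similarity O P) (T : Similarity P Q) {u v w} →
      S ⊢ u ≋ v → T ⊢ v ≋ w → S ⨾ T ⊢ u ≋ w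
⨾-≋ S T []      []      = []
⨾-≋ S T (r ∷ p) (s ∷ q) = (_ , r , s) ∷ ⨾-≋ S T p q

infixr 6 _×-∼_
-- A strict step of the lexicographic order contains the inequality `x≉y`, so even monotonicity of
-- the product uses `≈-reflect`. This is why a similarity carries both directions.
_×-∼_ : ∀ {O O′ P P′} → Similarity O P → Similarity O′ P′ → Similarity (O ×ᵒ O′) (P ×ᵒ P′)
S ×-∼ T = record
  { _∼_     = λ (x , x′) (y , y′) → (S ⊢ x ∼ y) × (T ⊢ x′ ∼ y′)
  ; mono    = λ { (r , _) (s , _) (inj₁ (x≤y , x≉y)) →
                    inj₁ (mono S r s x≤y , x≉y ∘ Similarity.≈-reflect S r s)
                ; (r , r′) (s , s′) (inj₂ (x≈y , x≤y)) →
                    inj₂ (Similarity.≈-mono S r s x≈y , mono T r′ s′ x≤y) }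
  ; reflect = λ { (r , _) (s , _) (inj₁ (x≤y , x≉y)) →
                    inj₁ (reflect S r s x≤y , x≉y ∘ Similarity.≈-mono S r s)
                ; (r , r′) (s , s′) (inj₂ (x≈y , x≤y)) →
                    inj₂ (Similarity.≈-reflect S r s x≈y , reflect T r′ s′ x≤y) }
  }

data ⊎-Rel {O O′ P P′} (S : Similarity O P) (T : Similarity O′ P′) :
           ∣ O ⊎ᵒ O′ ∣ᵒ → ∣ P ⊎ᵒ P′ ∣ᵒ → Set where
  leftᴿ  : ∀ {x y} → S ⊢ x ∼ y → ⊎-Rel S T (inj₁ x) (inj₁ y)
  rightᴿ : ∀ {x y} → T ⊢ x ∼ y → ⊎-Rel S T (inj₂ x) (inj₂ y)

infixr 5 _⊎-∼_
_⊎-∼_ : ∀ {O O′ P P′} → Similarity O P → Similarity O′ P′ → Similarity (O ⊎ᵒ O′) (P ⊎ᵒ P′)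
S ⊎-∼ T = record
  { _∼_     = ⊎-Rel S T
  ; mono    = λ { (leftᴿ r) (leftᴿ s) (₁∼₁ p) → ₁∼₁ (mono S r s p)
                ; (leftᴿ r) (rightᴿ s) ₁∼₂ → ₁∼₂
                ; (rightᴿ r) (rightᴿ s) (₂∼₂ p) → ₂∼₂ (mono T r s p) }
  ; reflect = λ { (leftᴿ r) (leftᴿ s) (₁∼₁ p) → ₁∼₁ (reflect S r s p)
                ; (leftᴿ r) (rightᴿ s) ₁∼₂ → ₁∼₂
                ; (rightᴿ r) (rightᴿ s) (₂∼₂ p) → ₂∼₂ (reflect T r s p) }
  }

-- Uniqueness of packing

private
  pred-∈ : ∀ {u} → IsPacked u → ∀ {k} → suc (suc k) ∈ u → suc k ∈ u
  pred-∈ {u} pu {k} k∈u = Equivalence.from (pu _)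
    (s≤s z≤n , ℕ.≤-trans (ℕ.n≤1+n _) (proj₂ (Equivalence.to (pu _) k∈u)))

  Pointwise-∈ : ∀ {a b r} {A : Set a} {B : Set b} {R : A → B → Set r} {u v x} →
                Pointwise R u v → x ∈ u → ∃ λ y → y ∈ v × R x y
  Pointwise-∈ (r ∷ rs) (here ≡.refl) = _ , here ≡.refl , r
  Pointwise-∈ (r ∷ rs) (there x∈) = Product.map₂ (Product.map₁ there) (Pointwise-∈ rs x∈)

-- A similarity between packed words is the identity: by induction along 1, 2, ...
-- it cannot decrease a letter, and neither can its inverse.
packed-≤ : ∀ {u v} (S : Similarity ℕᵒ ℕᵒ) → IsPacked u → IsPacked v → S ⊢ u ≋ v →
           ∀ {k l} → k ∈ u → l ∈ v → S ⊢ k ∼ l → k ≤ l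
packed-≤ S pu pv p {zero} _ _ _ = z≤n
packed-≤ S pu pv p {suc zero} _ l∈v _ = proj₁ (Equivalence.to (pv _) l∈v)
packed-≤ S pu pv p {suc (suc k)} k∈u l∈v r =
  let l′ , l′∈v , r′ = Pointwise-∈ p (pred-∈ pu k∈u)
  in ℕ.≤-<-trans (packed-≤ S pu pv p (pred-∈ pu k∈u) l′∈v r′)
       (ℕ.≰⇒> (λ l≤l′ → ℕ.<-irrefl ≡.refl (reflect S r r′ l≤l′)))

packed-unique : ∀ {u v} (S : Similarity ℕᵒ ℕᵒ) → IsPacked u → IsPacked v →
                S ⊢ u ≋ v → u ≡ v
packed-unique {u} {v} S pu pv p = go p (λ x∈ → x∈) (λ y∈ → y∈)
  where
  -- Only the suffixes shrink: comparing two letters by `packed-≤` needs the whole packed words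
  -- around them.
  go : ∀ {u′ v′} → S ⊢ u′ ≋ v′ → (∀ {x} → x ∈ u′ → x ∈ u) → (∀ {y} → y ∈ v′ → y ∈ v) → u′ ≡ v′
  go [] _ _ = ≡.refl
  go (r ∷ rs) f g = ≡.cong₂ _∷_
    (ℕ.≤-antisym
      (packed-≤ S pu pv p (f (here ≡.refl)) (g (here ≡.refl)) r)
      (packed-≤ (flip-∼ S) pv pu (flip-≋ S p) (g (here ≡.refl)) (f (here ≡.refl)) r))
    (go rs (f ∘ there) (g ∘ there))

-- Packedness is an irrelevant field and cannot tell two packed words apart.
word-injective : ∀ {u v} → word u ≡ word v → u ≡ v
word-injective {packed u _} {packed _ _} ≡.refl = ≡.refl

module _ (O : Order) where
  open DecTotalOrder O
    using (_≈_; _≟_; module Eq)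
    renaming (Carrier to A; _≤_ to _≼_; _≤?_ to _≼?_; trans to ≼-trans; refl to ≼-refl;
              reflexive to ≼-reflexive)
  open Packing O

  private
    count-mono : ∀ d {x y} → x ≼ y → countBelow d x ≤ countBelow d y
    count-mono [] _ = z≤n
    count-mono (z ∷ d) {x} {y} x≼y with z ≼? x | z ≼? y
    ... | yes _   | yes _ = s≤s (count-mono d x≼y)
    ... | yes z≼x | no ¬p = contradiction (≼-trans z≼x x≼y) ¬p
    ... | no _    | yes _ = ℕ.m≤n⇒m≤1+n (count-mono d x≼y)
    ... | no _    | no _  = count-mono d x≼y

    -- Membership is up to `≈`, because `deduplicate` keeps one representative of each class of
    -- equal letters.
    count-strict : ∀ {d x y} → Any (x ≈_) d → y ≼ x → ¬ (x ≼ y) →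
                   countBelow d y < countBelow d x
    count-strict {z ∷ d} {x} {y} x∈ y≼x x⋠y with z ≼? y | z ≼? x
    count-strict {z ∷ d} (here x≈z) y≼x x⋠y | yes z≼y | _ =
      contradiction (≼-trans (≼-reflexive x≈z) z≼y) x⋠y
    count-strict {z ∷ d} (here x≈z) y≼x x⋠y | no _ | no z⋠x =
      contradiction (≼-reflexive (Eq.sym x≈z)) z⋠x
    count-strict {z ∷ d} (here x≈z) y≼x x⋠y | no _ | yes _ = s≤s (count-mono d y≼x)
    count-strict {z ∷ d} (there x∈) y≼x x⋠y | yes _ | yes _ = s≤s (count-strict x∈ y≼x x⋠y)
    count-strict {z ∷ d} (there x∈) y≼x x⋠y | yes z≼y | no z⋠x =
      contradiction (≼-trans z≼y y≼x) z⋠x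
    count-strict {z ∷ d} (there x∈) y≼x x⋠y | no _ | yes _ =
      ℕ.m≤n⇒m≤1+n (count-strict x∈ y≼x x⋠y)
    count-strict {z ∷ d} (there x∈) y≼x x⋠y | no _ | no _ = count-strict x∈ y≼x x⋠y

    rank-reflect : ∀ w {x y} → x ∈ w → rank w x ≤ rank w y → x ≼ y
    rank-reflect w {x} {y} x∈w r≤ with x ≼? y
    ... | yes x≼y = x≼y
    ... | no x⋠y = contradiction r≤ (ℕ.<⇒≱ (count-strict
      (SetoidMembership.∈-deduplicate⁺ Eq.setoid _≟_ (λ p q → Eq.trans q (Eq.sym p))
        (Any.map Eq.reflexive x∈w))
      (Sum.[ id , (λ x≼y → contradiction x≼y x⋠y) ] (DecTotalOrder.total O y x)) x⋠y))

  -- The restriction to letters of `w` is what makes ranks reflect the order: letters that do not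
  -- occur in `w` may be distinct and have the same rank.
  rank-∼ : List A → Similarity ℕᵒ O
  rank-∼ w = record
    { _∼_     = λ k x → x ∈ w × k ≡ rank w x
    ; mono    = λ { (x∈w , ≡.refl) (_ , ≡.refl) → rank-reflect w x∈w }
    ; reflect = λ { (_ , ≡.refl) (_ , ≡.refl) → count-mono (deduplicate _≟_ w) }
    }

  rank-≋ : ∀ w → rank-∼ w ⊢ word (pack w) ≋ w
  rank-≋ w = go w id
    where
    go : ∀ w′ → (∀ {x} → x ∈ w′ → x ∈ w) → rank-∼ w ⊢ map (rank w) w′ ≋ w′
    go []       f = []
    go (x ∷ w′) f = (f (here ≡.refl) , ≡.refl) ∷ go w′ (f ∘ there)

pack : (O : Order) → List ∣ O ∣ᵒ → PackedWord
pack O = Packing.pack O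

-- Each packing is similar to the word it comes from, so the two packings are similar to each other
-- and `packed-unique` applies. Identities between basis elements are reduced to this by exhibiting
-- a similarity.
pack-cong : ∀ {O P} (S : Similarity O P) {u v} → S ⊢ u ≋ v → pack O u ≡ pack P v
pack-cong {O} {P} S {u} {v} p = word-injective (packed-unique
  (rank-∼ O u ⨾ S ⨾ flip-∼ (rank-∼ P v))
  (Packing.ranks-packed O u) (Packing.ranks-packed P v)
  (⨾-≋ (rank-∼ O u) (S ⨾ flip-∼ (rank-∼ P v)) (rank-≋ O u)
    (⨾-≋ S (flip-∼ (rank-∼ P v)) p (flip-≋ (rank-∼ P v) (rank-≋ P v)))))

packed-pack : ∀ {O} {u : PackedWord} {v} (S : Similarity ℕᵒ O) → S ⊢ word u ≋ v →
              u ≡ pack O v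
-- `pu` is irrelevant; it may be used because equality of words is decidable and can be recomputed.
packed-pack {O} {packed u pu} {v} S p = word-injective (recompute (List.≡-dec ℕ._≟_ _ _)
  (packed-unique (S ⨾ flip-∼ (rank-∼ O v)) pu (Packing.ranks-packed O v)
    (⨾-≋ S (flip-∼ (rank-∼ O v)) p (flip-≋ (rank-∼ O v) (rank-≋ O v)))))

packWord-word : ∀ u → packWord (word u) ≡ u
packWord-word u = ≡.sym (packed-pack id-∼ (Pointwise.refl ≡.refl))

length-pack : ∀ O w → length (word (pack O w)) ≡ length w
length-pack O w = List.length-map _ w

-- Similarities for ordered sums, lexicographic products and marks

inj₁-∼ : ∀ {O P} → Similarity O (O ⊎ᵒ P)
inj₁-∼ = record
  { _∼_     = λ x y → y ≡ inj₁ x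
  ; mono    = λ { ≡.refl ≡.refl → ₁∼₁ }
  ; reflect = λ { ≡.refl ≡.refl (₁∼₁ p) → p }
  }

inj₂-∼ : ∀ {O P} → Similarity P (O ⊎ᵒ P)
inj₂-∼ = record
  { _∼_     = λ x y → y ≡ inj₂ x
  ; mono    = λ { ≡.refl ≡.refl → ₂∼₂ }
  ; reflect = λ { ≡.refl ≡.refl (₂∼₂ p) → p }
  }

map-≋ : ∀ {O P} (S : Similarity O P) (f : ∣ O ∣ᵒ → ∣ P ∣ᵒ) → (∀ x → S ⊢ x ∼ f x) →
        ∀ w → S ⊢ w ≋ map f w
map-≋ S f r []      = []
map-≋ S f r (x ∷ w) = r x ∷ map-≋ S f r w

module _ {O P Q : Order} where
  data ⊎-AssocRel : ∣ (O ⊎ᵒ P) ⊎ᵒ Q ∣ᵒ → ∣ O ⊎ᵒ (P ⊎ᵒ Q) ∣ᵒ → Set where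
    firstᴿ  : ∀ {x} → ⊎-AssocRel (inj₁ (inj₁ x)) (inj₁ x)
    secondᴿ : ∀ {x} → ⊎-AssocRel (inj₁ (inj₂ x)) (inj₂ (inj₁ x))
    thirdᴿ  : ∀ {x} → ⊎-AssocRel (inj₂ x) (inj₂ (inj₂ x))

  ⊎-assoc-∼ : Similarity ((O ⊎ᵒ P) ⊎ᵒ Q) (O ⊎ᵒ (P ⊎ᵒ Q))
  ⊎-assoc-∼ = record
    { _∼_     = ⊎-AssocRel
    ; mono    = λ { firstᴿ  firstᴿ  (₁∼₁ (₁∼₁ p)) → ₁∼₁ p
                  ; firstᴿ  secondᴿ _             → ₁∼₂
                  ; firstᴿ  thirdᴿ  _             → ₁∼₂
                  ; secondᴿ secondᴿ (₁∼₁ (₂∼₂ p)) → ₂∼₂ (₁∼₁ p)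
                  ; secondᴿ thirdᴿ  _             → ₂∼₂ ₁∼₂
                  ; thirdᴿ  thirdᴿ  (₂∼₂ p)       → ₂∼₂ (₂∼₂ p)
                  ; secondᴿ firstᴿ  (₁∼₁ ()) }
    ; reflect = λ { firstᴿ  firstᴿ  (₁∼₁ p)       → ₁∼₁ (₁∼₁ p)
                  ; firstᴿ  secondᴿ _             → ₁∼₁ ₁∼₂
                  ; firstᴿ  thirdᴿ  _             → ₁∼₂
                  ; secondᴿ secondᴿ (₂∼₂ (₁∼₁ p)) → ₁∼₁ (₂∼₂ p)
                  ; secondᴿ thirdᴿ  _             → ₁∼₂
                  ; thirdᴿ  thirdᴿ  (₂∼₂ (₂∼₂ p)) → ₂∼₂ p
                  ; thirdᴿ  secondᴿ (₂∼₂ ()) }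
    }

  ×-assoc-∼ : Similarity ((O ×ᵒ P) ×ᵒ Q) (O ×ᵒ (P ×ᵒ Q))
  ×-assoc-∼ = record
    { _∼_     = λ ((x , y) , z) t → t ≡ (x , y , z)
    ; mono    = λ { ≡.refl ≡.refl (inj₁ (inj₁ p , _)) → inj₁ p
                  ; ≡.refl ≡.refl (inj₁ (inj₂ (e , p) , ne)) →
                      inj₂ (e , inj₁ (p , λ e′ → ne (e , e′)))
                  ; ≡.refl ≡.refl (inj₂ ((e , e′) , p)) → inj₂ (e , inj₂ (e′ , p)) }
    ; reflect = λ { ≡.refl ≡.refl (inj₁ p) → inj₁ (inj₁ p , λ (e , _) → proj₂ p e)
                  ; ≡.refl ≡.refl (inj₂ (e , inj₁ (p , ne))) →
                      inj₁ (inj₂ (e , p) , λ (_ , e′) → ne e′)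
                  ; ≡.refl ≡.refl (inj₂ (e , inj₂ (e′ , p))) → inj₂ ((e , e′) , p) }
    }

module _ {O P : Order} where
  private
    module O = DecTotalOrder O
    module P = DecTotalOrder P
    module OP = DecTotalOrder (O ×ᵒ P)

  lex-proj₁ : ∀ {x y k l} → (x , k) OP.≤ (y , l) → x O.≤ y
  lex-proj₁ (inj₁ (x≤y , _)) = x≤y
  lex-proj₁ (inj₂ (x≈y , _)) = O.reflexive x≈y

  lex⁺ : ∀ {x y k l} → x O.≤ y → k P.≤ l → (x , k) OP.≤ (y , l)
  lex⁺ {x} {y} x≤y k≤l with x O.≟ y
  ... | yes x≈y = inj₂ (x≈y , k≤l)
  ... | no x≉y  = inj₁ (x≤y , x≉y)

  -- Behind both the neutrality of the word 1^n for the internal product and the fact that a word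
  -- without a marked position packs as it did before.
  constʳ-∼ : P.Carrier → Similarity (O ×ᵒ P) O
  constʳ-∼ c = record
    { _∼_     = λ (x , k) y → y ≡ x × k ≡ c
    ; mono    = λ { (≡.refl , ≡.refl) (≡.refl , ≡.refl) → lex-proj₁ }
    ; reflect = λ { (≡.refl , ≡.refl) (≡.refl , ≡.refl) p → lex⁺ p P.refl }
    }

  constˡ-∼ : O.Carrier → Similarity (O ×ᵒ P) P
  constˡ-∼ c = record
    { _∼_     = λ (k , x) y → y ≡ x × k ≡ c
    ; mono    = λ { (≡.refl , ≡.refl) (≡.refl , ≡.refl) (inj₁ (_ , ne)) → contradiction O.Eq.refl ne
                  ; (≡.refl , ≡.refl) (≡.refl , ≡.refl) (inj₂ (_ , p)) → p }
    ; reflect = λ { (≡.refl , ≡.refl) (≡.refl , ≡.refl) p → inj₂ (O.Eq.refl , p) }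
    }

-- Shifting realises an ordered sum of alphabets inside the natural numbers. The bounds `k ≤ m` and
-- `1 ≤ k` keep the two images apart; packed words meet them.
data ShiftRel (m : ℕ) : ℕ → ℕ ⊎ ℕ → Set where
  lowᴿ  : ∀ {k} → k ≤ m → ShiftRel m k (inj₁ k)
  highᴿ : ∀ {k} → 1 ≤ k → ShiftRel m (m +ℕ k) (inj₂ k)

shift-∼ : ℕ → Similarity ℕᵒ (ℕᵒ ⊎ᵒ ℕᵒ)
shift-∼ m = record
  { _∼_     = ShiftRel m
  ; mono    = λ { (lowᴿ _) (lowᴿ _) p → ₁∼₁ p
                ; (lowᴿ _) (highᴿ _) _ → ₁∼₂
                ; (highᴿ _) (highᴿ _) p → ₂∼₂ (ℕ.+-cancelˡ-≤ m _ _ p)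
                ; (highᴿ {k} 1≤k) (lowᴿ l≤m) p →
                    contradiction (ℕ.≤-trans p l≤m) (ℕ.<⇒≱ (ℕ.m<m+n m 1≤k)) }
  ; reflect = λ { (lowᴿ _) (lowᴿ _) (₁∼₁ p) → p
                ; (lowᴿ k≤m) (highᴿ _) _ → ℕ.≤-trans k≤m (ℕ.m≤m+n m _)
                ; (highᴿ _) (highᴿ _) (₂∼₂ p) → ℕ.+-monoʳ-≤ m p }
  }

-- In the lexicographic order a marked letter precedes the unmarked copies of the same letter.
marked unmarked : ∀ {a} {A : Set a} → A → A × ℕ
marked x   = x , 0
unmarked x = x , 1

-- In the product of N_1 with the word of ones, the single letter of the first factor plays the mark
-- `0` and the letters of the second factor play the `1` of the unmarked positions.
data MarkRel : ℕ ⊎ ℕ → ℕ → Set where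
  markᴿ   : MarkRel (inj₁ 1) 0
  unmarkᴿ : MarkRel (inj₂ 1) 1

mark-∼ : Similarity (ℕᵒ ⊎ᵒ ℕᵒ) ℕᵒ
mark-∼ = record
  { _∼_     = MarkRel
  ; mono    = λ { markᴿ markᴿ _ → z≤n ; markᴿ unmarkᴿ _ → z≤n ; unmarkᴿ unmarkᴿ _ → ℕ.≤-refl }
  ; reflect = λ { markᴿ markᴿ _ → ₁∼₁ ℕ.≤-refl ; markᴿ unmarkᴿ _ → ₁∼₂
                ; unmarkᴿ unmarkᴿ _ → ₂∼₂ ℕ.≤-refl }
  }

module _ {O P : Order} where
  private
    module O = DecTotalOrder O
    module P = DecTotalOrder P

  -- The mark falls on one factor of a product; the letters of the other factor all carry the
  -- component `1`, which can then be dropped.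
  data MarkLeftRel : ∣ (O ⊎ᵒ P) ×ᵒ ℕᵒ ∣ᵒ → ∣ (O ×ᵒ ℕᵒ) ⊎ᵒ P ∣ᵒ → Set where
    leftᴿ  : ∀ {x k} → MarkLeftRel (inj₁ x , k) (inj₁ (x , k))
    rightᴿ : ∀ {y} → MarkLeftRel (inj₂ y , 1) (inj₂ y)

  markLeft-∼ : Similarity ((O ⊎ᵒ P) ×ᵒ ℕᵒ) ((O ×ᵒ ℕᵒ) ⊎ᵒ P)
  markLeft-∼ = record
    { _∼_     = MarkLeftRel
    ; mono    = λ { leftᴿ leftᴿ (inj₁ (₁∼₁ p , ne)) → ₁∼₁ (inj₁ (p , λ e → ne (≈₁ e)))
                  ; leftᴿ leftᴿ (inj₂ (≈₁ e , p)) → ₁∼₁ (inj₂ (e , p))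
                  ; leftᴿ rightᴿ _ → ₁∼₂
                  ; rightᴿ rightᴿ p → ₂∼₂ (case (lex-proj₁ {O ⊎ᵒ P} {ℕᵒ} p))
                  ; rightᴿ leftᴿ (inj₁ (() , _))
                  ; rightᴿ leftᴿ (inj₂ (() , _)) }
    ; reflect = λ { leftᴿ leftᴿ (₁∼₁ (inj₁ (p , ne))) → inj₁ (₁∼₁ p , λ { (≈₁ e) → ne e })
                  ; leftᴿ leftᴿ (₁∼₁ (inj₂ (e , p))) → inj₂ (≈₁ e , p)
                  ; leftᴿ rightᴿ _ → inj₁ (₁∼₂ , λ ())
                  ; rightᴿ rightᴿ (₂∼₂ p) → lex⁺ {O ⊎ᵒ P} {ℕᵒ} (₂∼₂ p) ℕ.≤-refl }
    }
    where
    case : ∀ {x y} → DecTotalOrder._≤_ (O ⊎ᵒ P) (inj₂ x) (inj₂ y) → x P.≤ y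
    case (₂∼₂ p) = p

  data MarkRightRel : ∣ (O ⊎ᵒ P) ×ᵒ ℕᵒ ∣ᵒ → ∣ O ⊎ᵒ (P ×ᵒ ℕᵒ) ∣ᵒ → Set where
    leftᴿ  : ∀ {x} → MarkRightRel (inj₁ x , 1) (inj₁ x)
    rightᴿ : ∀ {y k} → MarkRightRel (inj₂ y , k) (inj₂ (y , k))

  markRight-∼ : Similarity ((O ⊎ᵒ P) ×ᵒ ℕᵒ) (O ⊎ᵒ (P ×ᵒ ℕᵒ))
  markRight-∼ = record
    { _∼_     = MarkRightRel
    ; mono    = λ { rightᴿ rightᴿ (inj₁ (₂∼₂ p , ne)) → ₂∼₂ (inj₁ (p , λ e → ne (≈₂ e)))
                  ; rightᴿ rightᴿ (inj₂ (≈₂ e , p)) → ₂∼₂ (inj₂ (e , p))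
                  ; leftᴿ rightᴿ _ → ₁∼₂
                  ; leftᴿ leftᴿ p → ₁∼₁ (case (lex-proj₁ {O ⊎ᵒ P} {ℕᵒ} p))
                  ; rightᴿ leftᴿ (inj₁ (() , _))
                  ; rightᴿ leftᴿ (inj₂ (() , _)) }
    ; reflect = λ { rightᴿ rightᴿ (₂∼₂ (inj₁ (p , ne))) → inj₁ (₂∼₂ p , λ { (≈₂ e) → ne e })
                  ; rightᴿ rightᴿ (₂∼₂ (inj₂ (e , p))) → inj₂ (≈₂ e , p)
                  ; leftᴿ rightᴿ _ → inj₁ (₁∼₂ , λ ())
                  ; leftᴿ leftᴿ (₁∼₁ p) → lex⁺ {O ⊎ᵒ P} {ℕᵒ} (₁∼₁ p) ℕ.≤-refl }
    }
    where
    case : ∀ {x y} → DecTotalOrder._≤_ (O ⊎ᵒ P) (inj₁ x) (inj₁ y) → x O.≤ y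
    case (₁∼₁ p) = p

-- Letters occurring exactly once

module _ (O : Order) where
  open DecTotalOrder O using (_≈_; _≟_; module Eq) renaming (Carrier to A)

  -- An inductive form of `HasSingleton` over any alphabet, which can be followed through
  -- interleavings, cuts and similarities before anything is packed.
  data Once (x : A) : List A → Set where
    here  : ∀ {w} → All (λ y → ¬ x ≈ y) w → Once x (x ∷ w)
    there : ∀ {y w} → ¬ x ≈ y → Once x w → Once x (y ∷ w)

  Once-++ : ∀ {x} u {v} → Once x (u ++ v) → Once x u ⊎ Once x v
  Once-++ []      o           = inj₂ o
  Once-++ (_ ∷ u) (here p)    = inj₁ (here (All.++⁻ˡ u p))
  Once-++ (_ ∷ u) (there p o) = Sum.map₁ (there p) (Once-++ u o)

  ++-Once : ∀ {x} u {v} → All (λ y → ¬ x ≈ y) u → All (λ y → ¬ x ≈ y) v →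
            Once x (u ++ x ∷ v)
  ++-Once []      _        q = here q
  ++-Once (_ ∷ u) (p ∷ ps) q = there p (++-Once u ps q)

  private
    all-interleave : ∀ {P : A → Set} {u v w} → Interleaving u v w → All P u → All P v → All P w
    all-interleave []           _        _        = []
    all-interleave (consˡ i)    (p ∷ ps) qs       = p ∷ all-interleave i ps qs
    all-interleave (consʳ i)    ps       (q ∷ qs) = q ∷ all-interleave i ps qs

  Once-interleaveˡ : ∀ {x u v w} → Interleaving u v w → Once x u → All (λ y → ¬ x ≈ y) v → Once x w
  Once-interleaveˡ (consˡ i) (here p)    q        = here (all-interleave i p q)
  Once-interleaveˡ (consˡ i) (there p o) q        = there p (Once-interleaveˡ i o q)
  Once-interleaveˡ (consʳ i) o           (p ∷ q)  = there p (Once-interleaveˡ i o q)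

  Once-interleaveʳ : ∀ {x u v w} → Interleaving u v w → All (λ y → ¬ x ≈ y) u → Once x v → Once x w
  Once-interleaveʳ (consʳ i) q        (here p)    = here (all-interleave i q p)
  Once-interleaveʳ (consʳ i) q        (there p o) = there p (Once-interleaveʳ i q o)
  Once-interleaveʳ (consˡ i) (p ∷ q)  o           = there p (Once-interleaveʳ i q o)

  count : A → List A → ℕ
  count x w = length (filter (x ≟_) w)

  equalPairs : List A → ℕ
  equalPairs []      = 0
  equalPairs (x ∷ w) = count x w +ℕ equalPairs w

  count-++ : ∀ x u v → count x (u ++ v) ≡ count x u +ℕ count x v
  count-++ x u v = ≡.trans (≡.cong length (List.filter-++ (x ≟_) u v))
                           (List.length-++ (filter (x ≟_) u))

  count-none : ∀ {x w} → All (λ y → ¬ x ≈ y) w → count x w ≡ 0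
  count-none {x} p = ≡.cong length (List.filter-none (x ≟_) p)

  count-some : ∀ {x w} → Any (x ≈_) w → 1 ≤ count x w
  count-some {x} {w} p = List.filter-some (x ≟_) p

module _ {O P : Order} (S : Similarity O P) where
  private
    module O = DecTotalOrder O
    module P = DecTotalOrder P
  open Similarity S using (≈-mono; ≈-reflect)

  Once-≋ : ∀ {u v x} → S ⊢ u ≋ v → Once O x u → ∃ λ y → (S ⊢ x ∼ y) × Once P y v
  Once-≋ (r ∷ rs) (here p) = _ , r , here (go rs p)
    where
    go : ∀ {u v} → S ⊢ u ≋ v → All (λ y → ¬ _ O.≈ y) u → All (λ y → ¬ _ P.≈ y) v
    go []       []       = []
    go (s ∷ ss) (p ∷ ps) = (λ e → p (≈-reflect r s e)) ∷ go ss ps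
  Once-≋ (r ∷ rs) (there p o) with Once-≋ rs o
  ... | y , s , o′ = y , s , there (λ e → p (≈-reflect s r e)) o′

  count-≋ : ∀ {u v x y} → S ⊢ x ∼ y → S ⊢ u ≋ v → count O x u ≡ count P y v
  count-≋ {x = x} {y} r rs = Pointwise.Pointwise-length
    (Pointwise.filter⁺ (x O.≟_) (y P.≟_) (≈-mono r) (≈-reflect r) rs)

  equalPairs-≋ : ∀ {u v} → S ⊢ u ≋ v → equalPairs O u ≡ equalPairs P v
  equalPairs-≋ []       = ≡.refl
  equalPairs-≋ (r ∷ rs) = ≡.cong₂ _+ℕ_ (count-≋ r rs) (equalPairs-≋ rs)

module _ {O P : Order} where
  private
    module O = DecTotalOrder O
    module P = DecTotalOrder P

  -- Biletters with different first components are different, whatever stands in the second word.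
  -- Hence the singleton words absorb internal products on the right.
  Once-zipˡ : ∀ {x u} v → length u ≡ length v → Once O x u → ∃ λ y → Once (O ×ᵒ P) (x , y) (zip u v)
  Once-zipˡ {u = _ ∷ u} (y ∷ v) eq (here p) = y , here (go u v p)
    where
    go : ∀ u v → All (λ z → ¬ _ O.≈ z) u → All (λ z → ¬ DecTotalOrder._≈_ (O ×ᵒ P) _ z) (zip u v)
    go []      v       _        = []
    go (_ ∷ u) []      _        = []
    go (_ ∷ u) (_ ∷ v) (p ∷ ps) = (λ (e , _) → p e) ∷ go u v ps
  Once-zipˡ (y ∷ v) eq (there p o) = Product.map₂ (there (λ (e , _) → p e))
    (Once-zipˡ v (ℕ.suc-injective eq) o)

Once⇒HasSingleton : ∀ {O w x} → Once O x w → HasSingleton (pack O w)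
Once⇒HasSingleton {O} {w} o with Once-≋ (flip-∼ (rank-∼ O w)) (flip-≋ (rank-∼ O w) (rank-≋ O w)) o
... | a , _ , o′ = a , go o′
  where
  go : ∀ {a v} → Once ℕᵒ a v → length (filter (a ℕ.≟_) v) ≡ 1
  go {a} (here p) = ≡.trans (≡.cong length (List.filter-accept (a ℕ.≟_) ≡.refl))
    (≡.cong suc (count-none ℕᵒ p))
  go {a} (there p o) = ≡.trans (≡.cong length (List.filter-reject (a ℕ.≟_) p)) (go o)

HasSingleton⇒Once : ∀ u → HasSingleton u → ∃ λ a → Once ℕᵒ a (word u)
HasSingleton⇒Once u (a , eq) = a , go (word u) eq
  where
  none : ∀ v → length (filter (a ℕ.≟_) v) ≡ 0 → All (a ≢_) v
  none []      _  = []
  none (x ∷ v) eq = a≢x ∷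
    none v (≡.trans (≡.cong length (≡.sym (List.filter-reject (a ℕ.≟_) a≢x))) eq)
    where
    a≢x : a ≢ x
    a≢x a≡x with ≡.trans (≡.cong length (≡.sym (List.filter-accept (a ℕ.≟_) {x} {v} a≡x))) eq
    ... | ()
  go : ∀ v → length (filter (a ℕ.≟_) v) ≡ 1 → Once ℕᵒ a v
  split : ∀ x v → Dec (a ≡ x) → length (filter (a ℕ.≟_) (x ∷ v)) ≡ 1 → Once ℕᵒ a (x ∷ v)
  go (x ∷ v) eq = split x v (a ℕ.≟ x) eq
  split x v (yes ≡.refl) eq = here (none v (ℕ.suc-injective
    (≡.trans (≡.cong length (≡.sym (List.filter-accept (a ℕ.≟_) ≡.refl))) eq)))
  split x v (no a≢x) eq = there a≢x
    (go v (≡.trans (≡.cong length (≡.sym (List.filter-reject (a ℕ.≟_) a≢x))) eq))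

-- Marking one position of a word

markAt : ∀ {a} {A : Set a} → List A → A → List A → List (A × ℕ)
markAt l x r = map unmarked l ++ marked x ∷ map unmarked r

module _ (O : Order) where
  open DecTotalOrder O using (_≈_; _≟_; module Eq) renaming (Carrier to A)

  private
    Oℕ = O ×ᵒ ℕᵒ

  marked-Once : ∀ l x r → Once Oℕ (marked x) (markAt l x r)
  marked-Once l x r = ++-Once Oℕ (map unmarked l) (go l) (go r)
    where
    go : ∀ w → All (λ y → ¬ DecTotalOrder._≈_ Oℕ (marked x) y) (map unmarked w)
    go []      = []
    go (y ∷ w) = (λ ()) ∷ go w

  Alone : List A → A → List A → Set
  Alone l x r = All (λ y → ¬ x ≈ y) l × All (λ y → ¬ x ≈ y) r

  Once⇒Alone : ∀ {x w} → Once O x w → ∃ λ l → ∃ λ r → w ≡ l ++ x ∷ r × Alone l x r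
  Once⇒Alone (here p) = [] , _ , ≡.refl , [] , p
  Once⇒Alone (there {y} p o) with Once⇒Alone o
  ... | l , r , ≡.refl , q , q′ = y ∷ l , r , ≡.refl , p ∷ q , q′

  private
    data AloneRel (a : A) : A × ℕ → A → Set where
      selfᴿ  : AloneRel a (marked a) a
      otherᴿ : ∀ {x} → ¬ a ≈ x → AloneRel a (unmarked x) x

    alone-∼ : A → Similarity Oℕ O
    alone-∼ a = record
      { _∼_     = AloneRel a
      ; mono    = λ { selfᴿ selfᴿ → lex-proj₁ {O} {ℕᵒ} ; selfᴿ (otherᴿ _) → lex-proj₁ {O} {ℕᵒ}
                    ; (otherᴿ _) selfᴿ → lex-proj₁ {O} {ℕᵒ} ; (otherᴿ _) (otherᴿ _) → lex-proj₁ {O} {ℕᵒ} }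
      ; reflect = λ { selfᴿ selfᴿ p → lex⁺ {O} {ℕᵒ} p z≤n ; selfᴿ (otherᴿ _) p → lex⁺ {O} {ℕᵒ} p z≤n
                    ; (otherᴿ ne) selfᴿ p → inj₁ (p , λ e → ne (Eq.sym e))
                    ; (otherᴿ _) (otherᴿ _) p → lex⁺ {O} {ℕᵒ} p ℕ.≤-refl }
      }

    unmarked-≋ : ∀ w → constʳ-∼ {O} {ℕᵒ} 1 ⊢ map unmarked w ≋ w
    unmarked-≋ []      = []
    unmarked-≋ (x ∷ w) = (≡.refl , ≡.refl) ∷ unmarked-≋ w

  pack-unmarked : ∀ w → pack Oℕ (map unmarked w) ≡ pack O w
  pack-unmarked w = pack-cong (constʳ-∼ {O} {ℕᵒ} 1) (unmarked-≋ w)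

  -- A mark separates a letter from its equal copies. With no copies there is nothing to separate,
  -- and the marked letter takes the place of the old one in the order.
  Alone⇒pack : ∀ {l x r} → Alone l x r → pack Oℕ (markAt l x r) ≡ pack O (l ++ x ∷ r)
  Alone⇒pack {l} {x} {r} (p , q) = pack-cong (alone-∼ x) (go l p)
    where
    others : ∀ {w} → All (λ y → ¬ x ≈ y) w → alone-∼ x ⊢ map unmarked w ≋ w
    others []       = []
    others (p ∷ ps) = otherᴿ p ∷ others ps
    go : ∀ l → All (λ y → ¬ x ≈ y) l → alone-∼ x ⊢ markAt l x r ≋ l ++ x ∷ r
    go []      _        = selfᴿ ∷ others q
    go (_ ∷ l) (p ∷ ps) = otherᴿ p ∷ go l ps

  private
    count-unmarked : ∀ y w → count Oℕ (unmarked y) (map unmarked w) ≡ count O y w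
    count-unmarked y w = count-≋ (constʳ-∼ {O} {ℕᵒ} 1) (≡.refl , ≡.refl) (unmarked-≋ w)

    count-markAt : ∀ y l x r → count Oℕ (unmarked y) (markAt l x r) ≡ count O y (l ++ r)
    count-markAt y l x r = ≡.trans (count-++ Oℕ _ (map unmarked l) _)
      (≡.trans (≡.cong₂ _+ℕ_ (count-unmarked y l)
        (≡.trans (≡.cong length (List.filter-reject (DecTotalOrder._≟_ Oℕ (unmarked y)) (λ ())))
                 (count-unmarked y r)))
        (≡.sym (count-++ O y l r)))

    count-insert : ∀ y l x r → count O y (l ++ r) ≤ count O y (l ++ x ∷ r)
    count-insert y l x r = ≡.subst₂ _≤_ (≡.sym (count-++ O y l r)) (≡.sym (count-++ O y l (x ∷ r)))
      (ℕ.+-monoʳ-≤ (count O y l) tail)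
      where
      tail : count O y r ≤ count O y (x ∷ r)
      tail with y ≟ x
      ... | yes _ = ℕ.n≤1+n _
      ... | no  _ = ℕ.≤-refl

    count-insert-< : ∀ {y x} l r → y ≈ x → count O y (l ++ r) < count O y (l ++ x ∷ r)
    count-insert-< {y} {x} l r e =
      ≡.subst₂ _<_ (≡.sym (count-++ O y l r)) (≡.sym (count-++ O y l (x ∷ r)))
        (ℕ.+-monoʳ-< (count O y l)
          (ℕ.≤-reflexive (≡.sym (≡.cong length (List.filter-accept (y ≟_) e)))))

    equalPairs-tail : ∀ x r → equalPairs Oℕ (markAt [] x r) ≡ equalPairs O r
    equalPairs-tail x r = ≡.cong₂ _+ℕ_ (none r)
      (equalPairs-≋ (constʳ-∼ {O} {ℕᵒ} 1) (unmarked-≋ r))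
      where
      none : ∀ w → count Oℕ (marked x) (map unmarked w) ≡ 0
      none w = count-none Oℕ (All.map⁺ (All.universal (λ _ ()) w))

    equalPairs-markAt-≤ : ∀ l x r → equalPairs Oℕ (markAt l x r) ≤ equalPairs O (l ++ x ∷ r)
    equalPairs-markAt-≤ [] x r = ≡.subst (_≤ equalPairs O (x ∷ r)) (≡.sym (equalPairs-tail x r))
      (ℕ.m≤n+m _ (count O x r))
    equalPairs-markAt-≤ (y ∷ l) x r = ℕ.+-mono-≤
      (≡.subst (_≤ count O y (l ++ x ∷ r)) (≡.sym (count-markAt y l x r)) (count-insert y l x r))
      (equalPairs-markAt-≤ l x r)

  -- Marking destroys exactly the equal pairs that contain the marked position and creates none; the
  -- hypothesis provides one such pair.
  equalPairs-markAt : ∀ l x r → Any (x ≈_) (l ++ r) →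
                      equalPairs Oℕ (markAt l x r) < equalPairs O (l ++ x ∷ r)
  equalPairs-markAt [] x r p = ≡.subst (_< equalPairs O (x ∷ r)) (≡.sym (equalPairs-tail x r))
    (ℕ.+-monoˡ-≤ (equalPairs O r) (count-some O p))
  equalPairs-markAt (y ∷ l) x r (here e) = ℕ.+-mono-<-≤
    (≡.subst (_< count O y (l ++ x ∷ r)) (≡.sym (count-markAt y l x r))
      (count-insert-< l r (Eq.sym e)))
    (equalPairs-markAt-≤ l x r)
  equalPairs-markAt (y ∷ l) x r (there p) = ℕ.+-mono-≤-<
    (≡.subst (_≤ count O y (l ++ x ∷ r)) (≡.sym (count-markAt y l x r)) (count-insert y l x r))
    (equalPairs-markAt l x r p)

-- Linear maps, tensor products and bilinear maps

module LinearAlgebra {c ℓ} (R : CommutativeRing c ℓ) where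
  module R = CommutativeRing R
  open HopfAlgebras R public
  open LeftModuleMorphisms public using (IsLeftModuleHomomorphism)

  Module : ∀ m ℓm → Set (c ⊔ ℓ ⊔ lsuc (m ⊔ ℓm))
  Module = LeftModule R.ring

  raw : ∀ {m ℓm} → Module m ℓm → RawLeftModule R.Carrier m ℓm
  raw = LeftModule.rawLeftModule

  scalars : Module c ℓ
  scalars = TensorUnit.leftModule {R = R.ring}

  module ModuleReasoning {m ℓm} (M : Module m ℓm) where
    open LeftModule M public
    open SetoidReasoning ≈ᴹ-setoid public
    open LeftModuleProperties M public
    open CommutativeMonoid +ᴹ-commutativeMonoid using (commutativeSemigroup)
    open CommutativeSemigroupProperties commutativeSemigroup public using (interchange)

    -ᴹ≈-1*ₗ : ∀ x → -ᴹ x ≈ᴹ (R.- R.1#) *ₗ x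
    -ᴹ≈-1*ₗ x = ≈ᴹ-sym (inverseˡ-uniqueᴹ _ _ (begin
      (R.- R.1#) *ₗ x +ᴹ x           ≈⟨ +ᴹ-congˡ (*ₗ-identityˡ x) ⟨
      (R.- R.1#) *ₗ x +ᴹ R.1# *ₗ x   ≈⟨ *ₗ-distribʳ x _ _ ⟨
      ((R.- R.1#) R.+ R.1#) *ₗ x     ≈⟨ *ₗ-cong (R.-‿inverseˡ R.1#) ≈ᴹ-refl ⟩
      R.0# *ₗ x                      ≈⟨ *ₗ-zeroˡ x ⟩
      0ᴹ                             ∎))

    -ᴹ-0ᴹ : -ᴹ 0ᴹ ≈ᴹ 0ᴹ
    -ᴹ-0ᴹ = ≈ᴹ-trans (-ᴹ≈-1*ₗ 0ᴹ) (*ₗ-zeroʳ _)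

    *ₗ-swap : ∀ j k x → j *ₗ k *ₗ x ≈ᴹ k *ₗ j *ₗ x
    *ₗ-swap j k x = ≈ᴹ-trans (≈ᴹ-sym (*ₗ-assoc j k x))
      (≈ᴹ-trans (*ₗ-cong (R.*-comm j k) ≈ᴹ-refl) (*ₗ-assoc k j x))

    x-y≈0⇒x≈y : ∀ {x y} → x +ᴹ -ᴹ y ≈ᴹ 0ᴹ → x ≈ᴹ y
    x-y≈0⇒x≈y {x} {y} eq = ≈ᴹ-trans (inverseˡ-uniqueᴹ x (-ᴹ y) eq) (-ᴹ-involutive y)

    x≈y⇒x-y≈0 : ∀ {x y} → x ≈ᴹ y → x +ᴹ -ᴹ y ≈ᴹ 0ᴹ
    x≈y⇒x-y≈0 {x} {y} eq = ≈ᴹ-trans (+ᴹ-congʳ eq) (-ᴹ‿inverseʳ y)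

  -- Zero and negatives are the multiples by 0 and -1, so three laws suffice; `isHomomorphism`
  -- restores the form in which the Hopf algebra axioms ask for linearity.
  record Linear {m ℓm n ℓn} (M : Module m ℓm) (N : Module n ℓn)
                (f : LeftModule.Carrierᴹ M → LeftModule.Carrierᴹ N) :
                Set (c ⊔ m ⊔ ℓm ⊔ ℓn) where
    private
      module M = ModuleReasoning M
      module N = ModuleReasoning N
    field
      cong : ∀ {x y} → x M.≈ᴹ y → f x N.≈ᴹ f y
      +-homo  : ∀ x y → f (x M.+ᴹ y) N.≈ᴹ f x N.+ᴹ f y
      *ₗ-homo  : ∀ k x → f (k M.*ₗ x) N.≈ᴹ k N.*ₗ f x

    zero-homo : f M.0ᴹ N.≈ᴹ N.0ᴹ
    zero-homo = N.≈ᴹ-trans (cong (M.≈ᴹ-sym (M.*ₗ-zeroˡ M.0ᴹ)))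
      (N.≈ᴹ-trans (*ₗ-homo R.0# M.0ᴹ) (N.*ₗ-zeroˡ _))

    neg-homo : ∀ x → f (M.-ᴹ x) N.≈ᴹ N.-ᴹ f x
    neg-homo x = N.≈ᴹ-trans (cong (M.-ᴹ≈-1*ₗ x))
      (N.≈ᴹ-trans (*ₗ-homo _ x) (N.≈ᴹ-sym (N.-ᴹ≈-1*ₗ (f x))))

    isHomomorphism : IsLeftModuleHomomorphism (raw M) (raw N) f
    isHomomorphism = record
      { +ᴹ-isGroupHomomorphism = record
        { isMonoidHomomorphism = record
          { isMagmaHomomorphism = record
            { isRelHomomorphism = record { cong = cong }
            ; homo = +-homo
            }
          ; ε-homo = zero-homo
          }
        ; ⁻¹-homo = neg-homo
        }
      ; *ₗ-homo = *ₗ-homo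
      }

  module _ {m ℓm n ℓn} {M : Module m ℓm} {N : Module n ℓn} where
    private
      module M = ModuleReasoning M
      module N = ModuleReasoning N

    fromHomomorphism : ∀ {f} → IsLeftModuleHomomorphism (raw M) (raw N) f → Linear M N f
    fromHomomorphism h = record { cong = ⟦⟧-cong ; +-homo = +ᴹ-homo ; *ₗ-homo = *ₗ-homo }
      where open IsLeftModuleHomomorphism h

    linear-≈ : ∀ {f g} → Linear M N f → (∀ x → f x N.≈ᴹ g x) → Linear M N g
    linear-≈ F e = record
      { cong = λ p → N.≈ᴹ-trans (N.≈ᴹ-sym (e _)) (N.≈ᴹ-trans (F.cong p) (e _))
      ; +-homo  = λ x y → N.≈ᴹ-trans (N.≈ᴹ-sym (e _))
          (N.≈ᴹ-trans (F.+-homo x y) (N.+ᴹ-cong (e x) (e y)))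
      ; *ₗ-homo  = λ k x → N.≈ᴹ-trans (N.≈ᴹ-sym (e _))
          (N.≈ᴹ-trans (F.*ₗ-homo k x) (N.*ₗ-cong R.refl (e x)))
      }
      where module F = Linear F

    0-linear : Linear M N (λ _ → N.0ᴹ)
    0-linear = record
      { cong = λ _ → N.≈ᴹ-refl
      ; +-homo  = λ _ _ → N.≈ᴹ-sym (N.+ᴹ-identityˡ _)
      ; *ₗ-homo  = λ k _ → N.≈ᴹ-sym (N.*ₗ-zeroʳ k)
      }

    +-linear : ∀ {f g} → Linear M N f → Linear M N g → Linear M N (λ x → f x N.+ᴹ g x)
    +-linear F G = record
      { cong = λ p → N.+ᴹ-cong (F.cong p) (G.cong p)
      ; +-homo  = λ x y → N.≈ᴹ-trans (N.+ᴹ-cong (F.+-homo x y) (G.+-homo x y)) (N.interchange _ _ _ _)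
      ; *ₗ-homo  = λ k x → N.≈ᴹ-trans (N.+ᴹ-cong (F.*ₗ-homo k x) (G.*ₗ-homo k x))
          (N.≈ᴹ-sym (N.*ₗ-distribˡ k _ _))
      }
      where
      module F = Linear F
      module G = Linear G

    *ₗ-linear : ∀ {f} j → Linear M N f → Linear M N (λ x → j N.*ₗ f x)
    *ₗ-linear j F = record
      { cong = λ p → N.*ₗ-cong R.refl (F.cong p)
      ; +-homo  = λ x y → N.≈ᴹ-trans (N.*ₗ-cong R.refl (F.+-homo x y)) (N.*ₗ-distribˡ j _ _)
      ; *ₗ-homo  = λ k x → N.≈ᴹ-trans (N.*ₗ-cong R.refl (F.*ₗ-homo k x)) (N.*ₗ-swap j k _)
      }
      where module F = Linear F

    -linear : ∀ {f} → Linear M N f → Linear M N (λ x → N.-ᴹ f x)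
    -linear F = linear-≈ (*ₗ-linear (R.- R.1#) F) (λ x → N.≈ᴹ-sym (N.-ᴹ≈-1*ₗ _))

  id-linear : ∀ {m ℓm} {M : Module m ℓm} → Linear M M id
  id-linear {M = M} = record { cong = id ; +-homo = λ _ _ → ≈ᴹ-refl ; *ₗ-homo = λ _ _ → ≈ᴹ-refl }
    where open LeftModule M

  infixr 9 _∘ᴸ_
  _∘ᴸ_ : ∀ {m ℓm n ℓn p ℓp} {M : Module m ℓm} {N : Module n ℓn} {P : Module p ℓp} {g f} →
         Linear N P g → Linear M N f → Linear M P (g ∘ f)
  _∘ᴸ_ {P = P} G F = record
    { cong = G.cong ∘ F.cong
    ; +-homo  = λ x y → ≈ᴹ-trans (G.cong (F.+-homo x y)) (G.+-homo _ _)
    ; *ₗ-homo  = λ k x → ≈ᴹ-trans (G.cong (F.*ₗ-homo k x)) (G.*ₗ-homo k _)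
    }
    where
    open LeftModule P
    module F = Linear F
    module G = Linear G

  module _ {m ℓm n ℓn} (M : Module m ℓm) (N : Module n ℓn) where
    private
      module M = LeftModule M
      module N = LeftModule N

      Elements : Set (m ⊔ n)
      Elements = List (M.Carrierᴹ × N.Carrierᴹ)

      infix 4 _≈_
      _≈_ : Elements → Elements → Set (c ⊔ m ⊔ n ⊔ ℓm ⊔ ℓn)
      _≈_ = TensorEq (raw M) (raw N)

      ≡⇒≈ : ∀ {s t} → s ≡ t → s ≈ t
      ≡⇒≈ ≡.refl = ≈-refl

      act : R.Carrier → Elements → Elements
      act k = map (Product.map₁ (k M.*ₗ_))

      act-cong : ∀ {j k s t} → j R.≈ k → s ≈ t → act j s ≈ act k t
      act-cong {j} {k} {s} j≈k s≈t = ≈-trans (left s) (right s≈t)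
        where
        left : ∀ s → act j s ≈ act k s
        left [] = ≈-refl
        left ((x , y) ∷ s) = ++-cong (⊗-cong (M.*ₗ-cong j≈k M.≈ᴹ-refl) N.≈ᴹ-refl) (left s)
        right : ∀ {s t} → s ≈ t → act k s ≈ act k t
        right ≈-refl = ≈-refl
        right (≈-sym p) = ≈-sym (right p)
        right (≈-trans p q) = ≈-trans (right p) (right q)
        right (++-cong {s} {s′} p q) = ≈-trans (≡⇒≈ (List.map-++ _ s _))
          (≈-trans (++-cong (right p) (right q)) (≡⇒≈ (≡.sym (List.map-++ _ s′ _))))
        right (++-comm s t) = ≈-trans (≡⇒≈ (List.map-++ _ s t))
          (≈-trans (++-comm (act k s) (act k t)) (≡⇒≈ (≡.sym (List.map-++ _ t s))))
        right (⊗-cong p q) = ⊗-cong (M.*ₗ-cong R.refl p) q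
        right (distribʳ x x′ y) = ≈-trans (⊗-cong (M.*ₗ-distribˡ k x x′) N.≈ᴹ-refl) (distribʳ _ _ _)
        right (distribˡ x y y′) = distribˡ _ _ _
        -- The scalar `k` is moved to the second factor, exchanged there with `j`, and moved back;
        -- this uses commutativity of the ring.
        right (balanced j x y) = ≈-trans (balanced k _ y)
          (≈-trans (balanced j x _)
          (≈-trans (⊗-cong M.≈ᴹ-refl (N.≈ᴹ-trans (N.≈ᴹ-sym (N.*ₗ-assoc j k y))
            (N.≈ᴹ-trans (N.*ₗ-cong (R.*-comm j k) N.≈ᴹ-refl) (N.*ₗ-assoc k j y))))
            (≈-sym (balanced k x _))))
        right (zeroˡ y) = ≈-trans (⊗-cong (M.*ₗ-zeroʳ k) N.≈ᴹ-refl) (zeroˡ y)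
        right (zeroʳ x) = zeroʳ _

      act-+ : ∀ s j k → act (j R.+ k) s ≈ act j s ++ act k s
      act-+ [] j k = ≈-refl
      act-+ ((x , y) ∷ s) j k = ≈-trans
        (++-cong (≈-trans (⊗-cong (M.*ₗ-distribʳ x j k) N.≈ᴹ-refl) (distribʳ _ _ y)) (act-+ s j k))
        (++-cong (≈-refl {s = [ j M.*ₗ x , y ]})
          (≈-trans (≡⇒≈ (≡.sym (List.++-assoc [ k M.*ₗ x , y ] (act j s) (act k s))))
          (≈-trans (++-cong (++-comm [ k M.*ₗ x , y ] (act j s)) ≈-refl)
            (≡⇒≈ (List.++-assoc (act j s) [ k M.*ₗ x , y ] (act k s))))))

      act-0 : ∀ s → act R.0# s ≈ []
      act-0 [] = ≈-refl
      act-0 ((x , y) ∷ s) = ++-cong (≈-trans (⊗-cong (M.*ₗ-zeroˡ x) N.≈ᴹ-refl) (zeroˡ y)) (act-0 s)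

      act-1 : ∀ s → act R.1# s ≈ s
      act-1 [] = ≈-refl
      act-1 ((x , y) ∷ s) = ++-cong (⊗-cong (M.*ₗ-identityˡ x) N.≈ᴹ-refl) (act-1 s)

      act-assoc : ∀ j k s → act (j R.* k) s ≈ act j (act k s)
      act-assoc j k [] = ≈-refl
      act-assoc j k ((x , y) ∷ s) = ++-cong (⊗-cong (M.*ₗ-assoc j k x) N.≈ᴹ-refl) (act-assoc j k s)

      neg : Elements → Elements
      neg = map (Product.map₁ M.-ᴹ_)

      neg-act : ∀ s → neg s ≈ act (R.- R.1#) s
      neg-act [] = ≈-refl
      neg-act ((x , y) ∷ s) =
        ++-cong (⊗-cong (ModuleReasoning.-ᴹ≈-1*ₗ M x) N.≈ᴹ-refl) (neg-act s)

      -- Negation is the action of -1, so the sum is the action of -1 + 1 = 0, which `zeroˡ` turns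
      -- into the empty list.
      inverseˡ : ∀ s → neg s ++ s ≈ []
      inverseˡ s = ≈-trans (++-cong (neg-act s) (≈-sym (act-1 s)))
        (≈-trans (≈-sym (act-+ s (R.- R.1#) R.1#))
        (≈-trans (act-cong {s = s} (R.-‿inverseˡ R.1#) ≈-refl) (act-0 s)))

    infixr 7 _⊗ᴹ_
    _⊗ᴹ_ : Module (m ⊔ n) (c ⊔ m ⊔ n ⊔ ℓm ⊔ ℓn)
    _⊗ᴹ_ = record
      { Carrierᴹ = Elements
      ; _≈ᴹ_ = _≈_
      ; _+ᴹ_ = _++_
      ; _*ₗ_ = act
      ; 0ᴹ = []
      ; -ᴹ_ = neg
      ; isLeftModule = record
        { isLeftSemimodule = record
          { +ᴹ-isCommutativeMonoid = record
            { isMonoid = record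
              { isSemigroup = record
                { isMagma = record
                  { isEquivalence = record { refl = ≈-refl ; sym = ≈-sym ; trans = ≈-trans }
                  ; ∙-cong = ++-cong
                  }
                ; assoc = λ s t u → ≡⇒≈ (List.++-assoc s t u)
                }
              ; identity = (λ s → ≈-refl) , (λ s → ≡⇒≈ (List.++-identityʳ s))
              }
            ; comm = ++-comm
            }
          ; isPreleftSemimodule = record
            { *ₗ-cong = λ j≈k s≈t → act-cong j≈k s≈t
            ; *ₗ-zeroˡ = act-0
            ; *ₗ-distribʳ = act-+
            ; *ₗ-identityˡ = act-1
            ; *ₗ-assoc = act-assoc
            ; *ₗ-zeroʳ = λ _ → ≈-refl
            ; *ₗ-distribˡ = λ k s t → ≡⇒≈ (List.map-++ _ s t)
            }
          }
        ; -ᴹ‿cong = λ {s} {t} p → ≈-trans (neg-act s)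
            (≈-trans (act-cong R.refl p) (≈-sym (neg-act t)))
        ; -ᴹ‿inverse = inverseˡ , λ s → ≈-trans (++-comm s (neg s)) (inverseˡ s)
        }
      }

  record Bilinear {m ℓm n ℓn p ℓp} (M : Module m ℓm) (N : Module n ℓn) (P : Module p ℓp)
                  (f : LeftModule.Carrierᴹ M → LeftModule.Carrierᴹ N → LeftModule.Carrierᴹ P) :
                  Set (c ⊔ m ⊔ ℓm ⊔ n ⊔ ℓn ⊔ p ⊔ ℓp) where
    field
      linearˡ : ∀ y → Linear M P (λ x → f x y)
      linearʳ : ∀ x → Linear N P (f x)

  module _ {m ℓm n ℓn p ℓp} {M : Module m ℓm} {N : Module n ℓn} {P : Module p ℓp} where
    private
      module M = ModuleReasoning M
      module N = ModuleReasoning N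
      module P = ModuleReasoning P
      module M⊗N = ModuleReasoning (M ⊗ᴹ N)

    -- The universal property of the tensor product. The map is described by its recursion on lists
    -- and not fixed to be a fold, so that the lemma covers `map`, `concatMap` and
    -- `cartesianProductWith` as they stand.
    ⊗-linear : ∀ {b f} → Bilinear M N P b → f [] P.≈ᴹ P.0ᴹ →
               (∀ x y s → f ((x , y) ∷ s) P.≈ᴹ b x y P.+ᴹ f s) → Linear (M ⊗ᴹ N) P f
    ⊗-linear {b} {f} B f[] f∷ = record { cong = cong ; +-homo = +-homo ; *ₗ-homo = *ₗ-homo }
      where
      open Bilinear B
      module L y = Linear (linearˡ y)
      module R′ x = Linear (linearʳ x)

      single : ∀ x y → f [ x , y ] P.≈ᴹ b x y
      single x y = P.≈ᴹ-trans (f∷ x y []) (P.≈ᴹ-trans (P.+ᴹ-congˡ f[]) (P.+ᴹ-identityʳ _))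

      +-homo : ∀ s t → f (s ++ t) P.≈ᴹ f s P.+ᴹ f t
      +-homo [] t = P.≈ᴹ-sym (P.≈ᴹ-trans (P.+ᴹ-congʳ f[]) (P.+ᴹ-identityˡ _))
      +-homo ((x , y) ∷ s) t = P.begin
        f ((x , y) ∷ s ++ t)            P.≈⟨ f∷ x y _ ⟩
        b x y P.+ᴹ f (s ++ t)           P.≈⟨ P.+ᴹ-congˡ (+-homo s t) ⟩
        b x y P.+ᴹ (f s P.+ᴹ f t)       P.≈⟨ P.+ᴹ-assoc _ _ _ ⟨
        b x y P.+ᴹ f s P.+ᴹ f t         P.≈⟨ P.+ᴹ-congʳ (f∷ x y s) ⟨
        f ((x , y) ∷ s) P.+ᴹ f t        P.∎

      *ₗ-homo : ∀ k s → f (k M⊗N.*ₗ s) P.≈ᴹ k P.*ₗ f s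
      *ₗ-homo k [] = P.≈ᴹ-trans f[] (P.≈ᴹ-sym (P.≈ᴹ-trans (P.*ₗ-cong R.refl f[]) (P.*ₗ-zeroʳ k)))
      *ₗ-homo k ((x , y) ∷ s) = P.begin
        f ((k M.*ₗ x , y) ∷ k M⊗N.*ₗ s)          P.≈⟨ f∷ _ _ _ ⟩
        b (k M.*ₗ x) y P.+ᴹ f (k M⊗N.*ₗ s)       P.≈⟨ P.+ᴹ-cong (L.*ₗ-homo y k x) (*ₗ-homo k s) ⟩
        k P.*ₗ b x y P.+ᴹ k P.*ₗ f s             P.≈⟨ P.*ₗ-distribˡ k _ _ ⟨
        k P.*ₗ (b x y P.+ᴹ f s)                  P.≈⟨ P.*ₗ-cong R.refl (f∷ x y s) ⟨
        k P.*ₗ f ((x , y) ∷ s)                   P.∎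

      cong : ∀ {s t} → s M⊗N.≈ᴹ t → f s P.≈ᴹ f t
      cong ≈-refl = P.≈ᴹ-refl
      cong (≈-sym p) = P.≈ᴹ-sym (cong p)
      cong (≈-trans p q) = P.≈ᴹ-trans (cong p) (cong q)
      cong (++-cong {s} {s′} p q) = P.≈ᴹ-trans (+-homo s _)
        (P.≈ᴹ-trans (P.+ᴹ-cong (cong p) (cong q)) (P.≈ᴹ-sym (+-homo s′ _)))
      cong (++-comm s t) = P.≈ᴹ-trans (+-homo s t) (P.≈ᴹ-trans (P.+ᴹ-comm _ _) (P.≈ᴹ-sym (+-homo t s)))
      cong (⊗-cong {x} {x′} {y} {y′} p q) = P.≈ᴹ-trans (single x y)
        (P.≈ᴹ-trans (L.cong y p) (P.≈ᴹ-trans (R′.cong x′ q) (P.≈ᴹ-sym (single x′ y′))))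
      cong (distribʳ x x′ y) = P.≈ᴹ-trans (single _ y) (P.≈ᴹ-trans (L.+-homo y x x′)
        (P.≈ᴹ-sym (P.≈ᴹ-trans (f∷ x y _) (P.+ᴹ-congˡ (single x′ y)))))
      cong (distribˡ x y y′) = P.≈ᴹ-trans (single x _) (P.≈ᴹ-trans (R′.+-homo x y y′)
        (P.≈ᴹ-sym (P.≈ᴹ-trans (f∷ x y _) (P.+ᴹ-congˡ (single x y′)))))
      cong (balanced k x y) = P.≈ᴹ-trans (single _ y) (P.≈ᴹ-trans (L.*ₗ-homo y k x)
        (P.≈ᴹ-sym (P.≈ᴹ-trans (single x _) (R′.*ₗ-homo x k y))))
      cong (zeroˡ y) = P.≈ᴹ-trans (single _ y) (P.≈ᴹ-trans (L.zero-homo y) (P.≈ᴹ-sym f[]))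
      cong (zeroʳ x) = P.≈ᴹ-trans (single x _) (P.≈ᴹ-trans (R′.zero-homo x) (P.≈ᴹ-sym f[]))

    -- The uniqueness half of the universal property, with no basis of either factor involved.
    ⊗-ext : ∀ {f g} → Linear (M ⊗ᴹ N) P f → Linear (M ⊗ᴹ N) P g →
            (∀ x y → f [ x , y ] P.≈ᴹ g [ x , y ]) → ∀ s → f s P.≈ᴹ g s
    ⊗-ext F G e [] = P.≈ᴹ-trans (Linear.zero-homo F) (P.≈ᴹ-sym (Linear.zero-homo G))
    ⊗-ext F G e ((x , y) ∷ s) = P.≈ᴹ-trans (Linear.+-homo F [ x , y ] s)
      (P.≈ᴹ-trans (P.+ᴹ-cong (e x y) (⊗-ext F G e s)) (P.≈ᴹ-sym (Linear.+-homo G [ x , y ] s)))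

    fold : (M.Carrierᴹ → N.Carrierᴹ → P.Carrierᴹ) → List (M.Carrierᴹ × N.Carrierᴹ) → P.Carrierᴹ
    fold b = foldr (λ (x , y) s → b x y P.+ᴹ s) P.0ᴹ

    fold-linear : ∀ {b} → Bilinear M N P b → Linear (M ⊗ᴹ N) P (fold b)
    fold-linear B = ⊗-linear B P.≈ᴹ-refl (λ _ _ _ → P.≈ᴹ-refl)

  module _ {m ℓm n ℓn} {M : Module m ℓm} {N : Module n ℓn} where
    private
      module M = LeftModule M
      module N = LeftModule N

    pure-bilinear : Bilinear M N (M ⊗ᴹ N) (λ x y → [ x , y ])
    pure-bilinear = record
      { linearˡ = λ y → record { cong = λ p → ⊗-cong p N.≈ᴹ-refl
                               ; +-homo = λ x x′ → distribʳ x x′ y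
                               ; *ₗ-homo = λ _ _ → ≈-refl }
      ; linearʳ = λ x → record { cong = ⊗-cong M.≈ᴹ-refl
                               ; +-homo = distribˡ x
                               ; *ₗ-homo = λ k y → ≈-sym (balanced k x y) }
      }

  module _ {m ℓm n ℓn p ℓp q ℓq} {M : Module m ℓm} {N : Module n ℓn}
           {P : Module p ℓp} {Q : Module q ℓq} where

    bilinear-∘ : ∀ {b f} → Linear P Q f → Bilinear M N P b → Bilinear M N Q (λ x y → f (b x y))
    bilinear-∘ F B = record { linearˡ = λ y → F ∘ᴸ linearˡ y ; linearʳ = λ x → F ∘ᴸ linearʳ x }
      where open Bilinear B

    bilinear-∘₂ : ∀ {b f g} → Bilinear P Q N b → Linear M P f → Linear M Q g →
                  Bilinear M M N (λ x y → b (f x) (g y))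
    bilinear-∘₂ B F G = record
      { linearˡ = λ y → linearˡ _ ∘ᴸ F ; linearʳ = λ x → linearʳ _ ∘ᴸ G }
      where open Bilinear B

    ⟨⊗⟩-linear : ∀ {f g} → Linear M P f → Linear N Q g → Linear (M ⊗ᴹ N) (P ⊗ᴹ Q) (f ⟨⊗⟩ g)
    ⟨⊗⟩-linear F G = ⊗-linear
      (record { linearˡ = λ y → linearˡ _ ∘ᴸ F ; linearʳ = λ x → linearʳ _ ∘ᴸ G })
      ≈-refl (λ _ _ _ → ≈-refl)
      where open Bilinear (pure-bilinear {M = P} {N = Q})

  reassociate-linear : ∀ {m ℓm n ℓn p ℓp} {M : Module m ℓm} {N : Module n ℓn} {P : Module p ℓp} →
                       Linear ((M ⊗ᴹ N) ⊗ᴹ P) (M ⊗ᴹ (N ⊗ᴹ P)) reassociate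
  reassociate-linear {M = M} {N} {P} = ⊗-linear
    (record
      { linearˡ = λ z → ⊗-linear
          (record
            { linearˡ = λ y → linearˡ _
            ; linearʳ = λ x → linearʳ x ∘ᴸ Bilinear.linearˡ (pure-bilinear {M = N} {N = P}) z
            })
          ≈-refl (λ _ _ _ → ≈-refl)
      ; linearʳ = right
      })
    ≈-refl (λ _ _ _ → ≈-refl)
    where
    open Bilinear (pure-bilinear {M = M} {N = N ⊗ᴹ P})
    right : ∀ t → Linear P (M ⊗ᴹ (N ⊗ᴹ P)) (λ z → map (λ (x , y) → x , [ y , z ]) t)
    right [] = 0-linear
    right ((x , y) ∷ t) = +-linear
      (linearʳ x ∘ᴸ Bilinear.linearʳ (pure-bilinear {M = N} {N = P}) y) (right t)

  ⊛-bilinear : ∀ {m ℓm} {M : Module m ℓm} {_*_} → Bilinear M M M _*_ →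
               Bilinear (M ⊗ᴹ M) (M ⊗ᴹ M) (M ⊗ᴹ M) (cartesianProductWith (Product.zip _*_ _*_))
  ⊛-bilinear {M = M} {_*_} *-bilinear = record
    { linearˡ = λ t → ⊗-linear (record { linearˡ = λ y → leftˡ y t ; linearʳ = λ x → leftʳ x t })
        ≈-refl (λ _ _ _ → ≈-refl)
    ; linearʳ = right
    }
    where
    open Bilinear *-bilinear
    open Bilinear (pure-bilinear {M = M} {N = M}) using ()
      renaming (linearˡ to pure-linearˡ; linearʳ to pure-linearʳ)
    leftˡ : ∀ y t → Linear M (M ⊗ᴹ M) (λ x → map (Product.zip _*_ _*_ (x , y)) t)
    leftˡ y []            = 0-linear
    leftˡ y ((v , w) ∷ t) = +-linear (pure-linearˡ _ ∘ᴸ linearˡ v) (leftˡ y t)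
    leftʳ : ∀ x t → Linear M (M ⊗ᴹ M) (λ y → map (Product.zip _*_ _*_ (x , y)) t)
    leftʳ x []            = 0-linear
    leftʳ x ((v , w) ∷ t) = +-linear (pure-linearʳ _ ∘ᴸ linearˡ w) (leftʳ x t)
    right : ∀ s → Linear (M ⊗ᴹ M) (M ⊗ᴹ M) (cartesianProductWith (Product.zip _*_ _*_) s)
    right []            = 0-linear
    right ((x , y) ∷ s) = +-linear (⟨⊗⟩-linear (linearʳ x) (linearʳ y)) (right s)

  *ₗ-linearˡ : ∀ {m ℓm} {M : Module m ℓm} y → Linear scalars M (λ k → LeftModule._*ₗ_ M k y)
  *ₗ-linearˡ {M = M} y = record
    { cong = λ p → *ₗ-cong p ≈ᴹ-refl ; +-homo = λ j k → *ₗ-distribʳ y j k ; *ₗ-homo = λ j k → *ₗ-assoc j k y }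
    where open LeftModule M

  module _ {m ℓm} {M : Module m ℓm} {e} (E : Linear M scalars e) where
    open LeftModule M using (_*ₗ_)

    ε*ˡ : Bilinear M M M (λ y z → e y *ₗ z)
    ε*ˡ = record { linearˡ = λ z → *ₗ-linearˡ z ∘ᴸ E ; linearʳ = λ y → *ₗ-linear (e y) id-linear }

    ε*ʳ : Bilinear M M M (λ y z → e z *ₗ y)
    ε*ʳ = record { linearˡ = λ z → *ₗ-linear (e z) id-linear ; linearʳ = λ y → *ₗ-linearˡ y ∘ᴸ E }

  module _ {a ℓa} {A : RawAlgebra a ℓa} (isAlgebra : IsAlgebra A) where
    open IsAlgebra isAlgebra
    private module ring = IsRing isRing

    algebra-bilinear : Bilinear (record { isLeftModule = isLeftModule }) (record { isLeftModule = isLeftModule })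
                                (record { isLeftModule = isLeftModule }) (RawAlgebra._*_ A)
    algebra-bilinear = record
      { linearˡ = λ y → record { cong = λ p → ring.*-cong p ring.refl ; +-homo = λ x x′ → ring.distribʳ y x x′
                               ; *ₗ-homo = λ k x → *ₗ-*-assoc k x y }
      ; linearʳ = λ x → record { cong = ring.*-cong ring.refl ; +-homo = ring.distribˡ x
                               ; *ₗ-homo = λ k y → *-*ₗ-comm k x y }
      }

-- Sums over shuffles, deconcatenations and markings of words

interleaving-length : ∀ {B : Set} {u v w : List B} → Interleaving u v w → length w ≡ length u +ℕ length v
interleaving-length []                = ≡.refl
interleaving-length (consˡ i)         = ≡.cong suc (interleaving-length i)
interleaving-length {u = u} (consʳ i) = ≡.trans (≡.cong suc (interleaving-length i))
  (≡.sym (ℕ.+-suc (length u) _))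

module WordSums {c ℓ m ℓm} (R : CommutativeRing c ℓ) (M : LinearAlgebra.Module R m ℓm) where
  open LinearAlgebra R using (Module; Linear)
  open LinearAlgebra.ModuleReasoning R M

  private
    open module Solver = CommutativeMonoidSolver +ᴹ-commutativeMonoid using (solve; _⊜_; _⊕_)

    mapR : ∀ {A B : Set} (f : A → B) w → Pointwise (λ x y → y ≡ f x) w (map f w)
    mapR f []      = []
    mapR f (x ∷ w) = ≡.refl ∷ mapR f w

    mapR⁻ : ∀ {A B : Set} {f : A → B} {w v} → Pointwise (λ x y → y ≡ f x) w v → v ≡ map f w
    mapR⁻ []            = ≡.refl
    mapR⁻ (≡.refl ∷ rs) = ≡.cong (_ ∷_) (mapR⁻ rs)

    allˡ : ∀ {A : Set} (xs : List A) → Interleaving xs [] xs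
    allˡ []       = []
    allˡ (x ∷ xs) = consˡ (allˡ xs)

    allʳ : ∀ {A : Set} (ys : List A) → Interleaving [] ys ys
    allʳ []       = []
    allʳ (y ∷ ys) = consʳ (allʳ ys)

  module _ {A : Set} where
    -- Sums over shuffles, cuts (`Cut`) and marked positions (`Mark`) are recursions on words in
    -- which the letters already read are absorbed into the summand. Identities between iterated
    -- sums then go by induction with the summand generalised.
    Ш : (List A → Carrierᴹ) → List A → List A → Carrierᴹ
    Ш g []       ys       = g ys
    Ш g (x ∷ xs) []       = g (x ∷ xs)
    Ш g (x ∷ xs) (y ∷ ys) = Ш (g ∘ (x ∷_)) xs (y ∷ ys) +ᴹ Ш (g ∘ (y ∷_)) (x ∷ xs) ys

    Cut : (List A → List A → Carrierᴹ) → List A → Carrierᴹ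
    Cut h []      = h [] []
    Cut h (x ∷ w) = h [] (x ∷ w) +ᴹ Cut (λ a b → h (x ∷ a) b) w

    Mark : (List (A × ℕ) → Carrierᴹ) → List A → Carrierᴹ
    Mark g []      = 0ᴹ
    Mark g (x ∷ w) = g (marked x ∷ map unmarked w) +ᴹ Mark (g ∘ (unmarked x ∷_)) w

    Ш-[]ʳ : ∀ g w → Ш g w [] ≡ g w
    Ш-[]ʳ g []      = ≡.refl
    Ш-[]ʳ g (x ∷ w) = ≡.refl

    Ш-closed : ∀ {p} (P : Pred Carrierᴹ p) → (∀ {x y} → P x → P y → P (x +ᴹ y)) →
               ∀ {g} xs ys → (∀ w → Interleaving xs ys w → P (g w)) → P (Ш g xs ys)
    Ш-closed P P-+ []       ys       e = e _ (allʳ ys)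
    Ш-closed P P-+ (x ∷ xs) []       e = e _ (allˡ (x ∷ xs))
    Ш-closed P P-+ (x ∷ xs) (y ∷ ys) e = P-+
      (Ш-closed P P-+ xs (y ∷ ys) (λ w i → e _ (consˡ i)))
      (Ш-closed P P-+ (x ∷ xs) ys (λ w i → e _ (consʳ i)))

    Ш-+ : ∀ g h xs ys → Ш (λ w → g w +ᴹ h w) xs ys ≈ᴹ Ш g xs ys +ᴹ Ш h xs ys
    Ш-+ g h []       ys       = ≈ᴹ-refl
    Ш-+ g h (x ∷ xs) []       = ≈ᴹ-refl
    Ш-+ g h (x ∷ xs) (y ∷ ys) = ≈ᴹ-trans
      (+ᴹ-cong (Ш-+ _ _ xs (y ∷ ys)) (Ш-+ _ _ (x ∷ xs) ys)) (interchange _ _ _ _)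

    Cut-closed : ∀ {p} (P : Pred Carrierᴹ p) → (∀ {x y} → P x → P y → P (x +ᴹ y)) →
                 ∀ {h} w → (∀ a b → a ++ b ≡ w → P (h a b)) → P (Cut h w)
    Cut-closed P P-+ []      e = e [] [] ≡.refl
    Cut-closed P P-+ (x ∷ w) e = P-+ (e [] _ ≡.refl)
      (Cut-closed P P-+ w (λ a b eq → e (x ∷ a) b (≡.cong (x ∷_) eq)))

    Cut-cong : ∀ {h h′} w → (∀ a b → a ++ b ≡ w → h a b ≈ᴹ h′ a b) → Cut h w ≈ᴹ Cut h′ w
    Cut-cong []      e = e [] [] ≡.refl
    Cut-cong (x ∷ w) e = +ᴹ-cong (e [] _ ≡.refl)
      (Cut-cong w (λ a b eq → e (x ∷ a) b (≡.cong (x ∷_) eq)))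

    Cut-+ : ∀ h h′ w → Cut (λ a b → h a b +ᴹ h′ a b) w ≈ᴹ Cut h w +ᴹ Cut h′ w
    Cut-+ h h′ []      = ≈ᴹ-refl
    Cut-+ h h′ (x ∷ w) = ≈ᴹ-trans (+ᴹ-congˡ (Cut-+ _ _ w)) (interchange _ _ _ _)

    Cut-coassoc : ∀ k w → Cut (λ a b → Cut (λ a′ a″ → k a′ a″ b) a) w ≈ᴹ Cut (λ a b → Cut (k a) b) w
    Cut-coassoc k []      = ≈ᴹ-refl
    Cut-coassoc k (x ∷ w) = ≈ᴹ-trans
      (+ᴹ-congˡ (≈ᴹ-trans (Cut-+ _ _ w) (+ᴹ-congˡ (Cut-coassoc (k ∘ (x ∷_)) w))))
      (≈ᴹ-sym (+ᴹ-assoc _ _ _))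

    Mark-closed : ∀ {p} (P : Pred Carrierᴹ p) → P 0ᴹ → (∀ {x y} → P x → P y → P (x +ᴹ y)) →
                  ∀ {g} w → (∀ l x r → l ++ x ∷ r ≡ w → P (g (markAt l x r))) → P (Mark g w)
    Mark-closed P P-0 P-+ []      e = P-0
    Mark-closed P P-0 P-+ (x ∷ w) e = P-+ (e [] x w ≡.refl)
      (Mark-closed P P-0 P-+ w (λ l y r eq → e (x ∷ l) y r (≡.cong (x ∷_) eq)))

    Mark-cong : ∀ {g g′} w → (∀ l x r → g (markAt l x r) ≈ᴹ g′ (markAt l x r)) →
                Mark g w ≈ᴹ Mark g′ w
    Mark-cong []      e = ≈ᴹ-refl
    Mark-cong (x ∷ w) e = +ᴹ-cong (e [] x w) (Mark-cong w (λ l → e (x ∷ l)))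

    Mark-+ : ∀ g h w → Mark (λ v → g v +ᴹ h v) w ≈ᴹ Mark g w +ᴹ Mark h w
    Mark-+ g h []      = ≈ᴹ-sym (+ᴹ-identityˡ 0ᴹ)
    Mark-+ g h (x ∷ w) = ≈ᴹ-trans (+ᴹ-congˡ (Mark-+ _ _ w)) (interchange _ _ _ _)

  module _ {A B : Set} (R : A → B → Set) where
    -- The shape of the sum depends on the lengths of the words only, so letters may be exchanged
    -- along a relation between two different alphabets.
    Ш-rel : ∀ {xs xs′ ys ys′ g g′} → Pointwise R xs xs′ → Pointwise R ys ys′ →
            (∀ {w w′} → Pointwise R w w′ → g w ≈ᴹ g′ w′) → Ш g xs ys ≈ᴹ Ш g′ xs′ ys′
    Ш-rel []       ss       e = e ss
    Ш-rel (r ∷ rs) []       e = e (r ∷ rs)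
    Ш-rel (r ∷ rs) (s ∷ ss) e = +ᴹ-cong
      (Ш-rel rs (s ∷ ss) (λ p → e (r ∷ p))) (Ш-rel (r ∷ rs) ss (λ p → e (s ∷ p)))

    Cut-rel : ∀ {w w′ h h′} → Pointwise R w w′ →
              (∀ {a a′ b b′} → Pointwise R a a′ → Pointwise R b b′ → h a b ≈ᴹ h′ a′ b′) →
              Cut h w ≈ᴹ Cut h′ w′
    Cut-rel []       e = e [] []
    Cut-rel (r ∷ rs) e = +ᴹ-cong (e [] (r ∷ rs)) (Cut-rel rs (λ p q → e (r ∷ p) q))

    Mark-rel : ∀ {w w′ g g′} → Pointwise R w w′ →
               (∀ {v v′} → Pointwise (λ (x , i) (y , j) → R x y × i ≡ j) v v′ → g v ≈ᴹ g′ v′) →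
               Mark g w ≈ᴹ Mark g′ w′
    Mark-rel []       e = ≈ᴹ-refl
    Mark-rel (r ∷ rs) e = +ᴹ-cong (e ((r , ≡.refl) ∷ go rs)) (Mark-rel rs (λ p → e ((r , ≡.refl) ∷ p)))
      where
      go : ∀ {w w′} → Pointwise R w w′ →
           Pointwise (λ (x , i) (y , j) → R x y × i ≡ j) (map unmarked w) (map unmarked w′)
      go []       = []
      go (r ∷ rs) = (r , ≡.refl) ∷ go rs

  Ш-cong : ∀ {A : Set} {g g′ : List A → Carrierᴹ} xs ys → (∀ w → g w ≈ᴹ g′ w) →
           Ш g xs ys ≈ᴹ Ш g′ xs ys
  Ш-cong []       ys       e = e ys
  Ш-cong (x ∷ xs) []       e = e (x ∷ xs)
  Ш-cong (x ∷ xs) (y ∷ ys) e = +ᴹ-cong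
    (Ш-cong xs (y ∷ ys) (λ w → e (x ∷ w))) (Ш-cong (x ∷ xs) ys (λ w → e (y ∷ w)))

  Ш-cong-∈ : ∀ {A : Set} {g g′ : List A → Carrierᴹ} xs ys →
             (∀ w → Interleaving xs ys w → g w ≈ᴹ g′ w) → Ш g xs ys ≈ᴹ Ш g′ xs ys
  Ш-cong-∈ []       ys       e = e ys (allʳ ys)
  Ш-cong-∈ (x ∷ xs) []       e = e (x ∷ xs) (allˡ (x ∷ xs))
  Ш-cong-∈ (x ∷ xs) (y ∷ ys) e = +ᴹ-cong
    (Ш-cong-∈ xs (y ∷ ys) (λ w i → e (x ∷ w) (consˡ i)))
    (Ш-cong-∈ (x ∷ xs) ys (λ w i → e (y ∷ w) (consʳ i)))

  Ш-map : ∀ {A B : Set} (f : A → B) g xs ys → Ш (g ∘ map f) xs ys ≈ᴹ Ш g (map f xs) (map f ys)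
  Ш-map f g xs ys = Ш-rel (λ x y → y ≡ f x) (mapR f xs) (mapR f ys)
    (λ p → ≈ᴹ-reflexive (≡.cong g (≡.sym (mapR⁻ p))))

  Cut-map : ∀ {A B : Set} (f : A → B) h w → Cut (λ a b → h (map f a) (map f b)) w ≈ᴹ Cut h (map f w)
  Cut-map f h w = Cut-rel (λ x y → y ≡ f x) (mapR f w)
    (λ p q → ≈ᴹ-reflexive (≡.cong₂ h (≡.sym (mapR⁻ p)) (≡.sym (mapR⁻ q))))

  module _ {A : Set} where
    -- Both sides are sums over shuffles of three words; they are split according to which of the
    -- three supplies the first letter.
    Ш-assoc : ∀ (g : List A → Carrierᴹ) xs ys zs →
              Ш (λ w → Ш g w zs) xs ys ≈ᴹ Ш (λ w → Ш g xs w) ys zs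
    Ш-assoc g []       ys       zs       = ≈ᴹ-refl
    Ш-assoc g (x ∷ xs) []       zs       = ≈ᴹ-refl
    Ш-assoc g (x ∷ xs) (y ∷ ys) []       =
      Ш-cong (x ∷ xs) (y ∷ ys) (λ w → ≈ᴹ-reflexive (Ш-[]ʳ g w))
    Ш-assoc g (x ∷ xs) (y ∷ ys) (z ∷ zs) =
      ≈ᴹ-trans (+ᴹ-cong (Ш-+ _ _ xs (y ∷ ys)) (Ш-+ _ _ (x ∷ xs) ys))
      (≈ᴹ-trans (interchange _ _ _ _)
      (≈ᴹ-trans (+ᴹ-cong (+ᴹ-cong (Ш-assoc (g ∘ (x ∷_)) xs (y ∷ ys) (z ∷ zs))
                                  (Ш-assoc (g ∘ (y ∷_)) (x ∷ xs) ys (z ∷ zs)))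
                         (Ш-assoc (g ∘ (z ∷_)) (x ∷ xs) (y ∷ ys) zs))
      (≈ᴹ-trans (regroup _ _ _ _)
      (≈ᴹ-sym (+ᴹ-cong (Ш-+ _ _ ys (z ∷ zs)) (Ш-+ _ _ (y ∷ ys) zs))))))
      where
      regroup : ∀ a b c d → ((a +ᴹ b) +ᴹ c) +ᴹ d ≈ᴹ (a +ᴹ c) +ᴹ (b +ᴹ d)
      regroup = solve 4 (λ a b c d → ((a ⊕ b) ⊕ c) ⊕ d ⊜ (a ⊕ c) ⊕ (b ⊕ d)) ≈ᴹ-refl

    -- The reason why the coproduct is multiplicative: cutting a shuffle cuts both words, and its
    -- two parts are shuffles of the two prefixes and of the two suffixes.
    Cut-Ш : ∀ (h : List A → List A → Carrierᴹ) xs ys →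
            Ш (Cut h) xs ys ≈ᴹ
            Cut (λ a b → Cut (λ c d → Ш (λ p → Ш (h p) b d) a c) ys) xs
    Cut-Ш h []       ys       = ≈ᴹ-refl
    Cut-Ш h (x ∷ xs) []       = Cut-cong (x ∷ xs) (λ a b _ → ≈ᴹ-reflexive (≡.sym
      (≡.trans (Ш-[]ʳ (λ p → Ш (h p) b []) a) (Ш-[]ʳ (h a) b))))
    Cut-Ш h (x ∷ xs) (y ∷ ys) =
      ≈ᴹ-trans (+ᴹ-cong
        (≈ᴹ-trans (Ш-+ _ _ xs (y ∷ ys)) (+ᴹ-congˡ
          (≈ᴹ-trans (Cut-Ш (h ∘ (x ∷_)) xs (y ∷ ys))
          (≈ᴹ-trans (Cut-cong xs (λ a b _ → +ᴹ-congʳ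
            (≈ᴹ-reflexive (Ш-[]ʳ (λ p → Ш (h (x ∷ p)) b (y ∷ ys)) a))))
          (Cut-+ _ _ xs)))))
        (≈ᴹ-trans (Ш-+ _ _ (x ∷ xs) ys) (+ᴹ-congˡ (Cut-Ш (h ∘ (y ∷_)) (x ∷ xs) ys))))
      (≈ᴹ-trans (regroup _ _ _ _ _ _)
      (+ᴹ-congˡ (≈ᴹ-sym
        (≈ᴹ-trans (Cut-cong xs (λ a b _ → +ᴹ-congˡ (Cut-+ _ _ ys)))
        (≈ᴹ-trans (Cut-+ _ _ xs) (+ᴹ-congˡ (Cut-+ _ _ xs)))))))
      where
      regroup : ∀ a b c d e f → (a +ᴹ (b +ᴹ c)) +ᴹ (d +ᴹ (e +ᴹ f)) ≈ᴹ
                                ((a +ᴹ d) +ᴹ e) +ᴹ (b +ᴹ (c +ᴹ f))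
      regroup = solve 6 (λ a b c d e f →
        (a ⊕ (b ⊕ c)) ⊕ (d ⊕ (e ⊕ f)) ⊜ ((a ⊕ d) ⊕ e) ⊕ (b ⊕ (c ⊕ f))) ≈ᴹ-refl

    -- The combinatorial Leibniz rule: a marked position of a shuffle belongs to exactly one of the
    -- two words.
    Mark-Ш : ∀ (g : List (A × ℕ) → Carrierᴹ) xs ys →
             Ш (Mark g) xs ys ≈ᴹ
             Mark (λ v → Ш g v (map unmarked ys)) xs +ᴹ Mark (λ v → Ш g (map unmarked xs) v) ys
    Mark-Ш g []       ys       = ≈ᴹ-sym (+ᴹ-identityˡ _)
    Mark-Ш g (x ∷ xs) []       = ≈ᴹ-sym (≈ᴹ-trans (+ᴹ-identityʳ _)
      (Mark-cong {g = λ v → Ш g v []} {g} (x ∷ xs) (λ _ _ _ → ≈ᴹ-reflexive (Ш-[]ʳ g _))))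
    Mark-Ш g (x ∷ xs) (y ∷ ys) =
      ≈ᴹ-trans (+ᴹ-cong
        (≈ᴹ-trans (Ш-+ _ _ xs (y ∷ ys)) (+ᴹ-cong (Ш-map unmarked _ xs (y ∷ ys))
          (Mark-Ш (g ∘ (unmarked x ∷_)) xs (y ∷ ys))))
        (≈ᴹ-trans (Ш-+ _ _ (x ∷ xs) ys) (+ᴹ-cong (Ш-map unmarked _ (x ∷ xs) ys)
          (Mark-Ш (g ∘ (unmarked y ∷_)) (x ∷ xs) ys))))
      (≈ᴹ-trans (regroup _ _ _ _ _ _ _ _)
      (≈ᴹ-sym (+ᴹ-cong (+ᴹ-congˡ (Mark-+ _ _ xs)) (+ᴹ-congˡ (Mark-+ _ _ ys)))))
      where
      regroup : ∀ a b c d e f i j →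
        (a +ᴹ (b +ᴹ (c +ᴹ d))) +ᴹ (e +ᴹ ((f +ᴹ i) +ᴹ j)) ≈ᴹ
        ((a +ᴹ f) +ᴹ (b +ᴹ i)) +ᴹ ((c +ᴹ e) +ᴹ (d +ᴹ j))
      regroup = solve 8 (λ a b c d e f i j →
        (a ⊕ (b ⊕ (c ⊕ d))) ⊕ (e ⊕ ((f ⊕ i) ⊕ j)) ⊜
        ((a ⊕ f) ⊕ (b ⊕ i)) ⊕ ((c ⊕ e) ⊕ (d ⊕ j))) ≈ᴹ-refl

    -- The dual of the Leibniz rule: a mark lies on exactly one side of a cut.
    Mark-Cut : ∀ (h : List (A × ℕ) → List (A × ℕ) → Carrierᴹ) w →
               Mark (Cut h) w ≈ᴹ
               Cut (λ a b → Mark (λ v → h v (map unmarked b)) a +ᴹ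
                            Mark (λ v → h (map unmarked a) v) b) w
    Mark-Cut h []      = ≈ᴹ-sym (+ᴹ-identityˡ 0ᴹ)
    Mark-Cut h (x ∷ w) =
      ≈ᴹ-trans (+ᴹ-cong (+ᴹ-congˡ (≈ᴹ-sym (Cut-map unmarked _ w)))
        (≈ᴹ-trans (Mark-+ _ _ w) (+ᴹ-congˡ (Mark-Cut (h ∘ (unmarked x ∷_)) w))))
      (≈ᴹ-trans (interchange _ _ _ _)
      (+ᴹ-cong (≈ᴹ-sym (+ᴹ-identityˡ _))
        (≈ᴹ-trans (≈ᴹ-sym (Cut-+ _ _ w)) (Cut-cong w (λ a b _ → ≈ᴹ-sym (+ᴹ-assoc _ _ _))))))

  -- Marking is a shuffle of one letter with copies of another, read alongside the word.
  Mark-zip : ∀ {A B : Set} (f : ℕ → B) (h : List (A × B) → Carrierᴹ) x w →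
             Ш (λ v → h (zip (x ∷ w) v)) [ f 0 ] (replicate (length w) (f 1)) ≈ᴹ
             Mark (h ∘ map (Product.map₂ f)) (x ∷ w)
  Mark-zip f h x []      = ≈ᴹ-sym (+ᴹ-identityʳ _)
  Mark-zip f h x (y ∷ w) = +ᴹ-cong
    (≈ᴹ-reflexive (≡.cong (λ v → h ((x , f 0) ∷ (y , f 1) ∷ v)) (go w)))
    (Mark-zip f (h ∘ ((x , f 1) ∷_)) y w)
    where
    go : ∀ w → zip w (replicate (length w) (f 1)) ≡ map (Product.map₂ f) (map unmarked w)
    go []      = ≡.refl
    go (z ∷ w) = ≡.cong ((z , f 1) ∷_) (go w)

module _ {c ℓ} (R : CommutativeRing c ℓ) where
  open LinearAlgebra R using (Module; Linear)

  module _ {m ℓm n ℓn} {M : Module m ℓm} {N : Module n ℓn} {f} (F : Linear M N f) where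
    private
      module M = WordSums R M
      module N = WordSums R N
      open LinearAlgebra.ModuleReasoning R N
      open Linear F

    Ш-linear : ∀ {A : Set} g (xs ys : List A) → f (M.Ш g xs ys) ≈ᴹ N.Ш (f ∘ g) xs ys
    Ш-linear g []       ys       = ≈ᴹ-refl
    Ш-linear g (x ∷ xs) []       = ≈ᴹ-refl
    Ш-linear g (x ∷ xs) (y ∷ ys) = ≈ᴹ-trans (+-homo _ _)
      (+ᴹ-cong (Ш-linear _ xs (y ∷ ys)) (Ш-linear _ (x ∷ xs) ys))

    Cut-linear : ∀ {A : Set} h (w : List A) → f (M.Cut h w) ≈ᴹ N.Cut (λ a b → f (h a b)) w
    Cut-linear h []      = ≈ᴹ-refl
    Cut-linear h (x ∷ w) = ≈ᴹ-trans (+-homo _ _) (+ᴹ-congˡ (Cut-linear _ w))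

    Mark-linear : ∀ {A : Set} g (w : List A) → f (M.Mark g w) ≈ᴹ N.Mark (f ∘ g) w
    Mark-linear g []      = zero-homo
    Mark-linear g (x ∷ w) = ≈ᴹ-trans (+-homo _ _) (+ᴹ-congˡ (Mark-linear _ w))

-- Polynomials in a linear operator

module FallingPowers {c ℓ} (R : CommutativeRing c ℓ) where
  open LinearAlgebra R
  open RawSemiringDefs (RawRing.rawSemiring R.rawRing) using () renaming (_×_ to _·_)

  ι : ℕ → R.Carrier
  ι i = i · R.1#

  module _ {m ℓm} (M : Module m ℓm) where
    private
      module M = ModuleReasoning M

    shiftBy : ℕ → (M.Carrierᴹ → M.Carrierᴹ) → M.Carrierᴹ → M.Carrierᴹ
    shiftBy i a x = a x M.+ᴹ (R.- ι i) M.*ₗ x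

    -- The falling factorial a (a - 1) ⋯ (a - i + 1).
    falling : (M.Carrierᴹ → M.Carrierᴹ) → ℕ → M.Carrierᴹ → M.Carrierᴹ
    falling a zero    x = x
    falling a (suc i) x = shiftBy i a (falling a i x)

    -- The product (a - 1) ⋯ (a - i), that is, a falling factorial with its factor a split off
    -- (`falling-suc`). A vector killed by it has no part with eigenvalue 0.
    positivePart : (M.Carrierᴹ → M.Carrierᴹ) → ℕ → M.Carrierᴹ → M.Carrierᴹ
    positivePart a zero    x = x
    positivePart a (suc i) x = positivePart a i (shiftBy (suc i) a x)

    module _ {a} (A : Linear M M a) where
      shiftBy-linear : ∀ i → Linear M M (shiftBy i a)
      shiftBy-linear i = +-linear A (*ₗ-linear _ id-linear)

      falling-linear : ∀ i → Linear M M (falling a i)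
      falling-linear zero    = id-linear
      falling-linear (suc i) = shiftBy-linear i ∘ᴸ falling-linear i

      positivePart-linear : ∀ i → Linear M M (positivePart a i)
      positivePart-linear zero    = id-linear
      positivePart-linear (suc i) = positivePart-linear i ∘ᴸ shiftBy-linear (suc i)

      shiftBy-comm : ∀ {b} (B : Linear M M b) → (∀ x → b (a x) M.≈ᴹ a (b x)) →
                     ∀ i x → b (shiftBy i a x) M.≈ᴹ shiftBy i a (b x)
      shiftBy-comm B ba≈ab i x = M.≈ᴹ-trans (Linear.+-homo B _ _)
        (M.+ᴹ-cong (ba≈ab x) (Linear.*ₗ-homo B _ x))

      falling-comm : ∀ {b} (B : Linear M M b) → (∀ x → b (a x) M.≈ᴹ a (b x)) →
                     ∀ i x → b (falling a i x) M.≈ᴹ falling a i (b x)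
      falling-comm B ba≈ab zero    x = M.≈ᴹ-refl
      falling-comm B ba≈ab (suc i) x = M.≈ᴹ-trans (shiftBy-comm B ba≈ab i _)
        (Linear.cong (shiftBy-linear i) (falling-comm B ba≈ab i x))

      positivePart-comm : ∀ {b} (B : Linear M M b) → (∀ x → b (a x) M.≈ᴹ a (b x)) →
                          ∀ i x → b (positivePart a i x) M.≈ᴹ positivePart a i (b x)
      positivePart-comm B ba≈ab zero    x = M.≈ᴹ-refl
      positivePart-comm B ba≈ab (suc i) x = M.≈ᴹ-trans (positivePart-comm B ba≈ab i _)
        (Linear.cong (positivePart-linear i) (shiftBy-comm B ba≈ab (suc i) x))

      falling-suc : ∀ i x → falling a (suc i) x M.≈ᴹ positivePart a i (a x)
      falling-suc zero x = M.begin
        a x M.+ᴹ (R.- R.0#) M.*ₗ x   M.≈⟨ M.+ᴹ-congˡ (M.*ₗ-cong (RingProperties.-0#≈0# R.ring) M.≈ᴹ-refl) ⟩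
        a x M.+ᴹ R.0# M.*ₗ x         M.≈⟨ M.+ᴹ-congˡ (M.*ₗ-zeroˡ x) ⟩
        a x M.+ᴹ M.0ᴹ                M.≈⟨ M.+ᴹ-identityʳ _ ⟩
        a x                          M.∎
      falling-suc (suc i) x = M.≈ᴹ-trans (Linear.cong (shiftBy-linear (suc i)) (falling-suc i x))
        (M.≈ᴹ-sym (shiftBy-commᵖ i (suc i)))
        where
        shiftBy-commᵖ : ∀ i j → positivePart a i (shiftBy j a (a x)) M.≈ᴹ
                                  shiftBy j a (positivePart a i (a x))
        shiftBy-commᵖ i j = shiftBy-comm (positivePart-linear i)
          (λ y → M.≈ᴹ-sym (positivePart-comm A (λ _ → M.≈ᴹ-refl) i y)) j (a x)

      kernel-falling : ∀ {x} → a x M.≈ᴹ M.0ᴹ → ∀ i → falling a (suc i) x M.≈ᴹ M.0ᴹ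
      kernel-falling {x} ax≈0 i = M.≈ᴹ-trans (falling-suc i x)
        (M.≈ᴹ-trans (Linear.cong (positivePart-linear i) ax≈0) (Linear.zero-homo (positivePart-linear i)))

    -- If (a + b) x = 0 while x is killed by (a - 1)⋯(a - i) and by (b - 1)⋯(b - j), then x = 0:
    -- on a common eigenvector a + b would act by a positive integer.
    module _ (cancel : ∀ i x → ι (suc i) M.*ₗ x M.≈ᴹ M.0ᴹ → x M.≈ᴹ M.0ᴹ)
             {a b} (A : Linear M M a) (B : Linear M M b) (ab≈ba : ∀ x → a (b x) M.≈ᴹ b (a x)) where
      private
        a+b : M.Carrierᴹ → M.Carrierᴹ
        a+b x = a x M.+ᴹ b x

        ι-+ : ∀ i j → ι (i +ℕ j) R.≈ ι i R.+ ι j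
        ι-+ zero    j = R.sym (R.+-identityˡ _)
        ι-+ (suc i) j = R.trans (R.+-congˡ (ι-+ i j)) (R.sym (R.+-assoc _ _ _))

        eigen : ∀ {e x} i → shiftBy i e x M.≈ᴹ M.0ᴹ → e x M.≈ᴹ ι i M.*ₗ x
        eigen {e} {x} i eq = M.begin
          e x                                                M.≈⟨ M.+ᴹ-identityʳ _ ⟨
          e x M.+ᴹ M.0ᴹ                                      M.≈⟨ M.+ᴹ-congˡ (M.*ₗ-zeroˡ x) ⟨
          e x M.+ᴹ R.0# M.*ₗ x                               M.≈⟨ M.+ᴹ-congˡ (M.*ₗ-cong (R.-‿inverseˡ _) M.≈ᴹ-refl) ⟨
          e x M.+ᴹ ((R.- ι i) R.+ ι i) M.*ₗ x                M.≈⟨ M.+ᴹ-congˡ (M.*ₗ-distribʳ x _ _) ⟩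
          e x M.+ᴹ ((R.- ι i) M.*ₗ x M.+ᴹ ι i M.*ₗ x)        M.≈⟨ M.+ᴹ-assoc _ _ _ ⟨
          shiftBy i e x M.+ᴹ ι i M.*ₗ x                      M.≈⟨ M.+ᴹ-congʳ eq ⟩
          M.0ᴹ M.+ᴹ ι i M.*ₗ x                               M.≈⟨ M.+ᴹ-identityˡ _ ⟩
          ι i M.*ₗ x                                         M.∎

        sum-kernel-shift : ∀ {e} (E : Linear M M e) → (∀ x → a+b (e x) M.≈ᴹ e (a+b x)) →
                           ∀ i {x} → a+b x M.≈ᴹ M.0ᴹ → a+b (shiftBy i e x) M.≈ᴹ M.0ᴹ
        sum-kernel-shift E comm i p = M.≈ᴹ-trans (shiftBy-comm E (+-linear A B) comm i _)
          (M.≈ᴹ-trans (Linear.cong (shiftBy-linear E i) p) (Linear.zero-homo (shiftBy-linear E i)))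

      no-positive-eigenvalue : ∀ i j {x} → a+b x M.≈ᴹ M.0ᴹ → positivePart a i x M.≈ᴹ M.0ᴹ →
                               positivePart b j x M.≈ᴹ M.0ᴹ → x M.≈ᴹ M.0ᴹ
      no-positive-eigenvalue zero    j       _ p _ = p
      no-positive-eigenvalue (suc i) zero    _ _ q = q
      -- The vectors (a - i - 1) x and (b - j - 1) x satisfy the hypotheses with one factor fewer,
      -- hence vanish. So x is a common eigenvector, and a + b multiplies it by i + j + 2, which is
      -- invertible.
      no-positive-eigenvalue (suc i) (suc j) {x} s p q = cancel (i +ℕ suc j) x (M.begin
        ι (suc i +ℕ suc j) M.*ₗ x                  M.≈⟨ M.*ₗ-cong (ι-+ (suc i) (suc j)) M.≈ᴹ-refl ⟩
        (ι (suc i) R.+ ι (suc j)) M.*ₗ x           M.≈⟨ M.*ₗ-distribʳ x _ _ ⟩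
        ι (suc i) M.*ₗ x M.+ᴹ ι (suc j) M.*ₗ x     M.≈⟨ M.+ᴹ-cong (eigen {a} (suc i) a-eigen) (eigen {b} (suc j) b-eigen) ⟨
        a+b x                                      M.≈⟨ s ⟩
        M.0ᴹ                                       M.∎)
        where
        a-eigen : shiftBy (suc i) a x M.≈ᴹ M.0ᴹ
        a-eigen = no-positive-eigenvalue i (suc j)
          (sum-kernel-shift A (λ y → M.≈ᴹ-trans (M.+ᴹ-cong M.≈ᴹ-refl (M.≈ᴹ-sym (ab≈ba y))) (M.≈ᴹ-sym (Linear.+-homo A _ _))) (suc i) s)
          p
          (M.≈ᴹ-trans (shiftBy-comm A (positivePart-linear B (suc j))
              (λ y → M.≈ᴹ-sym (positivePart-comm B A ab≈ba (suc j) y)) (suc i) x)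
            (M.≈ᴹ-trans (Linear.cong (shiftBy-linear A (suc i)) q) (Linear.zero-homo (shiftBy-linear A (suc i)))))
        b-eigen : shiftBy (suc j) b x M.≈ᴹ M.0ᴹ
        b-eigen = no-positive-eigenvalue (suc i) j
          (sum-kernel-shift B (λ y → M.≈ᴹ-trans (M.+ᴹ-cong (ab≈ba y) M.≈ᴹ-refl) (M.≈ᴹ-sym (Linear.+-homo B _ _))) (suc j) s)
          (M.≈ᴹ-trans (shiftBy-comm B (positivePart-linear A (suc i))
              (λ y → M.≈ᴹ-sym (positivePart-comm A B (λ z → M.≈ᴹ-sym (ab≈ba z)) (suc i) y)) (suc j) x)
            (M.≈ᴹ-trans (Linear.cong (shiftBy-linear B (suc j)) p) (Linear.zero-homo (shiftBy-linear B (suc j)))))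
          q

      -- `no-positive-eigenvalue` is applied to a x: the falling factorial of a at x is the positive
      -- part of a at a x, and a x = - b x carries the hypothesis on b over to the same vector.
      sum-kernel : ∀ i j {x} → a+b x M.≈ᴹ M.0ᴹ → falling a (suc i) x M.≈ᴹ M.0ᴹ →
                   falling b (suc j) x M.≈ᴹ M.0ᴹ → a x M.≈ᴹ M.0ᴹ × b x M.≈ᴹ M.0ᴹ
      sum-kernel i j {x} s p q = ax≈0 , (M.begin
        b x               M.≈⟨ bx≈-ax ⟩
        M.-ᴹ a x          M.≈⟨ M.-ᴹ‿cong ax≈0 ⟩
        M.-ᴹ M.0ᴹ         M.≈⟨ M.-ᴹ-0ᴹ ⟩
        M.0ᴹ              M.∎)
        where
        bx≈-ax : b x M.≈ᴹ M.-ᴹ a x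
        bx≈-ax = M.inverseʳ-uniqueᴹ _ _ s
        module G = Linear (positivePart-linear B j)
        ax≈0 : a x M.≈ᴹ M.0ᴹ
        ax≈0 = no-positive-eigenvalue i j
          (M.≈ᴹ-trans (M.+ᴹ-congˡ (M.≈ᴹ-sym (ab≈ba x))) (M.≈ᴹ-trans (M.≈ᴹ-sym (Linear.+-homo A _ _))
            (M.≈ᴹ-trans (Linear.cong A s) (Linear.zero-homo A))))
          (M.≈ᴹ-trans (M.≈ᴹ-sym (falling-suc A i x)) p)
          (M.begin
            positivePart b j (a x)           M.≈⟨ G.cong (M.-ᴹ-involutive _) ⟨
            positivePart b j (M.-ᴹ M.-ᴹ a x) M.≈⟨ G.cong (M.-ᴹ‿cong bx≈-ax) ⟨
            positivePart b j (M.-ᴹ b x)      M.≈⟨ G.neg-homo _ ⟩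
            M.-ᴹ positivePart b j (b x)      M.≈⟨ M.-ᴹ‿cong (M.≈ᴹ-trans (M.≈ᴹ-sym (falling-suc B j x)) q) ⟩
            M.-ᴹ M.0ᴹ                        M.≈⟨ M.-ᴹ-0ᴹ ⟩
            M.0ᴹ                             M.∎)

  module _ {m ℓm n ℓn} {M : Module m ℓm} {N : Module n ℓn} {h} (H : Linear M N h) where
    private
      module M = ModuleReasoning M
      module N = ModuleReasoning N

    falling-natural : ∀ {a b} → Linear N N b → (∀ x → h (a x) N.≈ᴹ b (h x)) →
                      ∀ i x → h (falling M a i x) N.≈ᴹ falling N b i (h x)
    falling-natural B comm zero    x = N.≈ᴹ-refl
    falling-natural B comm (suc i) x = N.≈ᴹ-trans (Linear.+-homo H _ _)
      (N.≈ᴹ-trans (N.+ᴹ-cong (comm _) (Linear.*ₗ-homo H _ _))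
        (Linear.cong (shiftBy-linear N B i) (falling-natural B comm i x)))

  module Projection (coef : ℕ → R.Carrier) (coef-0 : coef 0 R.≈ R.1#)
                    (coef-suc : ∀ i → coef (suc i) R.* ι (suc i) R.≈ R.- coef i) where

    module _ {m ℓm} (M : Module m ℓm) where
      private
        module M = ModuleReasoning M

      -- For coefficients (-1)^i / i! this is the sum of (-1)^i binom(a, i) over i ≤ n, which is 1
      -- on eigenvalue 0 and 0 on the eigenvalues 1, ..., n. The rule `coef-suc` is the recursion of
      -- these coefficients.
      projection : (M.Carrierᴹ → M.Carrierᴹ) → ℕ → M.Carrierᴹ → M.Carrierᴹ
      projection a zero    x = x
      projection a (suc n) x = projection a n x M.+ᴹ coef (suc n) M.*ₗ falling M a (suc n) x

      module _ {a} (A : Linear M M a) where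
        projection-linear : ∀ n → Linear M M (projection a n)
        projection-linear zero    = id-linear
        projection-linear (suc n) = +-linear (projection-linear n) (*ₗ-linear _ (falling-linear M A (suc n)))

        projection-comm : ∀ n x → a (projection a n x) M.≈ᴹ projection a n (a x)
        projection-comm zero    x = M.≈ᴹ-refl
        projection-comm (suc n) x = M.≈ᴹ-trans (Linear.+-homo A _ _)
          (M.+ᴹ-cong (projection-comm n x) (M.≈ᴹ-trans (Linear.*ₗ-homo A _ _)
            (M.*ₗ-cong R.refl (falling-comm M A A (λ _ → M.≈ᴹ-refl) (suc n) x))))

        kernel-projection : ∀ {x} → a x M.≈ᴹ M.0ᴹ → ∀ n → projection a n x M.≈ᴹ x
        kernel-projection ax≈0 zero    = M.≈ᴹ-refl
        kernel-projection ax≈0 (suc n) = M.≈ᴹ-trans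
          (M.+ᴹ-cong (kernel-projection ax≈0 n)
            (M.≈ᴹ-trans (M.*ₗ-cong R.refl (kernel-falling M A ax≈0 n)) (M.*ₗ-zeroʳ _)))
          (M.+ᴹ-identityʳ _)

        private
          a-falling : ∀ i x → a (falling M a i x) M.≈ᴹ falling M a (suc i) x M.+ᴹ ι i M.*ₗ falling M a i x
          a-falling i x = M.≈ᴹ-sym (M.begin
            (a y M.+ᴹ (R.- ι i) M.*ₗ y) M.+ᴹ ι i M.*ₗ y   M.≈⟨ M.+ᴹ-assoc _ _ _ ⟩
            a y M.+ᴹ ((R.- ι i) M.*ₗ y M.+ᴹ ι i M.*ₗ y)   M.≈⟨ M.+ᴹ-congˡ (M.*ₗ-distribʳ y _ _) ⟨
            a y M.+ᴹ ((R.- ι i) R.+ ι i) M.*ₗ y           M.≈⟨ M.+ᴹ-congˡ (M.*ₗ-cong (R.-‿inverseˡ _) M.≈ᴹ-refl) ⟩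
            a y M.+ᴹ R.0# M.*ₗ y                          M.≈⟨ M.+ᴹ-congˡ (M.*ₗ-zeroˡ y) ⟩
            a y M.+ᴹ M.0ᴹ                                 M.≈⟨ M.+ᴹ-identityʳ _ ⟩
            a y                                           M.∎)
            where y = falling M a i x

        -- The sum telescopes.
        a-projection : ∀ n x → a (projection a n x) M.≈ᴹ coef n M.*ₗ falling M a (suc n) x
        a-projection zero x = M.≈ᴹ-sym (M.≈ᴹ-trans (M.*ₗ-cong coef-0 (falling-suc M A 0 x)) (M.*ₗ-identityˡ _))
        a-projection (suc n) x = M.begin
          a (projection a n x M.+ᴹ c′ M.*ₗ f)                       M.≈⟨ Linear.+-homo A _ _ ⟩
          a (projection a n x) M.+ᴹ a (c′ M.*ₗ f)                   M.≈⟨ M.+ᴹ-cong (a-projection n x) (Linear.*ₗ-homo A _ _) ⟩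
          coef n M.*ₗ f M.+ᴹ c′ M.*ₗ a f                            M.≈⟨ M.+ᴹ-congˡ (M.*ₗ-cong R.refl (a-falling (suc n) x)) ⟩
          coef n M.*ₗ f M.+ᴹ c′ M.*ₗ (f′ M.+ᴹ ι (suc n) M.*ₗ f)     M.≈⟨ M.+ᴹ-congˡ (M.*ₗ-distribˡ _ _ _) ⟩
          coef n M.*ₗ f M.+ᴹ (c′ M.*ₗ f′ M.+ᴹ c′ M.*ₗ ι (suc n) M.*ₗ f)
            M.≈⟨ M.+ᴹ-congˡ (M.+ᴹ-congˡ (M.≈ᴹ-trans (M.≈ᴹ-sym (M.*ₗ-assoc _ _ _)) (M.*ₗ-cong (coef-suc n) M.≈ᴹ-refl))) ⟩
          coef n M.*ₗ f M.+ᴹ (c′ M.*ₗ f′ M.+ᴹ (R.- coef n) M.*ₗ f)  M.≈⟨ M.+ᴹ-congˡ (M.+ᴹ-comm _ _) ⟩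
          coef n M.*ₗ f M.+ᴹ ((R.- coef n) M.*ₗ f M.+ᴹ c′ M.*ₗ f′)  M.≈⟨ M.+ᴹ-assoc _ _ _ ⟨
          (coef n M.*ₗ f M.+ᴹ (R.- coef n) M.*ₗ f) M.+ᴹ c′ M.*ₗ f′  M.≈⟨ M.+ᴹ-congʳ (M.*ₗ-distribʳ f _ _) ⟨
          (coef n R.+ (R.- coef n)) M.*ₗ f M.+ᴹ c′ M.*ₗ f′          M.≈⟨ M.+ᴹ-congʳ (M.*ₗ-cong (R.-‿inverseʳ _) M.≈ᴹ-refl) ⟩
          R.0# M.*ₗ f M.+ᴹ c′ M.*ₗ f′                               M.≈⟨ M.+ᴹ-congʳ (M.*ₗ-zeroˡ f) ⟩
          M.0ᴹ M.+ᴹ c′ M.*ₗ f′                                      M.≈⟨ M.+ᴹ-identityˡ _ ⟩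
          c′ M.*ₗ f′                                                M.∎
          where
          c′ = coef (suc n)
          f = falling M a (suc n) x
          f′ = falling M a (suc (suc n)) x

    -- Meant for h sending x to x ⊗ z or z ⊗ x: a polynomial in D ⊗ 1 or 1 ⊗ D acts on a pure tensor
    -- through the same polynomial in D on one factor.
    projection-natural : ∀ {m ℓm n ℓn} {M : Module m ℓm} {N : Module n ℓn} {h} (H : Linear M N h) →
      ∀ {a b} → Linear N N b → (∀ x → LeftModule._≈ᴹ_ N (h (a x)) (b (h x))) →
      ∀ i x → LeftModule._≈ᴹ_ N (h (projection M a i x)) (projection N b i (h x))
    projection-natural {N = N} H B comm zero    x = LeftModule.≈ᴹ-refl N
    projection-natural {N = N} H B comm (suc i) x = N.≈ᴹ-trans (Linear.+-homo H _ _)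
      (N.+ᴹ-cong (projection-natural H B comm i x) (N.≈ᴹ-trans (Linear.*ₗ-homo H _ _)
        (N.*ₗ-cong R.refl (falling-natural H B comm (suc i) x))))
      where module N = LeftModule N

-- Bialgebras with a basis of packed words

module PackedWordBialgebras {c ℓ} (R : CommutativeRing c ℓ) where
  open LinearAlgebra R

  -- What the argument asks of 𝒲: the operations are known on the elements `N u`, `spanning` gives
  -- uniqueness of linear maps and `extend` their existence. The abstract carrier separates the
  -- combinatorics from the encoding of formal sums as lists of terms.
  record IsPackedWordBialgebra
    {a ℓa} (A : RawBialgebra a ℓa)
    (N : PackedWord → RawBialgebra.Carrier A)
    (_⋆_ : RawBialgebra.Carrier A → RawBialgebra.Carrier A → RawBialgebra.Carrier A)
    (extend : (PackedWord → RawBialgebra.Carrier A) →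
              RawBialgebra.Carrier A → RawBialgebra.Carrier A) :
    Set (c ⊔ ℓ ⊔ a ⊔ ℓa) where
    open RawBialgebra A
    field
      isLeftModule : IsLeftModule R.ring _≈_ _+_ 0# -_ _*ₗ_

    𝓐 : Module a ℓa
    𝓐 = record { isLeftModule = isLeftModule }

    field
      spanning      : ∀ x → Span rawAlgebra (λ F → ∃ λ u → F ≡ N u) x
      extend-linear : ∀ f → Linear 𝓐 𝓐 (extend f)
      extend-N      : ∀ f u → extend f (N u) ≈ f u
      *-bilinear    : Bilinear 𝓐 𝓐 𝓐 _*_
      ⋆-bilinear    : Bilinear 𝓐 𝓐 𝓐 _⋆_
      Δ-linear      : Linear 𝓐 (𝓐 ⊗ᴹ 𝓐) Δ
      ε-linear      : Linear 𝓐 scalars ε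
      1-N           : 1# ≈ N (ones 0)
      -- `packWord` makes the summand a function of arbitrary words; the words of a shifted shuffle
      -- of packed words are packed already.
      *-N           : ∀ u v → N u * N v ≈
                        WordSums.Ш R 𝓐 (λ w → N (packWord w)) (word u) (shift (word u) (word v))
      Δ-N           : ∀ w → TensorEq (raw 𝓐) (raw 𝓐) (Δ (N w))
                        (WordSums.Cut R (𝓐 ⊗ᴹ 𝓐) (λ a b → [ N (packWord a) , N (packWord b) ]) (word w))
      ε-N-empty     : ε (N (ones 0)) R.≈ R.1#
      ε-N-nonempty  : ∀ u → word u ≢ [] → ε (N u) R.≈ R.0#
      ⋆-N           : ∀ u v → length (word u) ≡ length (word v) → (N u ⋆ N v) ≈ N (packPair u v)
      ⋆-N-≢         : ∀ u v → length (word u) ≢ length (word v) → (N u ⋆ N v) ≈ 0#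

  module Basis {a ℓa} {A : RawBialgebra a ℓa} {N _⋆_ extend}
               (isPWB : IsPackedWordBialgebra A N _⋆_ extend) where
    open RawBialgebra A hiding (-_; rawLeftModule)
    open IsPackedWordBialgebra isPWB
    open ModuleReasoning 𝓐
      using (begin_; step-≈-⟩; step-≈-⟨; _∎; -ᴹ_; ≈ᴹ-refl; ≈ᴹ-sym; ≈ᴹ-trans; ≈ᴹ-reflexive;
             +ᴹ-cong; +ᴹ-congˡ; +ᴹ-identityˡ; +ᴹ-identityʳ; -ᴹ‿cong; -ᴹ‿inverseˡ; *ₗ-zeroˡ;
             *ₗ-cong; *ₗ-identityˡ)
    private
      module T² = ModuleReasoning (𝓐 ⊗ᴹ 𝓐)
      module S = WordSums R 𝓐
      module S² = WordSums R (𝓐 ⊗ᴹ 𝓐)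
      module S³ = WordSums R (𝓐 ⊗ᴹ (𝓐 ⊗ᴹ 𝓐))
      module K = WordSums R scalars

    open Bilinear *-bilinear public renaming (linearˡ to *-linearˡ; linearʳ to *-linearʳ)
    open Bilinear ⋆-bilinear public renaming (linearˡ to ⋆-linearˡ; linearʳ to ⋆-linearʳ)
    open Bilinear (pure-bilinear {M = 𝓐} {N = 𝓐}) public
      renaming (linearˡ to pure-linearˡ; linearʳ to pure-linearʳ)

    *-cong : ∀ {x x′ y y′} → x ≈ x′ → y ≈ y′ → x * y ≈ x′ * y′
    *-cong p q = ≈ᴹ-trans (Linear.cong (*-linearˡ _) p) (Linear.cong (*-linearʳ _) q)

    ⋆-cong : ∀ {x x′ y y′} → x ≈ x′ → y ≈ y′ → (x ⋆ y) ≈ (x′ ⋆ y′)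
    ⋆-cong p q = ≈ᴹ-trans (Linear.cong (⋆-linearˡ _) p) (Linear.cong (⋆-linearʳ _) q)

    module _ {m ℓm} {M : Module m ℓm} {f g : Carrier → LeftModule.Carrierᴹ M} where
      private
        module M = ModuleReasoning M

      Span-ext : ∀ {s} {P : Pred Carrier s} → Linear 𝓐 M f → Linear 𝓐 M g →
                 (∀ x → P x → f x M.≈ᴹ g x) → ∀ {x} → Span rawAlgebra P x → f x M.≈ᴹ g x
      Span-ext F G e (generator p) = e _ p
      Span-ext F G e zero = M.≈ᴹ-trans (Linear.zero-homo F) (M.≈ᴹ-sym (Linear.zero-homo G))
      Span-ext F G e (add p q) = M.≈ᴹ-trans (Linear.+-homo F _ _)
        (M.≈ᴹ-trans (M.+ᴹ-cong (Span-ext F G e p) (Span-ext F G e q)) (M.≈ᴹ-sym (Linear.+-homo G _ _)))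
      Span-ext F G e (scale k p) = M.≈ᴹ-trans (Linear.*ₗ-homo F k _)
        (M.≈ᴹ-trans (M.*ₗ-cong R.refl (Span-ext F G e p)) (M.≈ᴹ-sym (Linear.*ₗ-homo G k _)))
      Span-ext F G e (respects eq p) = M.≈ᴹ-trans (Linear.cong F (≈ᴹ-sym eq))
        (M.≈ᴹ-trans (Span-ext F G e p) (Linear.cong G eq))

      ext : Linear 𝓐 M f → Linear 𝓐 M g → (∀ u → f (N u) M.≈ᴹ g (N u)) → ∀ x → f x M.≈ᴹ g x
      ext F G e x = Span-ext F G (λ { _ (u , ≡.refl) → e u }) (spanning x)

    ext₂ : ∀ {m ℓm} {M : Module m ℓm} {f g : Carrier → Carrier → LeftModule.Carrierᴹ M} →
           Bilinear 𝓐 𝓐 M f → Bilinear 𝓐 𝓐 M g →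
           (∀ u v → LeftModule._≈ᴹ_ M (f (N u) (N v)) (g (N u) (N v))) →
           ∀ x y → LeftModule._≈ᴹ_ M (f x y) (g x y)
    ext₂ F G e x y = ext (Bilinear.linearˡ F y) (Bilinear.linearˡ G y)
      (λ u → ext (Bilinear.linearʳ F _) (Bilinear.linearʳ G _) (e u) y) x

    -- Words are kept unpacked over whichever alphabet describes them best, so that an operation can
    -- be applied to the result of another one without packing in between.
    Nᵒ : (O : Order) → List ∣ O ∣ᵒ → Carrier
    Nᵒ O w = N (pack O w)

    Nᵒ-≋ : ∀ {O P} (S : Similarity O P) {u v} → S ⊢ u ≋ v → Nᵒ O u ≈ Nᵒ P v
    Nᵒ-≋ S p = ≈ᴹ-reflexive (≡.cong N (pack-cong S p))

    N≈Nᵒ : ∀ u → N u ≈ Nᵒ ℕᵒ (word u)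
    N≈Nᵒ u = ≈ᴹ-reflexive (≡.cong N (≡.sym (packWord-word u)))

    1≈Nᵒ : ∀ O → 1# ≈ Nᵒ O []
    1≈Nᵒ O = ≈ᴹ-trans 1-N (≈ᴹ-reflexive (≡.cong N (word-injective ≡.refl)))

    Nᵒ-* : ∀ O P u v → Nᵒ O u * Nᵒ P v ≈ S.Ш (Nᵒ (O ⊎ᵒ P)) (map inj₁ u) (map inj₂ v)
    Nᵒ-* O P u v = ≈ᴹ-trans (*-N (pack O u) (pack P v))
      (S.Ш-rel (T ⊢_∼_) (low (rank-≋ O u) (xs≤max 0 (word (pack O u))))
        (high (rank-≋ P v) (All.tabulate (λ k∈ → proj₁ (Equivalence.to (Packing.ranks-packed P v _) k∈))))
        (Nᵒ-≋ T))
      where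
      m = max 0 (word (pack O u))
      T = shift-∼ m ⨾ (rank-∼ O u ⊎-∼ rank-∼ P v)
      low : ∀ {ks w} → rank-∼ O u ⊢ ks ≋ w → All (_≤ m) ks → T ⊢ ks ≋ map inj₁ w
      low []       _        = []
      low (r ∷ rs) (p ∷ ps) = (_ , lowᴿ p , leftᴿ r) ∷ low rs ps
      high : ∀ {ks w} → rank-∼ P v ⊢ ks ≋ w → All (1 ≤_) ks → T ⊢ map (m +ℕ_) ks ≋ map inj₂ w
      high []       _        = []
      high (r ∷ rs) (p ∷ ps) = (_ , highᴿ p , rightᴿ r) ∷ high rs ps

    Nᵒ-Δ : ∀ O w → Δ (Nᵒ O w) T².≈ᴹ S².Cut (λ a b → [ Nᵒ O a , Nᵒ O b ]) w
    Nᵒ-Δ O w = ≈-trans (Δ-N (pack O w)) (S².Cut-rel (rank-∼ O w ⊢_∼_) (rank-≋ O w)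
      (λ p q → ⊗-cong (Nᵒ-≋ (rank-∼ O w) p) (Nᵒ-≋ (rank-∼ O w) q)))

    zip-≋ : ∀ {O O′ P P′} (S : Similarity O P) (T : Similarity O′ P′) {u u′ v v′} →
            S ⊢ u ≋ v → T ⊢ u′ ≋ v′ → S ×-∼ T ⊢ zip u u′ ≋ zip v v′
    zip-≋ S T []       _        = []
    zip-≋ S T (_ ∷ _)  []       = []
    zip-≋ S T (r ∷ rs) (s ∷ ss) = (r , s) ∷ zip-≋ S T rs ss

    Nᵒ-⋆ : ∀ O P u v → length u ≡ length v → (Nᵒ O u ⋆ Nᵒ P v) ≈ Nᵒ (O ×ᵒ P) (zip u v)
    Nᵒ-⋆ O P u v eq = ≈ᴹ-trans
      (⋆-N (pack O u) (pack P v) (≡.trans (length-pack O u) (≡.trans eq (≡.sym (length-pack P v)))))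
      (Nᵒ-≋ (rank-∼ O u ×-∼ rank-∼ P v) (zip-≋ (rank-∼ O u) (rank-∼ P v) (rank-≋ O u) (rank-≋ P v)))

    -- Associativity and unit of the ordinary product

    *-assoc : ∀ x y z → (x * y) * z ≈ x * (y * z)
    *-assoc x y z = ext₂
      (bilinear-∘ (*-linearˡ z) *-bilinear)
      (record { linearˡ = λ y → *-linearˡ _ ; linearʳ = λ x → *-linearʳ x ∘ᴸ *-linearˡ z })
      (λ u v → ext (*-linearʳ (N u * N v)) (*-linearʳ (N u) ∘ᴸ *-linearʳ (N v)) (basis u v) z) x y
      where
      basis : ∀ u v w → (N u * N v) * N w ≈ N u * (N v * N w)
      basis u v w = begin
        (N u * N v) * N w
          ≈⟨ *-cong (*-cong (N≈Nᵒ u) (N≈Nᵒ v)) (N≈Nᵒ w) ⟩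
        (Nᵒ O (word u) * Nᵒ O (word v)) * Nᵒ O (word w)
          ≈⟨ *-cong (Nᵒ-* O O _ _) ≈ᴹ-refl ⟩
        S.Ш (Nᵒ (O ⊎ᵒ O)) u₁ v₂ * Nᵒ O (word w)
          ≈⟨ Ш-linear R (*-linearˡ _) _ u₁ v₂ ⟩
        S.Ш (λ t → Nᵒ (O ⊎ᵒ O) t * Nᵒ O (word w)) u₁ v₂
          ≈⟨ S.Ш-cong u₁ v₂ (λ t → Nᵒ-* (O ⊎ᵒ O) O t (word w)) ⟩
        S.Ш (λ t → S.Ш (Nᵒ ((O ⊎ᵒ O) ⊎ᵒ O)) (map inj₁ t) w₂) u₁ v₂
          ≈⟨ S.Ш-map inj₁ _ u₁ v₂ ⟩
        S.Ш (λ t → S.Ш (Nᵒ ((O ⊎ᵒ O) ⊎ᵒ O)) t w₂) (map inj₁ u₁) (map inj₁ v₂)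
          ≈⟨ S.Ш-assoc _ (map inj₁ u₁) (map inj₁ v₂) w₂ ⟩
        S.Ш (λ t → S.Ш (Nᵒ ((O ⊎ᵒ O) ⊎ᵒ O)) (map inj₁ u₁) t) (map inj₁ v₂) w₂
          ≈⟨ S.Ш-rel (T ⊢_∼_) (v~ (word v)) (w~ (word w)) (λ t → S.Ш-rel (T ⊢_∼_) (u~ (word u)) t (Nᵒ-≋ T)) ⟩
        S.Ш (λ t → S.Ш (Nᵒ (O ⊎ᵒ (O ⊎ᵒ O))) u₁′ t) (map inj₂ v₁) (map inj₂ w₂′)
          ≈⟨ S.Ш-map inj₂ _ v₁ w₂′ ⟨
        S.Ш (λ t → S.Ш (Nᵒ (O ⊎ᵒ (O ⊎ᵒ O))) u₁′ (map inj₂ t)) v₁ w₂′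
          ≈⟨ S.Ш-cong v₁ w₂′ (λ t → Nᵒ-* O (O ⊎ᵒ O) (word u) t) ⟨
        S.Ш (λ t → Nᵒ O (word u) * Nᵒ (O ⊎ᵒ O) t) v₁ w₂′
          ≈⟨ Ш-linear R (*-linearʳ _) _ v₁ w₂′ ⟨
        Nᵒ O (word u) * S.Ш (Nᵒ (O ⊎ᵒ O)) v₁ w₂′
          ≈⟨ *-cong ≈ᴹ-refl (Nᵒ-* O O _ _) ⟨
        Nᵒ O (word u) * (Nᵒ O (word v) * Nᵒ O (word w))
          ≈⟨ *-cong (N≈Nᵒ u) (*-cong (N≈Nᵒ v) (N≈Nᵒ w)) ⟨
        N u * (N v * N w) ∎
        where
        O = ℕᵒ
        T = ⊎-assoc-∼ {O} {O} {O}
        u₁ = map inj₁ (word u) ; v₂ = map inj₂ (word v) ; w₂ = map inj₂ (word w)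
        u₁′ = map inj₁ (word u) ; v₁ = map inj₁ (word v) ; w₂′ = map inj₂ (word w)
        u~ : ∀ t → T ⊢ map inj₁ (map inj₁ t) ≋ map inj₁ t
        u~ []      = []
        u~ (_ ∷ t) = firstᴿ ∷ u~ t
        v~ : ∀ t → T ⊢ map inj₁ (map inj₂ t) ≋ map inj₂ (map inj₁ t)
        v~ []      = []
        v~ (_ ∷ t) = secondᴿ ∷ v~ t
        w~ : ∀ t → T ⊢ map inj₂ t ≋ map inj₂ (map inj₂ t)
        w~ []      = []
        w~ (_ ∷ t) = thirdᴿ ∷ w~ t

    *-identityˡ : ∀ x → 1# * x ≈ x
    *-identityˡ = ext (*-linearʳ 1#) id-linear (λ u → ≈ᴹ-trans (*-cong (1≈Nᵒ ℕᵒ) (N≈Nᵒ u))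
      (≈ᴹ-trans (Nᵒ-* ℕᵒ ℕᵒ [] (word u))
      (≈ᴹ-trans (≈ᴹ-sym (Nᵒ-≋ (inj₂-∼ {ℕᵒ} {ℕᵒ}) (map-≋ (inj₂-∼ {ℕᵒ} {ℕᵒ}) inj₂ (λ _ → ≡.refl) (word u)))) (≈ᴹ-sym (N≈Nᵒ u)))))

    *-identityʳ : ∀ x → x * 1# ≈ x
    *-identityʳ = ext (*-linearˡ 1#) id-linear (λ u → ≈ᴹ-trans (*-cong (N≈Nᵒ u) (1≈Nᵒ ℕᵒ))
      (≈ᴹ-trans (Nᵒ-* ℕᵒ ℕᵒ (word u) [])
      (≈ᴹ-trans (≈ᴹ-reflexive (S.Ш-[]ʳ _ (map inj₁ (word u))))
      (≈ᴹ-trans (≈ᴹ-sym (Nᵒ-≋ (inj₁-∼ {ℕᵒ} {ℕᵒ}) (map-≋ (inj₁-∼ {ℕᵒ} {ℕᵒ}) inj₁ (λ _ → ≡.refl) (word u)))) (≈ᴹ-sym (N≈Nᵒ u))))))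

    isAlgebra : IsAlgebra rawAlgebra
    isAlgebra = record
      { isRing = record
        { +-isAbelianGroup = IsLeftModule.+ᴹ-isAbelianGroup isLeftModule
        ; *-cong = *-cong
        ; *-assoc = *-assoc
        ; *-identity = *-identityˡ , *-identityʳ
        ; distrib = (λ x y z → Linear.+-homo (*-linearʳ x) y z) , (λ x y z → Linear.+-homo (*-linearˡ x) y z)
        }
      ; isLeftModule = isLeftModule
      ; *ₗ-*-assoc = λ k x y → Linear.*ₗ-homo (*-linearˡ y) k x
      ; *-*ₗ-comm = λ k x y → Linear.*ₗ-homo (*-linearʳ x) k y
      }

    -- Coproduct and counit

    infixl 7 _⊛_
    _⊛_ : List (Carrier × Carrier) → List (Carrier × Carrier) → List (Carrier × Carrier)
    _⊛_ = cartesianProductWith (Product.zip _*_ _*_)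

    open Bilinear (⊛-bilinear *-bilinear) using () renaming (linearˡ to ⊛-linearˡ; linearʳ to ⊛-linearʳ)

    Δ-*-homo : ∀ x y → Δ (x * y) T².≈ᴹ Δ x ⊛ Δ y
    Δ-*-homo = ext₂ (bilinear-∘ Δ-linear *-bilinear) (bilinear-∘₂ (⊛-bilinear *-bilinear) Δ-linear Δ-linear) basis
      where
      O = ℕᵒ
      basis : ∀ u v → Δ (N u * N v) T².≈ᴹ Δ (N u) ⊛ Δ (N v)
      basis u v = T².begin
        Δ (N u * N v)
          T².≈⟨ Linear.cong Δ-linear (≈ᴹ-trans (*-cong (N≈Nᵒ u) (N≈Nᵒ v)) (Nᵒ-* O O _ _)) ⟩
        Δ (S.Ш (Nᵒ (O ⊎ᵒ O)) u₁ v₂)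
          T².≈⟨ Ш-linear R Δ-linear _ u₁ v₂ ⟩
        S².Ш (λ t → Δ (Nᵒ (O ⊎ᵒ O) t)) u₁ v₂
          T².≈⟨ S².Ш-cong u₁ v₂ (Nᵒ-Δ (O ⊎ᵒ O)) ⟩
        S².Ш (S².Cut h) u₁ v₂
          T².≈⟨ S².Cut-Ш h u₁ v₂ ⟩
        S².Cut (λ a b → S².Cut (λ c d → S².Ш (λ p → S².Ш (h p) b d) a c) v₂) u₁
          T².≈⟨ S².Cut-map inj₁ _ (word u) ⟨
        S².Cut (λ a b → S².Cut (λ c d → S².Ш (λ p → S².Ш (h p) (map inj₁ b) d) (map inj₁ a) c) v₂) (word u)
          T².≈⟨ S².Cut-cong (word u) (λ a b _ → S².Cut-map inj₂ _ (word v)) ⟨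
        S².Cut (λ a b → S².Cut (λ c d → S².Ш (λ p → S².Ш (h p) (map inj₁ b) (map inj₂ d))
                                          (map inj₁ a) (map inj₂ c)) (word v)) (word u)
          T².≈⟨ S².Cut-cong (word u) (λ a b _ → S².Cut-cong (word v) (λ c d _ → product a b c d)) ⟨
        S².Cut (λ a b → S².Cut (λ c d → [ Nᵒ O a * Nᵒ O c , Nᵒ O b * Nᵒ O d ]) (word v)) (word u)
          T².≈⟨ S².Cut-cong (word u) (λ a b _ → Cut-linear R (⊛-linearʳ [ Nᵒ O a , Nᵒ O b ]) _ (word v)) ⟨
        S².Cut (λ a b → [ Nᵒ O a , Nᵒ O b ] ⊛ S².Cut (λ c d → [ Nᵒ O c , Nᵒ O d ]) (word v)) (word u)
          T².≈⟨ Cut-linear R (⊛-linearˡ _) _ (word u) ⟨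
        S².Cut (λ a b → [ Nᵒ O a , Nᵒ O b ]) (word u) ⊛ S².Cut (λ c d → [ Nᵒ O c , Nᵒ O d ]) (word v)
          T².≈⟨ ≈-trans (Linear.cong (⊛-linearˡ (Δ (N v))) (Δ-N u))
            (Linear.cong (⊛-linearʳ (S².Cut (λ a b → [ Nᵒ O a , Nᵒ O b ]) (word u))) (Δ-N v)) ⟨
        Δ (N u) ⊛ Δ (N v) T².∎
        where
        u₁ = map inj₁ (word u) ; v₂ = map inj₂ (word v)
        h : List (ℕ ⊎ ℕ) → List (ℕ ⊎ ℕ) → List (Carrier × Carrier)
        h p q = [ Nᵒ (O ⊎ᵒ O) p , Nᵒ (O ⊎ᵒ O) q ]
        product : ∀ a b c d → [ Nᵒ O a * Nᵒ O c , Nᵒ O b * Nᵒ O d ] T².≈ᴹ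
                  S².Ш (λ p → S².Ш (h p) (map inj₁ b) (map inj₂ d)) (map inj₁ a) (map inj₂ c)
        product a b c d = ≈-trans (⊗-cong (Nᵒ-* O O a c) (Nᵒ-* O O b d))
          (≈-trans (Ш-linear R (pure-linearˡ _) _ (map inj₁ a) (map inj₂ c))
          (S².Ш-cong (map inj₁ a) (map inj₂ c)
            (λ p → Ш-linear R (pure-linearʳ _) _ (map inj₁ b) (map inj₂ d))))

    Δ-1-homo : Δ 1# T².≈ᴹ [ 1# , 1# ]
    Δ-1-homo = ≈-trans (Linear.cong Δ-linear (1≈Nᵒ ℕᵒ)) (≈-trans (Nᵒ-Δ ℕᵒ [])
      (⊗-cong (≈ᴹ-sym (1≈Nᵒ ℕᵒ)) (≈ᴹ-sym (1≈Nᵒ ℕᵒ))))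

    coassoc : ∀ x → TensorEq (raw 𝓐) (raw (𝓐 ⊗ᴹ 𝓐))
                      (reassociate ((Δ ⟨⊗⟩ id) (Δ x))) ((id ⟨⊗⟩ Δ) (Δ x))
    coassoc = ext left right basis
      where
      module T³ = ModuleReasoning (𝓐 ⊗ᴹ (𝓐 ⊗ᴹ 𝓐))
      reassoc : Linear ((𝓐 ⊗ᴹ 𝓐) ⊗ᴹ 𝓐) (𝓐 ⊗ᴹ (𝓐 ⊗ᴹ 𝓐)) reassociate
      reassoc = reassociate-linear {M = 𝓐} {N = 𝓐} {P = 𝓐}
      Δ⊗id : Linear (𝓐 ⊗ᴹ 𝓐) ((𝓐 ⊗ᴹ 𝓐) ⊗ᴹ 𝓐) (Δ ⟨⊗⟩ id)
      Δ⊗id = ⟨⊗⟩-linear Δ-linear id-linear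
      id⊗Δ : Linear (𝓐 ⊗ᴹ 𝓐) (𝓐 ⊗ᴹ (𝓐 ⊗ᴹ 𝓐)) (id ⟨⊗⟩ Δ)
      id⊗Δ = ⟨⊗⟩-linear id-linear Δ-linear
      left = reassoc ∘ᴸ Δ⊗id ∘ᴸ Δ-linear
      right = id⊗Δ ∘ᴸ Δ-linear
      n = Nᵒ ℕᵒ
      basis : ∀ w → reassociate ((Δ ⟨⊗⟩ id) (Δ (N w))) T³.≈ᴹ (id ⟨⊗⟩ Δ) (Δ (N w))
      basis w = T³.begin
        reassociate ((Δ ⟨⊗⟩ id) (Δ (N w)))
          T³.≈⟨ Linear.cong (reassoc ∘ᴸ Δ⊗id) (Δ-N w) ⟩
        reassociate ((Δ ⟨⊗⟩ id) (S².Cut (λ a b → [ n a , n b ]) (word w)))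
          T³.≈⟨ Cut-linear R (reassoc ∘ᴸ Δ⊗id) _ (word w) ⟩
        S³.Cut (λ a b → reassociate [ Δ (n a) , n b ]) (word w)
          T³.≈⟨ S³.Cut-cong (word w) (λ a b _ → T³.≈ᴹ-trans
            (Linear.cong (bracket b) (Nᵒ-Δ ℕᵒ a)) (Cut-linear R (bracket b) _ a)) ⟩
        S³.Cut (λ a b → S³.Cut (λ a′ a″ → [ n a′ , [ n a″ , n b ] ]) a) (word w)
          T³.≈⟨ S³.Cut-coassoc _ (word w) ⟩
        S³.Cut (λ a b → S³.Cut (λ b′ b″ → [ n a , [ n b′ , n b″ ] ]) b) (word w)
          T³.≈⟨ S³.Cut-cong (word w) (λ a b _ → T³.≈ᴹ-trans
            (Linear.cong (linearʳ (n a)) (Nᵒ-Δ ℕᵒ b)) (Cut-linear R (linearʳ (n a)) _ b)) ⟨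
        S³.Cut (λ a b → [ n a , Δ (n b) ]) (word w)
          T³.≈⟨ Cut-linear R id⊗Δ _ (word w) ⟨
        (id ⟨⊗⟩ Δ) (S².Cut (λ a b → [ n a , n b ]) (word w))
          T³.≈⟨ Linear.cong id⊗Δ (Δ-N w) ⟨
        (id ⟨⊗⟩ Δ) (Δ (N w)) T³.∎
        where
        open Bilinear (pure-bilinear {M = 𝓐} {N = 𝓐 ⊗ᴹ 𝓐})
        bracket : ∀ b → Linear (𝓐 ⊗ᴹ 𝓐) (𝓐 ⊗ᴹ (𝓐 ⊗ᴹ 𝓐)) (λ t → reassociate [ t , n b ])
        bracket b = reassoc ∘ᴸ Bilinear.linearˡ (pure-bilinear {M = 𝓐 ⊗ᴹ 𝓐} {N = 𝓐}) (n b)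

    εᵒ-empty : ∀ O → ε (Nᵒ O []) R.≈ R.1#
    εᵒ-empty O = R.trans (Linear.cong ε-linear (≈ᴹ-reflexive (≡.cong N (word-injective ≡.refl)))) ε-N-empty

    εᵒ-nonempty : ∀ O x w → ε (Nᵒ O (x ∷ w)) R.≈ R.0#
    εᵒ-nonempty O x w = ε-N-nonempty _ (λ ())

    Cut-0 : ∀ {h} (w : List ℕ) → (∀ a b → h a b ≈ 0#) → S.Cut h w ≈ 0#
    Cut-0 w e = S.Cut-closed (_≈ 0#) (λ p q → ≈ᴹ-trans (+ᴹ-cong p q) (+ᴹ-identityˡ 0#)) w (λ a b _ → e a b)

    -- Serves when the first factor of the summand vanishes on nonempty words, as the counit and the
    -- convolution unit `δ` do.
    Cut-first : ∀ {h} (w : List ℕ) → (∀ x a b → h (x ∷ a) b ≈ 0#) → S.Cut h w ≈ h [] w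
    Cut-first []      e = ≈ᴹ-refl
    Cut-first (x ∷ w) e = ≈ᴹ-trans (+ᴹ-congˡ (Cut-0 w (e x))) (+ᴹ-identityʳ _)

    Cut-last : ∀ {h} (w : List ℕ) → (∀ a x b → h a (x ∷ b) ≈ 0#) → S.Cut h w ≈ h w []
    Cut-last []      e = ≈ᴹ-refl
    Cut-last (x ∷ w) e = ≈ᴹ-trans (+ᴹ-cong (e [] x w) (Cut-last w (e ∘ (x ∷_)))) (+ᴹ-identityˡ _)

    fold-Δ : ∀ {b} → Bilinear 𝓐 𝓐 𝓐 b → ∀ w →
             ⟦ b ⟧⊗ (Δ (N w)) ≈ S.Cut (λ u v → b (Nᵒ ℕᵒ u) (Nᵒ ℕᵒ v)) (word w)
    fold-Δ B w = ≈ᴹ-trans (Linear.cong (fold-linear B) (Δ-N w))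
      (≈ᴹ-trans (Cut-linear R (fold-linear B) _ (word w))
      (S.Cut-cong (word w) (λ _ _ _ → +ᴹ-identityʳ _)))

    counitˡ : ∀ x → ⟦ (λ y z → ε y *ₗ z) ⟧⊗ (Δ x) ≈ x
    counitˡ = ext (fold-linear (ε*ˡ ε-linear) ∘ᴸ Δ-linear) id-linear (λ w →
      ≈ᴹ-trans (fold-Δ (ε*ˡ ε-linear) w)
      (≈ᴹ-trans (Cut-first (word w) (λ x a b → ≈ᴹ-trans (*ₗ-cong (εᵒ-nonempty ℕᵒ x a) ≈ᴹ-refl) (*ₗ-zeroˡ _)))
      (≈ᴹ-trans (*ₗ-cong (εᵒ-empty ℕᵒ) ≈ᴹ-refl) (≈ᴹ-trans (*ₗ-identityˡ _) (≈ᴹ-sym (N≈Nᵒ w))))))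

    counitʳ : ∀ x → ⟦ (λ y z → ε z *ₗ y) ⟧⊗ (Δ x) ≈ x
    counitʳ = ext (fold-linear (ε*ʳ ε-linear) ∘ᴸ Δ-linear) id-linear (λ w →
      ≈ᴹ-trans (fold-Δ (ε*ʳ ε-linear) w)
      (≈ᴹ-trans (Cut-last (word w) (λ a x b → ≈ᴹ-trans (*ₗ-cong (εᵒ-nonempty ℕᵒ x b) ≈ᴹ-refl) (*ₗ-zeroˡ _)))
      (≈ᴹ-trans (*ₗ-cong (εᵒ-empty ℕᵒ) ≈ᴹ-refl) (≈ᴹ-trans (*ₗ-identityˡ _) (≈ᴹ-sym (N≈Nᵒ w))))))

    R*-bilinear : Bilinear scalars scalars scalars R._*_
    R*-bilinear = record
      { linearˡ = λ y → record { cong = R.*-congʳ ; +-homo = λ j k → R.distribʳ y j k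
                               ; *ₗ-homo = λ j k → R.*-assoc j k y }
      ; linearʳ = λ x → record { cong = R.*-congˡ ; +-homo = R.distribˡ x
                               ; *ₗ-homo = λ j k → R.trans (R.sym (R.*-assoc x j k))
                                   (R.trans (R.*-congʳ (R.*-comm x j)) (R.*-assoc j x k)) }
      }

    ε-1-homo : ε 1# R.≈ R.1#
    ε-1-homo = R.trans (Linear.cong ε-linear (1≈Nᵒ ℕᵒ)) (εᵒ-empty ℕᵒ)

    ε-*-homo : ∀ x y → ε (x * y) R.≈ ε x R.* ε y
    ε-*-homo = ext₂ (bilinear-∘ ε-linear *-bilinear) (bilinear-∘₂ R*-bilinear ε-linear ε-linear)
      (λ u v → R.trans (Linear.cong ε-linear (≈ᴹ-trans (*-cong (N≈Nᵒ u) (N≈Nᵒ v)) (Nᵒ-* ℕᵒ ℕᵒ _ _)))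
        (R.trans (Ш-linear R ε-linear _ (map inj₁ (word u)) _)
        (R.trans (basis (word u) (word v))
        (R.sym (R.*-cong (Linear.cong ε-linear (N≈Nᵒ u)) (Linear.cong ε-linear (N≈Nᵒ v)))))))
      where
      vanish : ∀ {g} (xs ys : List (ℕ ⊎ ℕ)) → (∀ w → g w R.≈ R.0#) → K.Ш g xs ys R.≈ R.0#
      vanish xs ys e = K.Ш-closed (R._≈ R.0#) (λ p q → R.trans (R.+-cong p q) (R.+-identityˡ _)) xs ys (λ w _ → e w)
      basis : ∀ u v → K.Ш (λ w → ε (Nᵒ (ℕᵒ ⊎ᵒ ℕᵒ) w)) (map inj₁ u) (map inj₂ v) R.≈ ε (Nᵒ ℕᵒ u) R.* ε (Nᵒ ℕᵒ v)
      basis [] [] = R.trans (εᵒ-empty (ℕᵒ ⊎ᵒ ℕᵒ)) (R.sym (R.trans (R.*-cong (εᵒ-empty ℕᵒ) (εᵒ-empty ℕᵒ)) (R.*-identityˡ _)))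
      basis [] (y ∷ v) = R.trans (εᵒ-nonempty (ℕᵒ ⊎ᵒ ℕᵒ) (inj₂ y) (map inj₂ v))
        (R.sym (R.trans (R.*-congˡ (εᵒ-nonempty ℕᵒ y v)) (R.zeroʳ _)))
      basis (x ∷ u) [] = R.trans (εᵒ-nonempty (ℕᵒ ⊎ᵒ ℕᵒ) (inj₁ x) (map inj₁ u))
        (R.sym (R.trans (R.*-congʳ (εᵒ-nonempty ℕᵒ x u)) (R.zeroˡ _)))
      basis (x ∷ u) (y ∷ v) = R.trans
        (R.trans (R.+-cong (vanish (map inj₁ u) (inj₂ y ∷ map inj₂ v) (λ w → εᵒ-nonempty (ℕᵒ ⊎ᵒ ℕᵒ) (inj₁ x) w))
                           (vanish (inj₁ x ∷ map inj₁ u) (map inj₂ v) (λ w → εᵒ-nonempty (ℕᵒ ⊎ᵒ ℕᵒ) (inj₂ y) w)))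
                 (R.+-identityˡ _))
        (R.sym (R.trans (R.*-congʳ (εᵒ-nonempty ℕᵒ x u)) (R.zeroˡ _)))

    -- The antipode is the convolution inverse of w ↦ Nᵒ ℕᵒ w, computed as for a
    -- noncommutative power series with constant term 1; a right inverse T of such a
    -- series has itself a right inverse, so T is also a left inverse.

    conv : (List ℕ → Carrier) → (List ℕ → Carrier) → List ℕ → Carrier
    conv f g = S.Cut (λ a b → f a * g b)

    δ : List ℕ → Carrier
    δ []      = 1#
    δ (_ ∷ _) = 0#

    private
      -- The convolution of `f` with `inverse h`, fused with the definition of `inverse h` into one
      -- structural recursion: the value of `inverse h` at a word involves its values at proper
      -- suffixes only.
      convInverse : (List ℕ → Carrier) → (List ℕ → Carrier) → List ℕ → Carrier
      convInverse h f []      = f [] * 1#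
      convInverse h f (x ∷ w) = f [] * (-ᴹ convInverse h (h ∘ (x ∷_)) w) + convInverse h (f ∘ (x ∷_)) w

    inverse : (List ℕ → Carrier) → List ℕ → Carrier
    inverse h []      = 1#
    inverse h (x ∷ w) = -ᴹ convInverse h (h ∘ (x ∷_)) w

    private
      convInverse≈conv : ∀ h f w → convInverse h f w ≈ conv f (inverse h) w
      convInverse≈conv h f []      = ≈ᴹ-refl
      convInverse≈conv h f (x ∷ w) = +ᴹ-congˡ (convInverse≈conv h (f ∘ (x ∷_)) w)

    -- As `h` is 1 at the empty word, the first cut contributes the inverse itself, which is defined
    -- as minus the contribution of all other cuts.
    inverseʳ : ∀ h → h [] ≈ 1# → ∀ w → conv h (inverse h) w ≈ δ w
    inverseʳ h e []      = ≈ᴹ-trans (*-identityʳ _) e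
    inverseʳ h e (x ∷ w) = ≈ᴹ-trans
      (+ᴹ-cong (≈ᴹ-trans (*-cong e ≈ᴹ-refl) (*-identityˡ _)) (≈ᴹ-sym (convInverse≈conv h (h ∘ (x ∷_)) w)))
      (-ᴹ‿inverseˡ _)

    conv-cong : ∀ {f f′ g g′} → (∀ w → f w ≈ f′ w) → (∀ w → g w ≈ g′ w) → ∀ w → conv f g w ≈ conv f′ g′ w
    conv-cong p q w = S.Cut-cong w (λ a b _ → *-cong (p a) (q b))

    conv-assoc : ∀ f g h w → conv (conv f g) h w ≈ conv f (conv g h) w
    conv-assoc f g h w = ≈ᴹ-trans
      (S.Cut-cong w (λ a b _ → ≈ᴹ-trans (Cut-linear R (*-linearˡ (h b)) _ a)
        (S.Cut-cong a (λ _ _ _ → *-assoc _ _ _))))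
      (≈ᴹ-trans (S.Cut-coassoc (λ a b c → f a * (g b * h c)) w)
      (≈ᴹ-sym (S.Cut-cong w (λ a b _ → Cut-linear R (*-linearʳ (f a)) _ b))))

    conv-identityˡ : ∀ f w → conv δ f w ≈ f w
    conv-identityˡ f w = ≈ᴹ-trans (Cut-first w (λ _ _ b → Linear.zero-homo (*-linearˡ (f b)))) (*-identityˡ _)

    conv-identityʳ : ∀ f w → conv f δ w ≈ f w
    conv-identityʳ f w = ≈ᴹ-trans (Cut-last w (λ a _ _ → Linear.zero-homo (*-linearʳ (f a)))) (*-identityʳ _)

    inverseˡ : ∀ h → h [] ≈ 1# → ∀ w → conv (inverse h) h w ≈ δ w
    inverseˡ h e w = ≈ᴹ-trans (conv-cong (λ _ → ≈ᴹ-refl) h≈u w) (inverseʳ t ≈ᴹ-refl w)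
      where
      t = inverse h
      u = inverse t
      h≈u : ∀ w → h w ≈ u w
      h≈u w = begin
        h w                    ≈⟨ conv-identityʳ h w ⟨
        conv h δ w             ≈⟨ conv-cong (λ _ → ≈ᴹ-refl) (inverseʳ t ≈ᴹ-refl) w ⟨
        conv h (conv t u) w    ≈⟨ conv-assoc h t u w ⟨
        conv (conv h t) u w    ≈⟨ conv-cong (inverseʳ h e) (λ _ → ≈ᴹ-refl) w ⟩
        conv δ u w             ≈⟨ conv-identityˡ u w ⟩
        u w                    ∎

    antipode : Carrier → Carrier
    antipode = extend (λ u → inverse (Nᵒ ℕᵒ) (word u))

    antipode-linear : Linear 𝓐 𝓐 antipode
    antipode-linear = extend-linear _

    private
      inverse-≋ : ∀ (T : Similarity ℕᵒ ℕᵒ) {v w} → T ⊢ v ≋ w → inverse (Nᵒ ℕᵒ) v ≈ inverse (Nᵒ ℕᵒ) w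
      convInverse-≋ : ∀ (T : Similarity ℕᵒ ℕᵒ) {f f′} → (∀ {a b} → T ⊢ a ≋ b → f a ≈ f′ b) →
                      ∀ {v w} → T ⊢ v ≋ w → convInverse (Nᵒ ℕᵒ) f v ≈ convInverse (Nᵒ ℕᵒ) f′ w
      inverse-≋ T []       = ≈ᴹ-refl
      inverse-≋ T (r ∷ rs) = -ᴹ‿cong (convInverse-≋ T (λ p → Nᵒ-≋ T (r ∷ p)) rs)
      convInverse-≋ T e []       = *-cong (e []) ≈ᴹ-refl
      convInverse-≋ T e (r ∷ rs) = +ᴹ-cong (*-cong (e []) (-ᴹ‿cong (convInverse-≋ T (λ p → Nᵒ-≋ T (r ∷ p)) rs)))
        (convInverse-≋ T (λ p → e (r ∷ p)) rs)

    -- The parts of a cut of a packed word need not be packed, while `antipode` is defined through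
    -- packed words. The inverse therefore has to agree on similar words.
    antipode-N : ∀ w → antipode (Nᵒ ℕᵒ w) ≈ inverse (Nᵒ ℕᵒ) w
    antipode-N w = ≈ᴹ-trans (extend-N _ _) (inverse-≋ (rank-∼ ℕᵒ w) (rank-≋ ℕᵒ w))

    private
      δ-ε : ∀ w → δ (word w) ≈ ε (N w) *ₗ 1#
      δ-ε w = ≈ᴹ-trans (go (word w)) (*ₗ-cong (Linear.cong ε-linear (≈ᴹ-sym (N≈Nᵒ w))) ≈ᴹ-refl)
        where
        go : ∀ v → δ v ≈ ε (Nᵒ ℕᵒ v) *ₗ 1#
        go []      = ≈ᴹ-sym (≈ᴹ-trans (*ₗ-cong (εᵒ-empty ℕᵒ) ≈ᴹ-refl) (*ₗ-identityˡ 1#))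
        go (x ∷ v) = ≈ᴹ-sym (≈ᴹ-trans (*ₗ-cong (εᵒ-nonempty ℕᵒ x v) ≈ᴹ-refl) (*ₗ-zeroˡ 1#))

    antipodeˡ : ∀ x → ⟦ (λ y z → antipode y * z) ⟧⊗ (Δ x) ≈ ε x *ₗ 1#
    antipodeˡ = ext (fold-linear B ∘ᴸ Δ-linear) (*ₗ-linearˡ 1# ∘ᴸ ε-linear) (λ w →
      ≈ᴹ-trans (fold-Δ B w)
      (≈ᴹ-trans (S.Cut-cong (word w) (λ a b _ → *-cong (antipode-N a) ≈ᴹ-refl))
      (≈ᴹ-trans (inverseˡ (Nᵒ ℕᵒ) (≈ᴹ-sym (1≈Nᵒ ℕᵒ)) (word w)) (δ-ε w))))
      where
      B : Bilinear 𝓐 𝓐 𝓐 (λ y z → antipode y * z)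
      B = bilinear-∘₂ *-bilinear antipode-linear id-linear

    antipodeʳ : ∀ x → ⟦ (λ y z → y * antipode z) ⟧⊗ (Δ x) ≈ ε x *ₗ 1#
    antipodeʳ = ext (fold-linear B ∘ᴸ Δ-linear) (*ₗ-linearˡ 1# ∘ᴸ ε-linear) (λ w →
      ≈ᴹ-trans (fold-Δ B w)
      (≈ᴹ-trans (S.Cut-cong (word w) (λ a b _ → *-cong ≈ᴹ-refl (antipode-N b)))
      (≈ᴹ-trans (inverseʳ (Nᵒ ℕᵒ) (≈ᴹ-sym (1≈Nᵒ ℕᵒ)) (word w)) (δ-ε w))))
      where
      B : Bilinear 𝓐 𝓐 𝓐 (λ y z → y * antipode z)
      B = bilinear-∘₂ *-bilinear id-linear antipode-linear

    isHopfAlgebra : IsHopfAlgebra A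
    isHopfAlgebra = record
      { isAlgebra = isAlgebra
      ; Δ-linear = Linear.isHomomorphism Δ-linear
      ; ε-linear = Linear.isHomomorphism ε-linear
      ; coassoc = coassoc
      ; counitˡ = counitˡ
      ; counitʳ = counitʳ
      ; Δ-*-homo = Δ-*-homo
      ; Δ-1#-homo = Δ-1-homo
      ; ε-*-homo = ε-*-homo
      ; ε-1#-homo = ε-1-homo
      ; antipode = antipode
      ; antipode-linear = Linear.isHomomorphism antipode-linear
      ; antipodeˡ = antipodeˡ
      ; antipodeʳ = antipodeʳ
      }

-- The derivation that makes one position a singleton

module Derivations {c ℓ} (R : CommutativeRing c ℓ) where
  open LinearAlgebra R
  open PackedWordBialgebras R

  module Derivation
    {a ℓa} {A : RawBialgebra a ℓa} {N _⋆_ extend} (isPWB : IsPackedWordBialgebra A N _⋆_ extend)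
    (coef : ℕ → R.Carrier) where

    open RawBialgebra A hiding (-_; rawLeftModule)
    open IsPackedWordBialgebra isPWB
    open Basis isPWB
    open RawSemiringDefs (RawRing.rawSemiring rawRing) using (_^_; sum)
    open ModuleReasoning 𝓐
      using (begin_; step-≈-⟩; step-≈-⟨; _∎; -ᴹ_; ≈ᴹ-refl; ≈ᴹ-sym; ≈ᴹ-trans; ≈ᴹ-reflexive;
             +ᴹ-cong; *ₗ-zeroʳ; *ₗ-cong; *ₗ-identityˡ; *ₗ-assoc; -ᴹ≈-1*ₗ)
    private
      module T² = ModuleReasoning (𝓐 ⊗ᴹ 𝓐)
      module S = WordSums R 𝓐
      module S² = WordSums R (𝓐 ⊗ᴹ 𝓐)

    S : ℕ → Carrier
    S n = N (ones n)

    S♯ : ℕ → Carrier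
    S♯ n = sum (λ (j : Fin (suc n)) → coef (toℕ j) *ₗ (S 1 ^ toℕ j * S (n ∸ toℕ j)))

    infix 21 _♯
    _♯ : Carrier → Carrier
    _♯ = extend (λ u → N u ⋆ S♯ (length (word u)))

    ♯-linear : Linear 𝓐 𝓐 _♯
    ♯-linear = extend-linear _

    W₍_₎ : ℕ → Pred Carrier _
    W₍ n ₎ = Span rawAlgebra (λ F → ∃ λ u → length (word u) ≡ n × F ≡ N u)

    Singletons : Pred Carrier _
    Singletons F = ∃ λ u → HasSingleton u × F ≡ N u

    J : Pred Carrier _
    J = Ideal rawAlgebra Singletons

    D : Carrier → Carrier
    D = extend (λ u → S.Mark (Nᵒ (ℕᵒ ×ᵒ ℕᵒ)) (word u))

    D-linear : Linear 𝓐 𝓐 D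
    D-linear = extend-linear _

    -- Homogeneous elements

    span-closed : ∀ {p s} {P : Pred Carrier p} {Q : Pred Carrier s} {f} → Linear 𝓐 𝓐 f →
                  (∀ x → P x → Span rawAlgebra Q (f x)) →
                  ∀ {x} → Span rawAlgebra P x → Span rawAlgebra Q (f x)
    span-closed F e (generator p) = e _ p
    span-closed F e zero = respects (≈ᴹ-sym (Linear.zero-homo F)) zero
    span-closed F e (add p q) = respects (≈ᴹ-sym (Linear.+-homo F _ _)) (add (span-closed F e p) (span-closed F e q))
    span-closed F e (scale k p) = respects (≈ᴹ-sym (Linear.*ₗ-homo F k _)) (scale k (span-closed F e p))
    span-closed F e (respects eq p) = respects (Linear.cong F eq) (span-closed F e p)

    Span-neg : ∀ {p} {P : Pred Carrier p} {x} → Span rawAlgebra P x → Span rawAlgebra P (-ᴹ x)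
    Span-neg p = respects (≈ᴹ-sym (-ᴹ≈-1*ₗ _)) (scale (R.- R.1#) p)

    W-Nᵒ : ∀ O w → W₍ length w ₎ (Nᵒ O w)
    W-Nᵒ O w = generator (_ , length-pack O w , ≡.refl)

    W-N : ∀ u → W₍ length (word u) ₎ (N u)
    W-N u = generator (u , ≡.refl , ≡.refl)

    W-S : ∀ n → W₍ n ₎ (S n)
    W-S n = generator (ones n , List.length-replicate n , ≡.refl)

    W-1 : W₍ 0 ₎ 1#
    W-1 = respects (≈ᴹ-sym 1-N) (W-S 0)

    private
      length-markAt : ∀ {B : Set} (l : List B) x r → length (markAt l x r) ≡ length (l ++ x ∷ r)
      length-markAt []      x r = ≡.cong suc (List.length-map unmarked r)
      length-markAt (_ ∷ l) x r = ≡.cong suc (length-markAt l x r)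

    W-* : ∀ {m n x y} → W₍ m ₎ x → W₍ n ₎ y → W₍ m +ℕ n ₎ (x * y)
    W-* {m} {n} {y = y} p q = span-closed (*-linearˡ y)
      (λ { _ (u , ≡.refl , ≡.refl) → span-closed (*-linearʳ (N u))
        (λ { _ (v , ≡.refl , ≡.refl) → respects
          (≈ᴹ-sym (≈ᴹ-trans (*-cong (N≈Nᵒ u) (N≈Nᵒ v)) (Nᵒ-* ℕᵒ ℕᵒ (word u) (word v))))
          (S.Ш-closed W₍ length (word u) +ℕ length (word v) ₎ add (map inj₁ (word u)) (map inj₂ (word v))
            (λ w i → ≡.subst (λ k → W₍ k ₎ (Nᵒ (ℕᵒ ⊎ᵒ ℕᵒ) w))
              (≡.trans (interleaving-length i)
                (≡.cong₂ _+ℕ_ (List.length-map inj₁ (word u)) (List.length-map inj₂ (word v))))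
              (W-Nᵒ (ℕᵒ ⊎ᵒ ℕᵒ) w))) }) q }) p

    W-⋆ : ∀ {n x y} → W₍ n ₎ x → W₍ n ₎ y → W₍ n ₎ (x ⋆ y)
    W-⋆ {n} {y = y} p q = span-closed (⋆-linearˡ y)
      (λ { _ (u , eq , ≡.refl) → span-closed (⋆-linearʳ (N u))
        (λ { _ (v , eq′ , ≡.refl) → respects (≈ᴹ-sym (⋆-N u v (≡.trans eq (≡.sym eq′))))
          (generator (packPair u v , length-packPair u v eq eq′ , ≡.refl)) }) q }) p
      where
      length-packPair : ∀ u v → length (word u) ≡ n → length (word v) ≡ n → length (word (packPair u v)) ≡ n
      length-packPair u v eq eq′ = ≡.trans (length-pack (ℕᵒ ×ᵒ ℕᵒ) (zip (word u) (word v)))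
        (≡.trans (List.length-zipWith _,_ (word u) (word v))
          (≡.trans (≡.cong₂ _⊓_ eq eq′) (ℕ.⊓-idem n)))

    W-⋆-≢ : ∀ {m n x y} → m ≢ n → W₍ m ₎ x → W₍ n ₎ y → (x ⋆ y) ≈ 0#
    W-⋆-≢ {y = y} m≢n p q = Span-ext (⋆-linearˡ y) 0-linear
      (λ { _ (u , ≡.refl , ≡.refl) → Span-ext (⋆-linearʳ (N u)) 0-linear
        (λ { _ (v , ≡.refl , ≡.refl) → ⋆-N-≢ u v m≢n }) q }) p

    W-D : ∀ {n x} → W₍ n ₎ x → W₍ n ₎ (D x)
    W-D = span-closed D-linear (λ { _ (u , ≡.refl , ≡.refl) → respects (≈ᴹ-sym (extend-N _ u))
      (S.Mark-closed W₍ length (word u) ₎ zero add (word u) (λ l x r eq →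
        ≡.subst (λ k → W₍ k ₎ (Nᵒ (ℕᵒ ×ᵒ ℕᵒ) (markAt l x r))) (≡.trans (length-markAt l x r) (≡.cong length eq))
          (W-Nᵒ (ℕᵒ ×ᵒ ℕᵒ) (markAt l x r)))) })

    -- The internal product

    ⋆-assoc : ∀ x y z → ((x ⋆ y) ⋆ z) ≈ (x ⋆ (y ⋆ z))
    ⋆-assoc x y z = ext₂
      (bilinear-∘ (⋆-linearˡ z) ⋆-bilinear)
      (record { linearˡ = λ y → ⋆-linearˡ _ ; linearʳ = λ x → ⋆-linearʳ x ∘ᴸ ⋆-linearˡ z })
      (λ u v → ext (⋆-linearʳ (N u ⋆ N v)) (⋆-linearʳ (N u) ∘ᴸ ⋆-linearʳ (N v)) (basis u v) z) x y
      where
      O = ℕᵒ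
      T = ×-assoc-∼ {O} {O} {O}
      zips : ∀ a b c → T ⊢ zip (zip a b) c ≋ zip a (zip b c)
      zips []      b       c       = []
      zips (_ ∷ a) []      c       = []
      zips (_ ∷ a) (_ ∷ b) []      = []
      zips (_ ∷ a) (_ ∷ b) (_ ∷ c) = ≡.refl ∷ zips a b c
      length-zip : ∀ (a b : List ℕ) → length a ≡ length b → length (zip a b) ≡ length b
      length-zip a b eq = ≡.trans (List.length-zipWith _,_ a b)
        (≡.trans (≡.cong (_⊓ length b) eq) (ℕ.⊓-idem _))
      basis : ∀ u v w → ((N u ⋆ N v) ⋆ N w) ≈ (N u ⋆ (N v ⋆ N w))
      basis u v w with length (word u) ℕ.≟ length (word v) | length (word v) ℕ.≟ length (word w)
      ... | yes p | yes q = begin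
        (N u ⋆ N v) ⋆ N w
          ≈⟨ ⋆-cong (⋆-cong (N≈Nᵒ u) (N≈Nᵒ v)) (N≈Nᵒ w) ⟩
        (Nᵒ O (word u) ⋆ Nᵒ O (word v)) ⋆ Nᵒ O (word w)
          ≈⟨ ⋆-cong (Nᵒ-⋆ O O _ _ p) ≈ᴹ-refl ⟩
        Nᵒ (O ×ᵒ O) (zip (word u) (word v)) ⋆ Nᵒ O (word w)
          ≈⟨ Nᵒ-⋆ (O ×ᵒ O) O _ _ (≡.trans (length-zip (word u) (word v) p) q) ⟩
        Nᵒ ((O ×ᵒ O) ×ᵒ O) (zip (zip (word u) (word v)) (word w))
          ≈⟨ Nᵒ-≋ T (zips (word u) (word v) (word w)) ⟩
        Nᵒ (O ×ᵒ (O ×ᵒ O)) (zip (word u) (zip (word v) (word w)))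
          ≈⟨ Nᵒ-⋆ O (O ×ᵒ O) _ _ (≡.trans p (≡.trans q (≡.sym (length-zip (word v) (word w) q)))) ⟨
        Nᵒ O (word u) ⋆ Nᵒ (O ×ᵒ O) (zip (word v) (word w))
          ≈⟨ ⋆-cong ≈ᴹ-refl (Nᵒ-⋆ O O _ _ q) ⟨
        Nᵒ O (word u) ⋆ (Nᵒ O (word v) ⋆ Nᵒ O (word w))
          ≈⟨ ⋆-cong (N≈Nᵒ u) (⋆-cong (N≈Nᵒ v) (N≈Nᵒ w)) ⟨
        N u ⋆ (N v ⋆ N w) ∎
      ... | yes p | no q = ≈ᴹ-trans
        (W-⋆-≢ q (W-⋆ (≡.subst (λ k → W₍ k ₎ (N u)) p (W-N u)) (W-N v)) (W-N w))
        (≈ᴹ-sym (≈ᴹ-trans (⋆-cong ≈ᴹ-refl (⋆-N-≢ v w q)) (Linear.zero-homo (⋆-linearʳ (N u)))))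
      ... | no p | yes q = ≈ᴹ-trans
        (≈ᴹ-trans (⋆-cong (⋆-N-≢ u v p) ≈ᴹ-refl) (Linear.zero-homo (⋆-linearˡ (N w))))
        (≈ᴹ-sym (W-⋆-≢ p (W-N u) (W-⋆ (W-N v) (≡.subst (λ k → W₍ k ₎ (N w)) (≡.sym q) (W-N w)))))
      ... | no p | no q = ≈ᴹ-trans
        (≈ᴹ-trans (⋆-cong (⋆-N-≢ u v p) ≈ᴹ-refl) (Linear.zero-homo (⋆-linearˡ (N w))))
        (≈ᴹ-sym (≈ᴹ-trans (⋆-cong ≈ᴹ-refl (⋆-N-≢ v w q)) (Linear.zero-homo (⋆-linearʳ (N u)))))

    private
      ones-zipʳ : ∀ w → constʳ-∼ {ℕᵒ} {ℕᵒ} 1 ⊢ zip w (replicate (length w) 1) ≋ w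
      ones-zipʳ []      = []
      ones-zipʳ (x ∷ w) = (≡.refl , ≡.refl) ∷ ones-zipʳ w

      ones-zipˡ : ∀ w → constˡ-∼ {ℕᵒ} {ℕᵒ} 1 ⊢ zip (replicate (length w) 1) w ≋ w
      ones-zipˡ []      = []
      ones-zipˡ (x ∷ w) = (≡.refl , ≡.refl) ∷ ones-zipˡ w

    ⋆-identityʳ : ∀ {n x} → W₍ n ₎ x → (x ⋆ S n) ≈ x
    ⋆-identityʳ {n} = Span-ext (⋆-linearˡ (S n)) id-linear (λ { _ (u , ≡.refl , ≡.refl) →
      ≈ᴹ-trans (⋆-cong (N≈Nᵒ u) (N≈Nᵒ (ones n)))
      (≈ᴹ-trans (Nᵒ-⋆ ℕᵒ ℕᵒ _ _ (≡.sym (List.length-replicate n)))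
      (≈ᴹ-trans (Nᵒ-≋ (constʳ-∼ {ℕᵒ} {ℕᵒ} 1) (ones-zipʳ (word u))) (≈ᴹ-sym (N≈Nᵒ u)))) })

    ⋆-identityˡ : ∀ {n x} → W₍ n ₎ x → (S n ⋆ x) ≈ x
    ⋆-identityˡ {n} = Span-ext (⋆-linearʳ (S n)) id-linear (λ { _ (u , ≡.refl , ≡.refl) →
      ≈ᴹ-trans (⋆-cong (N≈Nᵒ (ones n)) (N≈Nᵒ u))
      (≈ᴹ-trans (Nᵒ-⋆ ℕᵒ ℕᵒ _ _ (List.length-replicate n))
      (≈ᴹ-trans (Nᵒ-≋ (constˡ-∼ {ℕᵒ} {ℕᵒ} 1) (ones-zipˡ (word u))) (≈ᴹ-sym (N≈Nᵒ u)))) })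

    -- The derivation D

    D-Nᵒ : ∀ O w → D (Nᵒ O w) ≈ S.Mark (Nᵒ (O ×ᵒ ℕᵒ)) w
    D-Nᵒ O w = ≈ᴹ-trans (extend-N _ _) (S.Mark-rel (rank-∼ O w ⊢_∼_) (rank-≋ O w)
      (Nᵒ-≋ (rank-∼ O w ×-∼ id-∼ {ℕᵒ})))

    D-* : ∀ x y → D (x * y) ≈ D x * y + x * D y
    D-* = ext₂ (bilinear-∘ D-linear *-bilinear)
      (record { linearˡ = λ y → +-linear (*-linearˡ y ∘ᴸ D-linear) (*-linearˡ (D y))
              ; linearʳ = λ x → +-linear (*-linearʳ (D x)) (*-linearʳ x ∘ᴸ D-linear) })
      (λ u v → ≈ᴹ-trans (Linear.cong D-linear (*-cong (N≈Nᵒ u) (N≈Nᵒ v)))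
        (≈ᴹ-trans (basis (word u) (word v))
          (+ᴹ-cong (*-cong (Linear.cong D-linear (≈ᴹ-sym (N≈Nᵒ u))) (≈ᴹ-sym (N≈Nᵒ v)))
                   (*-cong (≈ᴹ-sym (N≈Nᵒ u)) (Linear.cong D-linear (≈ᴹ-sym (N≈Nᵒ v)))))))
      where
      O = ℕᵒ
      P = (O ⊎ᵒ O) ×ᵒ ℕᵒ
      basis : ∀ u v → D (Nᵒ O u * Nᵒ O v) ≈ D (Nᵒ O u) * Nᵒ O v + Nᵒ O u * D (Nᵒ O v)
      basis u v = begin
        D (Nᵒ O u * Nᵒ O v)
          ≈⟨ Linear.cong D-linear (Nᵒ-* O O u v) ⟩
        D (S.Ш (Nᵒ (O ⊎ᵒ O)) u₁ v₂)
          ≈⟨ Ш-linear R D-linear _ u₁ v₂ ⟩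
        S.Ш (λ w → D (Nᵒ (O ⊎ᵒ O) w)) u₁ v₂
          ≈⟨ S.Ш-cong u₁ v₂ (D-Nᵒ (O ⊎ᵒ O)) ⟩
        S.Ш (S.Mark (Nᵒ P)) u₁ v₂
          ≈⟨ S.Mark-Ш (Nᵒ P) u₁ v₂ ⟩
        S.Mark (λ t → S.Ш (Nᵒ P) t (map unmarked v₂)) u₁ +
        S.Mark (λ t → S.Ш (Nᵒ P) (map unmarked u₁) t) v₂
          -- The marked ordered sum is replaced by the ordered sum of the marked alphabet of one
          -- factor with the plain alphabet of the other.
          ≈⟨ +ᴹ-cong (S.Mark-rel Inj₁ (inj₁-R u) (λ {t} {t′} p → left t t′ p))
                     (S.Mark-rel Inj₂ (inj₂-R v) (λ {t} {t′} p → right t t′ p)) ⟩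
        S.Mark (λ t → Nᵒ (O ×ᵒ ℕᵒ) t * Nᵒ O v) u + S.Mark (λ t → Nᵒ O u * Nᵒ (O ×ᵒ ℕᵒ) t) v
          ≈⟨ +ᴹ-cong (Mark-linear R (*-linearˡ (Nᵒ O v)) _ u) (Mark-linear R (*-linearʳ (Nᵒ O u)) _ v) ⟨
        S.Mark (Nᵒ (O ×ᵒ ℕᵒ)) u * Nᵒ O v + Nᵒ O u * S.Mark (Nᵒ (O ×ᵒ ℕᵒ)) v
          ≈⟨ +ᴹ-cong (*-cong (D-Nᵒ O u) ≈ᴹ-refl) (*-cong ≈ᴹ-refl (D-Nᵒ O v)) ⟨
        D (Nᵒ O u) * Nᵒ O v + Nᵒ O u * D (Nᵒ O v) ∎
        where
        u₁ = map inj₁ u ; v₂ = map inj₂ v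
        Inj₁ Inj₂ : ℕ ⊎ ℕ → ℕ → Set
        Inj₁ x y = x ≡ inj₁ y
        Inj₂ x y = x ≡ inj₂ y
        inj₁-R : ∀ w → Pointwise Inj₁ (map inj₁ w) w
        inj₁-R []      = []
        inj₁-R (_ ∷ w) = ≡.refl ∷ inj₁-R w
        inj₂-R : ∀ w → Pointwise Inj₂ (map inj₂ w) w
        inj₂-R []      = []
        inj₂-R (_ ∷ w) = ≡.refl ∷ inj₂-R w
        Tˡ = markLeft-∼ {O} {O}
        Tʳ = markRight-∼ {O} {O}
        left : ∀ t t′ → Pointwise (λ (x , i) (y , j) → Inj₁ x y × i ≡ j) t t′ →
               S.Ш (Nᵒ P) t (map unmarked v₂) ≈ Nᵒ (O ×ᵒ ℕᵒ) t′ * Nᵒ O v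
        left t t′ p = ≈ᴹ-trans (S.Ш-rel (Tˡ ⊢_∼_) (mark p) (plain v) (Nᵒ-≋ Tˡ)) (≈ᴹ-sym (Nᵒ-* (O ×ᵒ ℕᵒ) O t′ v))
          where
          mark : ∀ {t t′} → Pointwise (λ (x , i) (y , j) → Inj₁ x y × i ≡ j) t t′ → Tˡ ⊢ t ≋ map inj₁ t′
          mark []                           = []
          mark ((≡.refl , ≡.refl) ∷ ps) = leftᴿ ∷ mark ps
          plain : ∀ v → Tˡ ⊢ map unmarked (map inj₂ v) ≋ map inj₂ v
          plain []      = []
          plain (_ ∷ v) = rightᴿ ∷ plain v
        right : ∀ t t′ → Pointwise (λ (x , i) (y , j) → Inj₂ x y × i ≡ j) t t′ →
                S.Ш (Nᵒ P) (map unmarked u₁) t ≈ Nᵒ O u * Nᵒ (O ×ᵒ ℕᵒ) t′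
        right t t′ p = ≈ᴹ-trans (S.Ш-rel (Tʳ ⊢_∼_) (plain u) (mark p) (Nᵒ-≋ Tʳ)) (≈ᴹ-sym (Nᵒ-* O (O ×ᵒ ℕᵒ) u t′))
          where
          mark : ∀ {t t′} → Pointwise (λ (x , i) (y , j) → Inj₂ x y × i ≡ j) t t′ → Tʳ ⊢ t ≋ map inj₂ t′
          mark []                           = []
          mark ((≡.refl , ≡.refl) ∷ ps) = rightᴿ ∷ mark ps
          plain : ∀ v → Tʳ ⊢ map unmarked (map inj₁ v) ≋ map inj₁ v
          plain []      = []
          plain (_ ∷ v) = leftᴿ ∷ plain v

    Δ-D : ∀ x → Δ (D x) T².≈ᴹ (D ⟨⊗⟩ id) (Δ x) T².+ᴹ (id ⟨⊗⟩ D) (Δ x)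
    Δ-D = ext (Δ-linear ∘ᴸ D-linear) (+-linear (D₁ ∘ᴸ Δ-linear) (D₂ ∘ᴸ Δ-linear))
      (λ u → ≈-trans (Linear.cong (Δ-linear ∘ᴸ D-linear) (N≈Nᵒ u)) (≈-trans (basis (word u))
        (T².+ᴹ-cong (Linear.cong (D₁ ∘ᴸ Δ-linear) (≈ᴹ-sym (N≈Nᵒ u))) (Linear.cong (D₂ ∘ᴸ Δ-linear) (≈ᴹ-sym (N≈Nᵒ u))))))
      where
      O = ℕᵒ
      P = O ×ᵒ ℕᵒ
      D₁ : Linear (𝓐 ⊗ᴹ 𝓐) (𝓐 ⊗ᴹ 𝓐) (D ⟨⊗⟩ id)
      D₁ = ⟨⊗⟩-linear D-linear id-linear
      D₂ : Linear (𝓐 ⊗ᴹ 𝓐) (𝓐 ⊗ᴹ 𝓐) (id ⟨⊗⟩ D)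
      D₂ = ⟨⊗⟩-linear id-linear D-linear
      -- The side of a cut without the mark names the same basis element as before marking.
      unmark : ∀ b → Nᵒ P (map unmarked b) ≈ Nᵒ O b
      unmark b = ≈ᴹ-reflexive (≡.cong N (pack-unmarked O b))
      basis : ∀ w → Δ (D (Nᵒ O w)) T².≈ᴹ (D ⟨⊗⟩ id) (Δ (Nᵒ O w)) T².+ᴹ (id ⟨⊗⟩ D) (Δ (Nᵒ O w))
      basis w = T².begin
        Δ (D (Nᵒ O w))
          T².≈⟨ Linear.cong Δ-linear (D-Nᵒ O w) ⟩
        Δ (S.Mark (Nᵒ P) w)
          T².≈⟨ Mark-linear R Δ-linear _ w ⟩
        S².Mark (λ v → Δ (Nᵒ P v)) w
          T².≈⟨ S².Mark-cong w (λ l x r → Nᵒ-Δ P (markAt l x r)) ⟩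
        S².Mark (S².Cut (λ a b → [ Nᵒ P a , Nᵒ P b ])) w
          T².≈⟨ S².Mark-Cut _ w ⟩
        S².Cut (λ a b → S².Mark (λ v → [ Nᵒ P v , Nᵒ P (map unmarked b) ]) a T².+ᴹ
                        S².Mark (λ v → [ Nᵒ P (map unmarked a) , Nᵒ P v ]) b) w
          T².≈⟨ S².Cut-cong w (λ a b _ → T².+ᴹ-cong
            (≈-trans (S².Mark-cong a (λ _ _ _ → ⊗-cong ≈ᴹ-refl (unmark b)))
              (≈-trans (≈-sym (Mark-linear R (pure-linearˡ (Nᵒ O b)) _ a)) (⊗-cong (≈ᴹ-sym (D-Nᵒ O a)) ≈ᴹ-refl)))
            (≈-trans (S².Mark-cong b (λ _ _ _ → ⊗-cong (unmark a) ≈ᴹ-refl))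
              (≈-trans (≈-sym (Mark-linear R (pure-linearʳ (Nᵒ O a)) _ b)) (⊗-cong ≈ᴹ-refl (≈ᴹ-sym (D-Nᵒ O b)))))) ⟩
        S².Cut (λ a b → [ D (Nᵒ O a) , Nᵒ O b ] T².+ᴹ [ Nᵒ O a , D (Nᵒ O b) ]) w
          T².≈⟨ S².Cut-+ _ _ w ⟩
        S².Cut (λ a b → [ D (Nᵒ O a) , Nᵒ O b ]) w T².+ᴹ S².Cut (λ a b → [ Nᵒ O a , D (Nᵒ O b) ]) w
          T².≈⟨ T².+ᴹ-cong (Cut-linear R D₁ _ w) (Cut-linear R D₂ _ w) ⟨
        (D ⟨⊗⟩ id) (S².Cut (λ a b → [ Nᵒ O a , Nᵒ O b ]) w) T².+ᴹ
        (id ⟨⊗⟩ D) (S².Cut (λ a b → [ Nᵒ O a , Nᵒ O b ]) w)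
          T².≈⟨ T².+ᴹ-cong (Linear.cong D₁ (Nᵒ-Δ O w)) (Linear.cong D₂ (Nᵒ-Δ O w)) ⟨
        (D ⟨⊗⟩ id) (Δ (Nᵒ O w)) T².+ᴹ (id ⟨⊗⟩ D) (Δ (Nᵒ O w)) T².∎

-- The map ♯ as a polynomial in the derivation

module SharpMap {c ℓ} (R : CommutativeRing c ℓ) where
  open LinearAlgebra R
  open PackedWordBialgebras R
  open FallingPowers R

  module Sharp
    {a ℓa} {A : RawBialgebra a ℓa} {N _⋆_ extend} (isPWB : IsPackedWordBialgebra A N _⋆_ extend)
    (ι⁻¹ : ∀ i → ∃ λ k → k R.* ι (suc i) R.≈ R.1#)
    (coef : ℕ → R.Carrier) (coef-0 : coef 0 R.≈ R.1#)
    (coef-suc : ∀ i → coef (suc i) R.* ι (suc i) R.≈ R.- coef i) where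

    open RawBialgebra A hiding (-_; rawLeftModule)
    open IsPackedWordBialgebra isPWB
    open Basis isPWB
    open Projection coef coef-0 coef-suc
    open Derivations.Derivation R isPWB coef public
    open RawSemiringDefs (RawRing.rawSemiring rawRing) using (_^_; sum)
    open ModuleReasoning 𝓐
      using (begin_; step-≈-⟩; step-≈-⟨; _∎; -ᴹ_; ≈ᴹ-refl; ≈ᴹ-sym; ≈ᴹ-trans; ≈ᴹ-reflexive;
             +ᴹ-cong; +ᴹ-congˡ; +ᴹ-congʳ; +ᴹ-identityˡ; +ᴹ-identityʳ; +ᴹ-assoc; +ᴹ-comm; -ᴹ‿cong;
             -ᴹ‿inverseʳ; *ₗ-zeroˡ; *ₗ-zeroʳ; *ₗ-cong; *ₗ-identityˡ; *ₗ-distribʳ; x-y≈0⇒x≈y;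
             x≈y⇒x-y≈0; -ᴹ≈-1*ₗ)
    private
      module T² = ModuleReasoning (𝓐 ⊗ᴹ 𝓐)
      module S = WordSums R 𝓐
      module S² = WordSums R (𝓐 ⊗ᴹ 𝓐)

      X : ℕ → ℕ → Carrier
      X i n = S 1 ^ i * S (n ∸ i)

    -- The form in which characteristic 0 enters the argument on eigenvalues and the induction that
    -- kills singleton words.
    ι-cancel : ∀ {m ℓm} (M : Module m ℓm) i x →
               LeftModule._≈ᴹ_ M (LeftModule._*ₗ_ M (ι (suc i)) x) (LeftModule.0ᴹ M) →
               LeftModule._≈ᴹ_ M x (LeftModule.0ᴹ M)
    ι-cancel M i x p = M.≈ᴹ-trans (M.≈ᴹ-sym (M.*ₗ-identityˡ x))
      (M.≈ᴹ-trans (M.*ₗ-cong (R.sym (proj₂ (ι⁻¹ i))) M.≈ᴹ-refl)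
      (M.≈ᴹ-trans (M.*ₗ-assoc _ _ x) (M.≈ᴹ-trans (M.*ₗ-cong R.refl p) (M.*ₗ-zeroʳ _))))
      where module M = LeftModule M

    W-X : ∀ {i n} → i ≤ n → W₍ n ₎ (X i n)
    W-X {i} {n} i≤n = ≡.subst (λ k → W₍ k ₎ (X i n)) (ℕ.m+[n∸m]≡n i≤n) (W-* (power i) (W-S (n ∸ i)))
      where
      power : ∀ i → W₍ i ₎ (S 1 ^ i)
      power zero    = W-1
      power (suc i) = W-* (W-S 1) (power i)

    sum-closed : ∀ {p} (P : Pred Carrier p) → P 0# → (∀ {x y} → P x → P y → P (x + y)) →
                 ∀ m (t : ℕ → Carrier) → (∀ i → i < m → P (t i)) → P (sum (λ (j : Fin m) → t (toℕ j)))
    sum-closed P P-0 P-+ zero    t p = P-0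
    sum-closed P P-0 P-+ (suc m) t p = P-+ (p 0 (s≤s z≤n))
      (sum-closed P P-0 P-+ m (t ∘ suc) (λ i i<m → p (suc i) (s≤s i<m)))

    W-S♯ : ∀ n → W₍ n ₎ (S♯ n)
    W-S♯ n = sum-closed W₍ n ₎ zero add (suc n) (λ i → coef i *ₗ X i n)
      (λ { i (s≤s i≤n) → scale (coef i) (W-X {i} {n} i≤n) })

    -- The product of N_1 and the word of ones is the sum of the words with a single 1 and all other
    -- letters 2. Pairing a word with such a word puts the letter at the position of the 1 just
    -- below its former equals, which is a marking.
    D-⋆-X : ∀ {n x} → W₍ n ₎ x → D x ≈ (x ⋆ (S 1 * S (n ∸ 1)))
    D-⋆-X {n} = Span-ext D-linear (⋆-linearˡ _) (λ { _ (u , ≡.refl , ≡.refl) → go u (word u) ≡.refl })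
      where
      O = ℕᵒ
      f : ℕ → ℕ ⊎ ℕ
      f zero    = inj₁ 1
      f (suc _) = inj₂ 1
      marking : ∀ l x r → id-∼ {O} ×-∼ mark-∼ ⊢ map (Product.map₂ f) (markAt l x r) ≋ markAt l x r
      marking []      x r = (≡.refl , markᴿ) ∷ go r
        where
        go : ∀ w → id-∼ {O} ×-∼ mark-∼ ⊢ map (Product.map₂ f) (map unmarked w) ≋ map unmarked w
        go []      = []
        go (_ ∷ w) = (≡.refl , unmarkᴿ) ∷ go w
      marking (_ ∷ l) x r = (≡.refl , unmarkᴿ) ∷ marking l x r
      go : ∀ u w → w ≡ word u → D (N u) ≈ (N u ⋆ (S 1 * S (length (word u) ∸ 1)))
      -- In degree 0 the truncated `n ∸ 1` is 0 and the right factor has degree 1, so both sides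
      -- vanish.
      go u [] eq = ≈ᴹ-trans (extend-N _ u)
        (≈ᴹ-trans (≈ᴹ-reflexive (≡.cong (S.Mark (Nᵒ (O ×ᵒ ℕᵒ))) (≡.sym eq)))
        (≈ᴹ-sym (W-⋆-≢ (λ eq′ → case (≡.trans (≡.cong length eq) eq′))
          (W-N u) (W-* (W-S 1) (W-S (length (word u) ∸ 1))))))
        where
        case : ∀ {k} → 0 ≢ suc k
        case ()
      go u (x ∷ w) eq = begin
        D (N u)
          ≈⟨ Linear.cong D-linear u≈ ⟩
        D (Nᵒ O (x ∷ w))
          ≈⟨ D-Nᵒ O (x ∷ w) ⟩
        S.Mark (Nᵒ (O ×ᵒ ℕᵒ)) (x ∷ w)
          ≈⟨ S.Mark-cong {g = Nᵒ (O ×ᵒ (O ⊎ᵒ O)) ∘ map (Product.map₂ f)} {Nᵒ (O ×ᵒ ℕᵒ)} (x ∷ w)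
               (λ l y r → Nᵒ-≋ (id-∼ {O} ×-∼ mark-∼) (marking l y r)) ⟨
        S.Mark (Nᵒ (O ×ᵒ (O ⊎ᵒ O)) ∘ map (Product.map₂ f)) (x ∷ w)
          ≈⟨ S.Mark-zip f (Nᵒ (O ×ᵒ (O ⊎ᵒ O))) x w ⟨
        S.Ш (λ v → Nᵒ (O ×ᵒ (O ⊎ᵒ O)) (zip (x ∷ w) v)) [ inj₁ 1 ] 2s
          ≈⟨ S.Ш-cong-∈ [ inj₁ 1 ] 2s (λ v i → Nᵒ-⋆ O (O ⊎ᵒ O) (x ∷ w) v (≡.sym (len i))) ⟨
        S.Ш (λ v → Nᵒ O (x ∷ w) ⋆ Nᵒ (O ⊎ᵒ O) v) [ inj₁ 1 ] 2s
          ≈⟨ Ш-linear R (⋆-linearʳ (Nᵒ O (x ∷ w))) _ [ inj₁ 1 ] 2s ⟨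
        Nᵒ O (x ∷ w) ⋆ S.Ш (Nᵒ (O ⊎ᵒ O)) [ inj₁ 1 ] 2s
          ≈⟨ ⋆-cong ≈ᴹ-refl (≈ᴹ-reflexive (≡.cong (S.Ш (Nᵒ (O ⊎ᵒ O)) [ inj₁ 1 ])
               (List.map-replicate inj₂ (length w) 1))) ⟨
        Nᵒ O (x ∷ w) ⋆ S.Ш (Nᵒ (O ⊎ᵒ O)) (map inj₁ [ 1 ]) (map inj₂ (replicate (length w) 1))
          ≈⟨ ⋆-cong ≈ᴹ-refl (Nᵒ-* O O [ 1 ] (replicate (length w) 1)) ⟨
        Nᵒ O (x ∷ w) ⋆ (Nᵒ O [ 1 ] * Nᵒ O (replicate (length w) 1))
          ≈⟨ ⋆-cong u≈ (*-cong (N≈Nᵒ (ones 1)) (N≈Nᵒ (ones (length w)))) ⟨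
        N u ⋆ (S 1 * S (length w))
          ≈⟨ ≈ᴹ-reflexive (≡.cong (λ v → N u ⋆ (S 1 * S (length v ∸ 1))) eq) ⟩
        N u ⋆ (S 1 * S (length (word u) ∸ 1)) ∎
        where
        2s = replicate (length w) (inj₂ 1)
        u≈ : N u ≈ Nᵒ O (x ∷ w)
        u≈ = ≈ᴹ-trans (N≈Nᵒ u) (≈ᴹ-reflexive (≡.cong (Nᵒ O) (≡.sym eq)))
        len : ∀ {v} → Interleaving [ inj₁ 1 ] 2s v → length v ≡ suc (length w)
        len i = ≡.trans (interleaving-length i) (≡.cong suc (List.length-replicate (length w)))

    -- In each degree `D` is an internal multiplication from the right, so this is associativity of
    -- `⋆`.
    ⋆-D : ∀ x y → D (x ⋆ y) ≈ (x ⋆ D y)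
    ⋆-D = ext₂ (bilinear-∘ D-linear ⋆-bilinear)
      (record { linearˡ = λ y → ⋆-linearˡ (D y) ; linearʳ = λ x → ⋆-linearʳ x ∘ᴸ D-linear }) basis
      where
      basis : ∀ u v → D (N u ⋆ N v) ≈ (N u ⋆ D (N v))
      basis u v with length (word u) ℕ.≟ length (word v)
      ... | yes p = ≈ᴹ-trans (D-⋆-X (W-⋆ (≡.subst (λ k → W₍ k ₎ (N u)) p (W-N u)) (W-N v)))
        (≈ᴹ-trans (⋆-assoc _ _ _) (⋆-cong ≈ᴹ-refl (≈ᴹ-sym (D-⋆-X (W-N v)))))
      ... | no p = ≈ᴹ-trans (Linear.cong D-linear (⋆-N-≢ u v p))
        (≈ᴹ-trans (Linear.zero-homo D-linear) (≈ᴹ-sym (W-⋆-≢ p (W-N u) (W-D (W-N v)))))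

    private
      D-S : ∀ n → D (S (suc n)) ≈ S 1 * S n
      D-S n = ≈ᴹ-trans (D-⋆-X (W-S (suc n))) (⋆-identityˡ (W-* (W-S 1) (W-S n)))

      D-W₀ : ∀ {x} → W₍ 0 ₎ x → D x ≈ 0#
      D-W₀ p = ≈ᴹ-trans (D-⋆-X p) (W-⋆-≢ (λ ()) p (W-* (W-S 1) (W-S 0)))

      S-0 : S 0 ≈ 1#
      S-0 = ≈ᴹ-sym 1-N

      D-power : ∀ i → D (S 1 ^ i) ≈ ι i *ₗ (S 1 ^ i)
      D-power zero = ≈ᴹ-trans (D-W₀ W-1) (≈ᴹ-sym (*ₗ-zeroˡ 1#))
      D-power (suc i) = begin
        D (S 1 * S 1 ^ i)                       ≈⟨ D-* _ _ ⟩
        D (S 1) * S 1 ^ i + S 1 * D (S 1 ^ i)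
          ≈⟨ +ᴹ-cong (*-cong (≈ᴹ-trans (D-S 0) (≈ᴹ-trans (*-cong ≈ᴹ-refl S-0) (*-identityʳ _))) ≈ᴹ-refl)
               (≈ᴹ-trans (*-cong ≈ᴹ-refl (D-power i)) (Linear.*ₗ-homo (*-linearʳ (S 1)) _ _)) ⟩
        S 1 ^ suc i + ι i *ₗ S 1 ^ suc i        ≈⟨ +ᴹ-congʳ (*ₗ-identityˡ _) ⟨
        R.1# *ₗ S 1 ^ suc i + ι i *ₗ S 1 ^ suc i ≈⟨ *ₗ-distribʳ _ _ _ ⟨
        ι (suc i) *ₗ S 1 ^ suc i                ∎

      power-comm : ∀ i → S 1 ^ i * S 1 ≈ S 1 ^ suc i
      power-comm zero    = ≈ᴹ-trans (*-identityˡ _) (≈ᴹ-sym (*-identityʳ _))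
      power-comm (suc i) = ≈ᴹ-trans (*-assoc _ _ _) (*-cong ≈ᴹ-refl (power-comm i))

      ∸-suc : ∀ {i n} → suc i ≤ n → n ∸ i ≡ suc (n ∸ suc i)
      ∸-suc (s≤s i≤n) = ℕ.+-∸-assoc 1 i≤n

      D-X : ∀ {i n} → suc i ≤ n → D (X i n) ≈ ι i *ₗ X i n + X (suc i) n
      D-X {i} {n} i<n = begin
        D (S 1 ^ i * S (n ∸ i))                              ≈⟨ D-* _ _ ⟩
        D (S 1 ^ i) * S (n ∸ i) + S 1 ^ i * D (S (n ∸ i))
          ≈⟨ +ᴹ-cong (≈ᴹ-trans (*-cong (D-power i) ≈ᴹ-refl) (Linear.*ₗ-homo (*-linearˡ _) _ _)) (begin
            S 1 ^ i * D (S (n ∸ i))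
              ≈⟨ *-cong ≈ᴹ-refl (≈ᴹ-trans (≈ᴹ-reflexive (≡.cong (D ∘ S) (∸-suc i<n))) (D-S _)) ⟩
            S 1 ^ i * (S 1 * S (n ∸ suc i))                  ≈⟨ *-assoc _ _ _ ⟨
            (S 1 ^ i * S 1) * S (n ∸ suc i)                  ≈⟨ *-cong (power-comm i) ≈ᴹ-refl ⟩
            X (suc i) n                                      ∎) ⟩
        ι i *ₗ X i n + X (suc i) n                           ∎

      -- For i = n the last factor is the unit, which `D` kills, so the recursion of `D-X` stops
      -- with an eigenvector.
      D-X-top : ∀ n → D (X n n) ≈ ι n *ₗ X n n
      D-X-top n = begin
        D (S 1 ^ n * S (n ∸ n))                              ≈⟨ D-* _ _ ⟩
        D (S 1 ^ n) * S (n ∸ n) + S 1 ^ n * D (S (n ∸ n))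
          ≈⟨ +ᴹ-cong (≈ᴹ-trans (*-cong (D-power n) ≈ᴹ-refl) (Linear.*ₗ-homo (*-linearˡ _) _ _))
               (*-cong ≈ᴹ-refl (D-W₀ (≡.subst (λ k → W₍ k ₎ (S (n ∸ n))) (ℕ.n∸n≡0 n) (W-S (n ∸ n))))) ⟩
        ι n *ₗ X n n + S 1 ^ n * 0#
          ≈⟨ ≈ᴹ-trans (+ᴹ-congˡ (Linear.zero-homo (*-linearʳ _))) (+ᴹ-identityʳ _) ⟩
        ι n *ₗ X n n                                         ∎

      shift-X : ∀ i x y → shiftBy 𝓐 i D (x ⋆ y) ≈ (x ⋆ shiftBy 𝓐 i D y)
      shift-X i x y = ≈ᴹ-trans (+ᴹ-cong (⋆-D x y) (≈ᴹ-sym (Linear.*ₗ-homo (⋆-linearʳ x) _ y)))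
        (≈ᴹ-sym (Linear.+-homo (⋆-linearʳ x) _ _))

      cancel : ∀ k x y → (k *ₗ x + y) + (R.- k) *ₗ x ≈ y
      cancel k x y = begin
        (k *ₗ x + y) + (R.- k) *ₗ x    ≈⟨ +ᴹ-comm _ _ ⟩
        (R.- k) *ₗ x + (k *ₗ x + y)    ≈⟨ +ᴹ-assoc _ _ _ ⟨
        ((R.- k) *ₗ x + k *ₗ x) + y    ≈⟨ +ᴹ-congʳ (*ₗ-distribʳ x _ _) ⟨
        ((R.- k) R.+ k) *ₗ x + y       ≈⟨ +ᴹ-congʳ (≈ᴹ-trans (*ₗ-cong (R.-‿inverseˡ k) ≈ᴹ-refl) (*ₗ-zeroˡ x)) ⟩
        0# + y                         ≈⟨ +ᴹ-identityˡ y ⟩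
        y                              ∎

    ⋆-X : ∀ {n x} → W₍ n ₎ x → ∀ i → i ≤ n → (x ⋆ X i n) ≈ falling 𝓐 D i x
    ⋆-X {n} {x} p zero    _   = ≈ᴹ-trans (⋆-cong ≈ᴹ-refl (*-identityˡ _)) (⋆-identityʳ p)
    ⋆-X {n} {x} p (suc i) i<n = begin
      x ⋆ X (suc i) n               ≈⟨ ⋆-cong ≈ᴹ-refl (≈ᴹ-trans (+ᴹ-congʳ (D-X i<n)) (cancel (ι i) _ _)) ⟨
      x ⋆ shiftBy 𝓐 i D (X i n)     ≈⟨ shift-X i x _ ⟨
      shiftBy 𝓐 i D (x ⋆ X i n)     ≈⟨ Linear.cong (shiftBy-linear 𝓐 D-linear i) (⋆-X p i (ℕ.<⇒≤ i<n)) ⟩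
      falling 𝓐 D (suc i) x         ∎

    -- In degree n the next falling factorial is the internal product with (D - n) (X n n), and X n
    -- n has eigenvalue n. So D (D - 1) ⋯ (D - n) annihilates degree n.
    falling-W : ∀ {n x} → W₍ n ₎ x → falling 𝓐 D (suc n) x ≈ 0#
    falling-W {n} {x} p = begin
      shiftBy 𝓐 n D (falling 𝓐 D n x)
        ≈⟨ Linear.cong (shiftBy-linear 𝓐 D-linear n) (⋆-X p n ℕ.≤-refl) ⟨
      shiftBy 𝓐 n D (x ⋆ X n n)     ≈⟨ shift-X n x _ ⟩
      x ⋆ shiftBy 𝓐 n D (X n n)
        ≈⟨ ⋆-cong ≈ᴹ-refl (≈ᴹ-trans (+ᴹ-congʳ (≈ᴹ-trans (D-X-top n) (≈ᴹ-sym (+ᴹ-identityʳ _)))) (cancel (ι n) _ _)) ⟩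
      x ⋆ 0#                        ≈⟨ Linear.zero-homo (⋆-linearʳ x) ⟩
      0#                            ∎

    -- A coproduct mixes components of several degrees; one polynomial has to annihilate all degrees
    -- up to n.
    falling-W-≤ : ∀ {m n x} → m ≤ n → W₍ m ₎ x → falling 𝓐 D (suc n) x ≈ 0#
    falling-W-≤ {m} {n} m≤n p = go (ℕ.≤⇒≤′ m≤n)
      where
      go : ∀ {n} → m ≤′ n → falling 𝓐 D (suc n) _ ≈ 0#
      go (≤′-reflexive ≡.refl) = falling-W p
      go {suc n} (≤′-step q) = ≈ᴹ-trans (Linear.cong (shiftBy-linear 𝓐 D-linear (suc n)) (go q))
        (Linear.zero-homo (shiftBy-linear 𝓐 D-linear (suc n)))

    private
      -- `sum` splits off its first term, whereas `projection` grows by its last.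
      sum-last : ∀ m (t : ℕ → Carrier) →
                 sum (λ (j : Fin (suc m)) → t (toℕ j)) ≈ sum (λ (j : Fin m) → t (toℕ j)) + t m
      sum-last zero    t = +ᴹ-comm _ _
      sum-last (suc m) t = ≈ᴹ-trans (+ᴹ-congˡ (sum-last m (t ∘ suc))) (≈ᴹ-sym (+ᴹ-assoc _ _ _))

    ⋆-S♯ : ∀ {n x} → W₍ n ₎ x → (x ⋆ S♯ n) ≈ projection 𝓐 D n x
    ⋆-S♯ {n} {x} p = go n ℕ.≤-refl
      where
      t : ℕ → Carrier
      t i = coef i *ₗ X i n
      go : ∀ m → m ≤ n → (x ⋆ sum (λ (j : Fin (suc m)) → t (toℕ j))) ≈ projection 𝓐 D m x
      go zero    _   = begin
        x ⋆ (coef 0 *ₗ X 0 n + 0#)    ≈⟨ ⋆-cong ≈ᴹ-refl (≈ᴹ-trans (+ᴹ-identityʳ _) (≈ᴹ-trans (*ₗ-cong coef-0 ≈ᴹ-refl) (*ₗ-identityˡ _))) ⟩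
        x ⋆ X 0 n                     ≈⟨ ⋆-X p 0 z≤n ⟩
        x                             ∎
      go (suc m) m<n = begin
        x ⋆ sum (λ (j : Fin (suc (suc m))) → t (toℕ j))
          ≈⟨ ⋆-cong ≈ᴹ-refl (sum-last (suc m) t) ⟩
        x ⋆ (sum (λ (j : Fin (suc m)) → t (toℕ j)) + t (suc m))
          ≈⟨ Linear.+-homo (⋆-linearʳ x) _ _ ⟩
        (x ⋆ sum (λ (j : Fin (suc m)) → t (toℕ j))) + (x ⋆ t (suc m))
          ≈⟨ +ᴹ-cong (go m (ℕ.<⇒≤ m<n)) (≈ᴹ-trans (Linear.*ₗ-homo (⋆-linearʳ x) _ _) (*ₗ-cong R.refl (⋆-X p (suc m) m<n))) ⟩
        projection 𝓐 D (suc m) x ∎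

    ♯-W : ∀ {n x} → W₍ n ₎ x → x ♯ ≈ (x ⋆ S♯ n)
    ♯-W {n} = Span-ext ♯-linear (⋆-linearˡ (S♯ n)) (λ { _ (u , ≡.refl , ≡.refl) → extend-N _ u })

    ♯-projection : ∀ {n x} → W₍ n ₎ x → x ♯ ≈ projection 𝓐 D n x
    ♯-projection p = ≈ᴹ-trans (♯-W p) (⋆-S♯ p)

    W-♯ : ∀ {n x} → W₍ n ₎ x → W₍ n ₎ (x ♯)
    W-♯ p = respects (≈ᴹ-sym (♯-W p)) (W-⋆ p (W-S♯ _))

    D-♯ : ∀ x → D (x ♯) ≈ 0#
    D-♯ = ext (D-linear ∘ᴸ ♯-linear) 0-linear (λ u →
      ≈ᴹ-trans (Linear.cong D-linear (♯-projection (W-N u)))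
      (≈ᴹ-trans (a-projection 𝓐 D-linear (length (word u)) (N u))
      (≈ᴹ-trans (*ₗ-cong R.refl (falling-W (W-N u))) (*ₗ-zeroʳ _))))

    -- In each degree ♯ is a polynomial in `D` and commutes with it, so this reduces to `D-♯`.
    ♯-D : ∀ x → (D x) ♯ ≈ 0#
    ♯-D = ext (♯-linear ∘ᴸ D-linear) 0-linear (λ u →
      ≈ᴹ-trans (♯-projection (W-D (W-N u)))
      (≈ᴹ-trans (≈ᴹ-sym (projection-comm 𝓐 D-linear (length (word u)) (N u)))
      (≈ᴹ-trans (Linear.cong D-linear (≈ᴹ-sym (♯-projection (W-N u)))) (D-♯ (N u)))))

    kernel-D : ∀ {n x} → W₍ n ₎ x → D x ≈ 0# → x ♯ ≈ x
    kernel-D {n} p q = ≈ᴹ-trans (♯-projection p) (kernel-projection 𝓐 D-linear q n)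

    ♯-idem : ∀ x → x ♯ ♯ ≈ x ♯
    ♯-idem = ext (♯-linear ∘ᴸ ♯-linear) ♯-linear (λ u → kernel-D (W-♯ (W-N u)) (D-♯ (N u)))

    ♯-1 : 1# ♯ ≈ 1#
    ♯-1 = ♯-projection W-1

    ♯-⋆ : ∀ x y → (x ⋆ y) ♯ ≈ (x ⋆ y ♯)
    ♯-⋆ = ext₂ (bilinear-∘ ♯-linear ⋆-bilinear)
      (record { linearˡ = λ y → ⋆-linearˡ (y ♯) ; linearʳ = λ x → ⋆-linearʳ x ∘ᴸ ♯-linear }) basis
      where
      basis : ∀ u v → (N u ⋆ N v) ♯ ≈ (N u ⋆ N v ♯)
      basis u v with length (word u) ℕ.≟ length (word v)
      ... | yes p = ≈ᴹ-trans (♯-W (W-⋆ (≡.subst (λ k → W₍ k ₎ (N u)) p (W-N u)) (W-N v)))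
        (≈ᴹ-trans (⋆-assoc _ _ _) (⋆-cong ≈ᴹ-refl (≈ᴹ-sym (♯-W (W-N v)))))
      ... | no p = ≈ᴹ-trans (Linear.cong ♯-linear (⋆-N-≢ u v p))
        (≈ᴹ-trans (Linear.zero-homo ♯-linear) (≈ᴹ-sym (W-⋆-≢ p (W-N u) (W-♯ (W-N v)))))

    -- The kernel of ♯

    private
      -- The linear span of the singleton words. It absorbs ordinary products on both sides and
      -- therefore equals `J`, but a linear map can be tested on it by its values at single words.
      J₀ : Pred Carrier _
      J₀ = Span rawAlgebra Singletons

    J₀-Nᵒ : ∀ O {w x} → Once O x w → J₀ (Nᵒ O w)
    J₀-Nᵒ O o = generator (_ , Once⇒HasSingleton o , ≡.refl)

    private
      Once-inj₁ : ∀ {w x} → Once ℕᵒ x w → Once (ℕᵒ ⊎ᵒ ℕᵒ) (inj₁ x) (map inj₁ w)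
      Once-inj₁ {w} o with Once-≋ (inj₁-∼ {ℕᵒ} {ℕᵒ}) (map-≋ (inj₁-∼ {ℕᵒ} {ℕᵒ}) inj₁ (λ _ → ≡.refl) w) o
      ... | _ , ≡.refl , o′ = o′

      Once-inj₂ : ∀ {w x} → Once ℕᵒ x w → Once (ℕᵒ ⊎ᵒ ℕᵒ) (inj₂ x) (map inj₂ w)
      Once-inj₂ {w} o with Once-≋ (inj₂-∼ {ℕᵒ} {ℕᵒ}) (map-≋ (inj₂-∼ {ℕᵒ} {ℕᵒ}) inj₂ (λ _ → ≡.refl) w) o
      ... | _ , ≡.refl , o′ = o′

    -- In the ordered sum of the alphabets the letters of the other factor are distinct from the
    -- singleton, which keeps occurring once in every shuffle.
    J₀-*ʳ : ∀ y {x} → J₀ x → J₀ (x * y)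
    J₀-*ʳ y {x} p = span-closed (*-linearˡ y)
      (λ { _ (u , s , ≡.refl) → let (a , o) = HasSingleton⇒Once u s in
        span-closed {P = λ F → ∃ λ v → F ≡ N v} (*-linearʳ (N u))
          (λ { _ (v , ≡.refl) → respects
            (≈ᴹ-sym (≈ᴹ-trans (*-cong (N≈Nᵒ u) (N≈Nᵒ v)) (Nᵒ-* ℕᵒ ℕᵒ (word u) (word v))))
            (S.Ш-closed J₀ add (map inj₁ (word u)) (map inj₂ (word v))
              (λ w i → J₀-Nᵒ (ℕᵒ ⊎ᵒ ℕᵒ) (Once-interleaveˡ (ℕᵒ ⊎ᵒ ℕᵒ) i (Once-inj₁ o)
                (All.map⁺ (All.universal (λ _ ()) (word v)))))) })
          (spanning y) }) p

    J₀-*ˡ : ∀ y {x} → J₀ x → J₀ (y * x)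
    J₀-*ˡ y {x} p = span-closed (*-linearʳ y)
      (λ { _ (u , s , ≡.refl) → let (a , o) = HasSingleton⇒Once u s in
        span-closed {P = λ F → ∃ λ v → F ≡ N v} (*-linearˡ (N u))
          (λ { _ (v , ≡.refl) → respects
            (≈ᴹ-sym (≈ᴹ-trans (*-cong (N≈Nᵒ v) (N≈Nᵒ u)) (Nᵒ-* ℕᵒ ℕᵒ (word v) (word u))))
            (S.Ш-closed J₀ add (map inj₁ (word v)) (map inj₂ (word u))
              (λ w i → J₀-Nᵒ (ℕᵒ ⊎ᵒ ℕᵒ) (Once-interleaveʳ (ℕᵒ ⊎ᵒ ℕᵒ) i
                (All.map⁺ (All.universal (λ _ ()) (word v))) (Once-inj₂ o)))) })
          (spanning y) }) p

    -- The singleton stands in the left word here. Multiples from the other side are governed by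
    -- `♯-⋆`: if ♯ kills x, it kills y ⋆ x.
    J₀-⋆ʳ : ∀ y {x} → J₀ x → J₀ (x ⋆ y)
    J₀-⋆ʳ y {x} p = span-closed (⋆-linearˡ y)
      (λ { _ (u , s , ≡.refl) →
        span-closed {P = λ F → ∃ λ v → F ≡ N v} (⋆-linearʳ (N u))
          (λ { _ (v , ≡.refl) → basis u v (HasSingleton⇒Once u s) (length (word u) ℕ.≟ length (word v)) })
          (spanning y) }) p
      where
      basis : ∀ u v → (∃ λ a → Once ℕᵒ a (word u)) → Dec (length (word u) ≡ length (word v)) → J₀ (N u ⋆ N v)
      basis u v (a , o) (yes eq) = respects (≈ᴹ-sym (⋆-N u v eq))
        (J₀-Nᵒ (ℕᵒ ×ᵒ ℕᵒ) (proj₂ (Once-zipˡ {P = ℕᵒ} (word v) eq o)))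
      basis u v _ (no neq) = respects (≈ᴹ-sym (⋆-N-≢ u v neq)) zero

    J⇒J₀ : ∀ {x} → J x → J₀ x
    J⇒J₀ (generator p) = generator p
    J⇒J₀ zero = zero
    J⇒J₀ (add p q) = add (J⇒J₀ p) (J⇒J₀ q)
    J⇒J₀ (scale k p) = scale k (J⇒J₀ p)
    J⇒J₀ (mulˡ y p) = J₀-*ˡ y (J⇒J₀ p)
    J⇒J₀ (mulʳ y p) = J₀-*ʳ y (J⇒J₀ p)
    J⇒J₀ (respects eq p) = respects eq (J⇒J₀ p)

    J₀⇒J : ∀ {x} → J₀ x → J x
    J₀⇒J (generator p) = generator p
    J₀⇒J zero = zero
    J₀⇒J (add p q) = add (J₀⇒J p) (J₀⇒J q)
    J₀⇒J (scale k p) = scale k (J₀⇒J p)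
    J₀⇒J (respects eq p) = respects eq (J₀⇒J p)

    private
      D-J₀ : ∀ x → J₀ (D x)
      D-J₀ x = span-closed D-linear (λ { _ (u , ≡.refl) → respects (≈ᴹ-sym (extend-N _ u))
        (S.Mark-closed J₀ zero add (word u) (λ l y r _ → J₀-Nᵒ (ℕᵒ ×ᵒ ℕᵒ) (marked-Once ℕᵒ l y r))) }) (spanning x)

      falling-J₀ : ∀ i x → J₀ (falling 𝓐 D (suc i) x)
      falling-J₀ zero    x = respects (≈ᴹ-sym (falling-suc 𝓐 D-linear 0 x)) (D-J₀ x)
      falling-J₀ (suc i) x = add (D-J₀ _) (scale _ (falling-J₀ i x))

      projection-J₀ : ∀ n x → J₀ (projection 𝓐 D n x + -ᴹ x)
      projection-J₀ zero    x = respects (≈ᴹ-sym (-ᴹ‿inverseʳ x)) zero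
      projection-J₀ (suc n) x = respects
        (≈ᴹ-trans (+ᴹ-assoc _ _ _) (≈ᴹ-trans (+ᴹ-congˡ (+ᴹ-comm _ _)) (≈ᴹ-sym (+ᴹ-assoc _ _ _))))
        (add (projection-J₀ n x) (scale (coef (suc n)) (falling-J₀ n x)))

    ♯-J₀ : ∀ x → J₀ (x ♯ + -ᴹ x)
    ♯-J₀ x = span-closed (+-linear ♯-linear (-linear id-linear))
      (λ { _ (u , ≡.refl) → respects (+ᴹ-congʳ (≈ᴹ-sym (♯-projection (W-N u)))) (projection-J₀ (length (word u)) (N u)) })
      (spanning x)

    private
      countMarks : ∀ {g} v (w : List ℕ) →
                   (∀ l x r → l ++ x ∷ r ≡ w → g (markAt l x r) ≈ v ⊎ g (markAt l x r) ≈ 0#) →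
                   ∃ λ k → S.Mark g w ≈ ι k *ₗ v
      countMarks v []      e = 0 , ≈ᴹ-sym (*ₗ-zeroˡ v)
      countMarks v (x ∷ w) e with countMarks v w (λ l y r eq → e (x ∷ l) y r (≡.cong (x ∷_) eq)) | e [] x w ≡.refl
      ... | k , eq | inj₁ p = suc k , ≈ᴹ-trans (+ᴹ-cong (≈ᴹ-trans p (≈ᴹ-sym (*ₗ-identityˡ v))) eq) (≈ᴹ-sym (*ₗ-distribʳ v _ _))
      ... | k , eq | inj₂ p = k , ≈ᴹ-trans (+ᴹ-cong p eq) (+ᴹ-identityˡ _)

      -- One position known to contribute `v` makes the multiplicity positive, hence invertible.
      countMarks⁺ : ∀ {g} v (l : List ℕ) x r →
                    (∀ l′ x′ r′ → l′ ++ x′ ∷ r′ ≡ l ++ x ∷ r → g (markAt l′ x′ r′) ≈ v ⊎ g (markAt l′ x′ r′) ≈ 0#) →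
                    g (markAt l x r) ≈ v → ∃ λ k → S.Mark g (l ++ x ∷ r) ≈ ι (suc k) *ₗ v
      countMarks⁺ v [] x r e p with countMarks v r (λ l y r′ eq → e (x ∷ l) y r′ (≡.cong (x ∷_) eq))
      ... | k , eq = k , ≈ᴹ-trans (+ᴹ-cong (≈ᴹ-trans p (≈ᴹ-sym (*ₗ-identityˡ v))) eq) (≈ᴹ-sym (*ₗ-distribʳ v _ _))
      countMarks⁺ v (y ∷ l) x r e p
        with countMarks⁺ v l x r (λ l′ x′ r′ eq → e (y ∷ l′) x′ r′ (≡.cong (y ∷_) eq)) p | e [] y (l ++ x ∷ r) ≡.refl
      ... | k , eq | inj₁ q = suc k , ≈ᴹ-trans (+ᴹ-cong (≈ᴹ-trans q (≈ᴹ-sym (*ₗ-identityˡ v))) eq) (≈ᴹ-sym (*ₗ-distribʳ v _ _))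
      ... | k , eq | inj₂ q = k , ≈ᴹ-trans (+ᴹ-cong q eq) (+ᴹ-identityˡ _)

      -- Marking a letter that occurs once does not change N u, and marking any other letter
      -- leaves fewer pairs of equal letters; so 0 = (D (N u)) ♯ is a positive multiple of N u ♯.
      ♯-singleton : ∀ m u → equalPairs ℕᵒ (word u) < m → HasSingleton u → N u ♯ ≈ 0#
      ♯-singleton (suc m) u (s≤s bound) s = ι-cancel 𝓐 (proj₁ total) (N u ♯)
        (≈ᴹ-trans (≈ᴹ-sym (proj₂ total)) (begin
          S.Mark (λ v → Nᵒ P v ♯) (l₀ ++ a₀ ∷ r₀) ≈⟨ ≈ᴹ-reflexive (≡.cong (S.Mark (λ v → Nᵒ P v ♯)) eq₀) ⟨
          S.Mark (λ v → Nᵒ P v ♯) (word u)        ≈⟨ Mark-linear R ♯-linear _ (word u) ⟨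
          S.Mark (Nᵒ P) (word u) ♯                ≈⟨ Linear.cong ♯-linear (extend-N _ u) ⟨
          D (N u) ♯                               ≈⟨ ♯-D (N u) ⟩
          0#                                      ∎))
        where
        P = ℕᵒ ×ᵒ ℕᵒ
        once = HasSingleton⇒Once u s
        a₀ = proj₁ once
        split = Once⇒Alone ℕᵒ (proj₂ once)
        l₀ = proj₁ split
        r₀ = proj₁ (proj₂ split)
        eq₀ : word u ≡ l₀ ++ a₀ ∷ r₀
        eq₀ = proj₁ (proj₂ (proj₂ split))
        alone : ∀ {l x r} → l ++ x ∷ r ≡ word u → Alone ℕᵒ l x r → Nᵒ P (markAt l x r) ♯ ≈ N u ♯
        alone {l} {x} {r} eq p = Linear.cong ♯-linear (≈ᴹ-trans
          (≈ᴹ-reflexive (≡.cong N (≡.trans (Alone⇒pack ℕᵒ p) (≡.cong (pack ℕᵒ) eq)))) (≈ᴹ-sym (N≈Nᵒ u)))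
        notAlone : ∀ {l x r} → l ++ x ∷ r ≡ word u → Any (x ≡_) (l ++ r) → Nᵒ P (markAt l x r) ♯ ≈ 0#
        notAlone {l} {x} {r} eq p = ♯-singleton m (pack P (markAt l x r))
          (ℕ.<-≤-trans (≡.subst₂ _<_ (≡.sym (equalPairs-≋ (rank-∼ P v) (rank-≋ P v)))
            (≡.cong (equalPairs ℕᵒ) eq) (equalPairs-markAt ℕᵒ l x r p)) bound)
          (Once⇒HasSingleton (marked-Once ℕᵒ l x r))
          where v = markAt l x r
        each : ∀ l x r → l ++ x ∷ r ≡ word u → Nᵒ P (markAt l x r) ♯ ≈ N u ♯ ⊎ Nᵒ P (markAt l x r) ♯ ≈ 0#
        each l x r eq with Any.any? (x ℕ.≟_) (l ++ r)
        ... | yes p = inj₂ (notAlone eq p)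
        ... | no ¬p = inj₁ (alone eq (All.++⁻ˡ l (All.¬Any⇒All¬ _ ¬p) , All.++⁻ʳ l (All.¬Any⇒All¬ _ ¬p)))
        total = countMarks⁺ {λ v → Nᵒ P v ♯} (N u ♯) l₀ a₀ r₀
          (λ l x r eq → each l x r (≡.trans eq (≡.sym eq₀)))
          (alone (≡.sym eq₀) (proj₂ (proj₂ (proj₂ split))))

    J₀-♯ : ∀ {x} → J₀ x → x ♯ ≈ 0#
    J₀-♯ = Span-ext ♯-linear 0-linear
      (λ { _ (u , s , ≡.refl) → ♯-singleton _ u ℕ.≤-refl s })

    -- By `♯-J₀` the elements x ♯ and x differ by an element of the span, so a linear map that kills
    -- the span cannot tell them apart.
    ♯-invariant : ∀ {m ℓm} {M : Module m ℓm} {f} → Linear 𝓐 M f →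
                  (∀ {y} → J₀ y → LeftModule._≈ᴹ_ M (f y) (LeftModule.0ᴹ M)) →
                  ∀ x → LeftModule._≈ᴹ_ M (f (x ♯)) (f x)
    ♯-invariant {M = M} F k x = M.x-y≈0⇒x≈y (M.≈ᴹ-trans
      (M.≈ᴹ-trans (M.+ᴹ-congˡ (M.≈ᴹ-sym (Linear.neg-homo F x))) (M.≈ᴹ-sym (Linear.+-homo F _ _)))
      (k (♯-J₀ x)))
      where module M = ModuleReasoning M

    ♯-* : ∀ x y → (x * y) ♯ ≈ x ♯ * y ♯
    ♯-* x y = begin
      (x * y) ♯        ≈⟨ ♯-invariant (♯-linear ∘ᴸ *-linearˡ y) (λ p → J₀-♯ (J₀-*ʳ y p)) x ⟨
      (x ♯ * y) ♯      ≈⟨ ♯-invariant (♯-linear ∘ᴸ *-linearʳ (x ♯)) (λ p → J₀-♯ (J₀-*ˡ (x ♯) p)) y ⟨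
      (x ♯ * y ♯) ♯    ≈⟨ ext₂ (bilinear-∘ ♯-linear B) B basis x y ⟩
      x ♯ * y ♯        ∎
      where
      B : Bilinear 𝓐 𝓐 𝓐 (λ x y → x ♯ * y ♯)
      B = bilinear-∘₂ *-bilinear ♯-linear ♯-linear
      basis : ∀ u v → (N u ♯ * N v ♯) ♯ ≈ N u ♯ * N v ♯
      basis u v = kernel-D (W-* (W-♯ (W-N u)) (W-♯ (W-N v))) (≈ᴹ-trans (D-* _ _)
        (≈ᴹ-trans (+ᴹ-cong (≈ᴹ-trans (*-cong (D-♯ (N u)) ≈ᴹ-refl) (Linear.zero-homo (*-linearˡ _)))
                           (≈ᴹ-trans (*-cong ≈ᴹ-refl (D-♯ (N v))) (Linear.zero-homo (*-linearʳ _))))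
                  (+ᴹ-identityˡ 0#)))

    ♯-⋆-♯ : ∀ x y → (x ⋆ y) ♯ ≈ (x ♯ ⋆ y ♯)
    ♯-⋆-♯ x y = ≈ᴹ-trans (≈ᴹ-sym (♯-invariant (♯-linear ∘ᴸ ⋆-linearˡ y) (λ p → J₀-♯ (J₀-⋆ʳ y p)) x)) (♯-⋆ (x ♯) y)

    -- A word with a singleton is not empty, so the counit kills the span and `♯-invariant` applies.
    ε-♯ : ∀ x → ε (x ♯) R.≈ ε x
    ε-♯ = ♯-invariant ε-linear (Span-ext ε-linear 0-linear
      (λ { _ (u , s , ≡.refl) → ε-N-nonempty u (nonempty (proj₂ (HasSingleton⇒Once u s))) }))
      where
      nonempty : ∀ {a w} → Once ℕᵒ a w → w ≢ []
      nonempty (here _)    ()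
      nonempty (there _ _) ()

    -- Compatibility of ♯ with the coproduct

    private
      D₁ : Linear (𝓐 ⊗ᴹ 𝓐) (𝓐 ⊗ᴹ 𝓐) (D ⟨⊗⟩ id)
      D₁ = ⟨⊗⟩-linear D-linear id-linear

      D₂ : Linear (𝓐 ⊗ᴹ 𝓐) (𝓐 ⊗ᴹ 𝓐) (id ⟨⊗⟩ D)
      D₂ = ⟨⊗⟩-linear id-linear D-linear

      D₁D₂ : ∀ s → (D ⟨⊗⟩ id) ((id ⟨⊗⟩ D) s) T².≈ᴹ (id ⟨⊗⟩ D) ((D ⟨⊗⟩ id) s)
      D₁D₂ = ⊗-ext (D₁ ∘ᴸ D₂) (D₂ ∘ᴸ D₁) (λ _ _ → ≈-refl)

      -- Polynomial identities for `D` hold in bounded degree only, not on the whole tensor square;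
      -- the coproduct of an element of degree n involves pure tensors of degrees at most n.
      Δ-ext : ∀ {n f g} → Linear (𝓐 ⊗ᴹ 𝓐) (𝓐 ⊗ᴹ 𝓐) f → Linear (𝓐 ⊗ᴹ 𝓐) (𝓐 ⊗ᴹ 𝓐) g →
              (∀ {i j x y} → i ≤ n → j ≤ n → W₍ i ₎ x → W₍ j ₎ y → f [ x , y ] T².≈ᴹ g [ x , y ]) →
              ∀ {x} → W₍ n ₎ x → f (Δ x) T².≈ᴹ g (Δ x)
      Δ-ext {n} {f} {g} F G e = Span-ext (F ∘ᴸ Δ-linear) (G ∘ᴸ Δ-linear)
        (λ { _ (u , ≡.refl , ≡.refl) → ≈-trans (expand F u) (≈-trans
          (S².Cut-cong (word u) (λ a b eq → e
            (ℕ.≤-trans (ℕ.m≤m+n (length a) (length b)) (ℕ.≤-reflexive (len a b eq)))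
            (ℕ.≤-trans (ℕ.m≤n+m (length b) (length a)) (ℕ.≤-reflexive (len a b eq)))
            (W-Nᵒ ℕᵒ a) (W-Nᵒ ℕᵒ b)))
          (≈-sym (expand G u))) })
        where
        len : ∀ a b {w : List ℕ} → a ++ b ≡ w → length a +ℕ length b ≡ length w
        len a b eq = ≡.trans (≡.sym (List.length-++ a)) (≡.cong length eq)
        expand : ∀ {h} (H : Linear (𝓐 ⊗ᴹ 𝓐) (𝓐 ⊗ᴹ 𝓐) h) u →
                 h (Δ (N u)) T².≈ᴹ S².Cut (λ a b → h [ Nᵒ ℕᵒ a , Nᵒ ℕᵒ b ]) (word u)
        expand H u = ≈-trans (Linear.cong H (Δ-N u)) (Cut-linear R H _ (word u))

      -- The additional terms vanish by `falling-W-≤`, so one polynomial in `D` computes ♯ in all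
      -- degrees up to n.
      projection-≤ : ∀ {m n x} → m ≤ n → W₍ m ₎ x → projection 𝓐 D n x ≈ x ♯
      projection-≤ {m} m≤n p = go (ℕ.≤⇒≤′ m≤n)
        where
        go : ∀ {n} → m ≤′ n → projection 𝓐 D n _ ≈ _ ♯
        go (≤′-reflexive ≡.refl) = ≈ᴹ-sym (♯-projection p)
        go (≤′-step q) = ≈ᴹ-trans
          (+ᴹ-cong (go q) (≈ᴹ-trans (*ₗ-cong R.refl (falling-W-≤ (ℕ.≤′⇒≤ q) p)) (*ₗ-zeroʳ _))) (+ᴹ-identityʳ _)

      ♯₁ : Linear (𝓐 ⊗ᴹ 𝓐) (𝓐 ⊗ᴹ 𝓐) (_♯ ⟨⊗⟩ id)
      ♯₁ = ⟨⊗⟩-linear ♯-linear id-linear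

      ♯₂ : Linear (𝓐 ⊗ᴹ 𝓐) (𝓐 ⊗ᴹ 𝓐) (id ⟨⊗⟩ _♯)
      ♯₂ = ⟨⊗⟩-linear id-linear ♯-linear

      -- On Δ x the map ♯ on one tensor factor is the projection for D ⊗ 1 or for 1 ⊗ D. By
      -- `sum-kernel` both operators kill Δ x, so both projections fix it.
      Δ-kernel : ∀ {n x} → W₍ n ₎ x → D x ≈ 0# → (_♯ ⟨⊗⟩ _♯) (Δ x) T².≈ᴹ Δ x
      Δ-kernel {n} {x} p Dx≈0 = T².begin
        (_♯ ⟨⊗⟩ _♯) (Δ x)
          T².≈⟨ ⊗-ext (⟨⊗⟩-linear ♯-linear ♯-linear) (♯₁ ∘ᴸ ♯₂) (λ _ _ → ≈-refl) (Δ x) ⟩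
        (_♯ ⟨⊗⟩ id) ((id ⟨⊗⟩ _♯) (Δ x))
          T².≈⟨ Linear.cong ♯₁ (≈-trans
            (Δ-ext ♯₂ (projection-linear (𝓐 ⊗ᴹ 𝓐) D₂ n) (λ {_} {_} {y} _ j≤n _ q → ≈-trans
              (⊗-cong ≈ᴹ-refl (≈ᴹ-sym (projection-≤ j≤n q)))
              (projection-natural (pure-linearʳ y) D₂ (λ _ → ≈-refl) n _)) p)
            (kernel-projection (𝓐 ⊗ᴹ 𝓐) D₂ (proj₂ kernels) n)) ⟩
        (_♯ ⟨⊗⟩ id) (Δ x)
          T².≈⟨ Δ-ext ♯₁ (projection-linear (𝓐 ⊗ᴹ 𝓐) D₁ n) (λ {_} {_} {_} {z} i≤n _ q _ → ≈-trans
              (⊗-cong (≈ᴹ-sym (projection-≤ i≤n q)) ≈ᴹ-refl)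
              (projection-natural (pure-linearˡ z) D₁ (λ _ → ≈-refl) n _)) p ⟩
        projection (𝓐 ⊗ᴹ 𝓐) (D ⟨⊗⟩ id) n (Δ x)
          T².≈⟨ kernel-projection (𝓐 ⊗ᴹ 𝓐) D₁ (proj₁ kernels) n ⟩
        Δ x T².∎
        where
        vanish₁ : falling (𝓐 ⊗ᴹ 𝓐) (D ⟨⊗⟩ id) (suc n) (Δ x) T².≈ᴹ []
        vanish₁ = Δ-ext (falling-linear (𝓐 ⊗ᴹ 𝓐) D₁ (suc n)) 0-linear (λ {_} {_} {_} {z} i≤n _ q _ → ≈-trans
          (≈-sym (falling-natural (pure-linearˡ z) D₁ (λ _ → ≈-refl) (suc n) _))
          (≈-trans (⊗-cong (falling-W-≤ i≤n q) ≈ᴹ-refl) (zeroˡ z))) p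
        vanish₂ : falling (𝓐 ⊗ᴹ 𝓐) (id ⟨⊗⟩ D) (suc n) (Δ x) T².≈ᴹ []
        vanish₂ = Δ-ext (falling-linear (𝓐 ⊗ᴹ 𝓐) D₂ (suc n)) 0-linear (λ {_} {_} {y} _ j≤n _ q → ≈-trans
          (≈-sym (falling-natural (pure-linearʳ y) D₂ (λ _ → ≈-refl) (suc n) _))
          (≈-trans (⊗-cong ≈ᴹ-refl (falling-W-≤ j≤n q)) (zeroʳ y))) p
        kernels = sum-kernel (𝓐 ⊗ᴹ 𝓐) (ι-cancel (𝓐 ⊗ᴹ 𝓐)) D₁ D₂ D₁D₂ n n
          (≈-trans (≈-sym (Δ-D x)) (≈-trans (Linear.cong Δ-linear Dx≈0) (Linear.zero-homo Δ-linear)))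
          vanish₁ vanish₂

      ♯♯ : Linear (𝓐 ⊗ᴹ 𝓐) (𝓐 ⊗ᴹ 𝓐) (_♯ ⟨⊗⟩ _♯)
      ♯♯ = ⟨⊗⟩-linear ♯-linear ♯-linear

      -- A letter occurring once lies on one side of every cut and occurs once there, so ♯ kills
      -- that tensor factor.
      Δ-J₀ : ∀ {x} → J₀ x → (_♯ ⟨⊗⟩ _♯) (Δ x) T².≈ᴹ []
      Δ-J₀ = Span-ext (♯♯ ∘ᴸ Δ-linear) 0-linear (λ { _ (u , s , ≡.refl) →
        ≈-trans (Linear.cong ♯♯ (Δ-N u)) (≈-trans (Cut-linear R ♯♯ _ (word u))
          (S².Cut-closed (T²._≈ᴹ []) (λ p q → T².+ᴹ-cong p q) (word u)
            (λ a b eq → case a b (Once-++ ℕᵒ a (≡.subst (Once ℕᵒ _) (≡.sym eq) (proj₂ (HasSingleton⇒Once u s))))))) })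
        where
        case : ∀ {x} a b → Once ℕᵒ x a ⊎ Once ℕᵒ x b → [ Nᵒ ℕᵒ a ♯ , Nᵒ ℕᵒ b ♯ ] T².≈ᴹ []
        case a b (inj₁ o) = ≈-trans (⊗-cong (J₀-♯ (J₀-Nᵒ ℕᵒ o)) ≈ᴹ-refl) (zeroˡ _)
        case a b (inj₂ o) = ≈-trans (⊗-cong ≈ᴹ-refl (J₀-♯ (J₀-Nᵒ ℕᵒ o))) (zeroʳ _)

    -- On the image of ♯ this is `Δ-kernel`; passing from x ♯ to x under ♯ ⊗ ♯ is allowed by `Δ-J₀`.
    Δ-♯ : ∀ x → Δ (x ♯) T².≈ᴹ (_♯ ⟨⊗⟩ _♯) (Δ x)
    Δ-♯ x = ≈-trans
      (ext (Δ-linear ∘ᴸ ♯-linear) (♯♯ ∘ᴸ Δ-linear ∘ᴸ ♯-linear)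
        (λ u → ≈-sym (Δ-kernel (W-♯ (W-N u)) (D-♯ (N u)))) x)
      (♯-invariant (♯♯ ∘ᴸ Δ-linear) Δ-J₀ x)

    J⇔kernel : ∀ x → J x ⇔ x ♯ ≈ 0#
    J⇔kernel x = mk⇔ (λ p → J₀-♯ (J⇒J₀ p))
      -- If x ♯ = 0, then x is -1 times x ♯ - x, which lies in the span.
      (λ p → J₀⇒J (respects (≈ᴹ-trans (≈ᴹ-sym (-ᴹ≈-1*ₗ _)) (≈ᴹ-trans (-ᴹ‿cong (≈ᴹ-trans (+ᴹ-congʳ p) (+ᴹ-identityˡ _)))
        (LeftModuleProperties.-ᴹ-involutive 𝓐 x))) (scale (R.- R.1#) (♯-J₀ x))))

    J-difference : ∀ x y → J (x + -ᴹ y) ⇔ x ♯ ≈ y ♯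
    J-difference x y = mk⇔
      (λ p → x-y≈0⇒x≈y (≈ᴹ-trans (≈ᴹ-sym difference) (Equivalence.to (J⇔kernel _) p)))
      (λ p → Equivalence.from (J⇔kernel _) (≈ᴹ-trans difference (x≈y⇒x-y≈0 p)))
      where
      difference : (x + -ᴹ y) ♯ ≈ x ♯ + -ᴹ (y ♯)
      difference = ≈ᴹ-trans (Linear.+-homo ♯-linear x _) (+ᴹ-congˡ (Linear.neg-homo ♯-linear y))

-- Bialgebras that are retracts of a Hopf algebra

module Retracts {c ℓ} (R : CommutativeRing c ℓ) where
  open LinearAlgebra R

  -- Algebra laws pull back along an injective homomorphism. This serves both a subalgebra, through
  -- its inclusion, and a quotient, through ♯, which is injective modulo its kernel.
  record IsMonomorphism {a b ℓa ℓb} (B : RawAlgebra b ℓb) (A : RawAlgebra a ℓa)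
                        (s : RawAlgebra.Carrier B → RawAlgebra.Carrier A) :
                        Set (c ⊔ a ⊔ b ⊔ ℓa ⊔ ℓb) where
    private
      module A = RawAlgebra A
      module B = RawAlgebra B
    field
      cong      : ∀ {x y} → x B.≈ y → s x A.≈ s y
      injective : ∀ {x y} → s x A.≈ s y → x B.≈ y
      +-homo    : ∀ x y → s (x B.+ y) A.≈ s x A.+ s y
      *-homo    : ∀ x y → s (x B.* y) A.≈ s x A.* s y
      *ₗ-homo   : ∀ k x → s (k B.*ₗ x) A.≈ k A.*ₗ s x
      neg-homo  : ∀ x → s (B.- x) A.≈ A.- s x
      0-homo    : s B.0# A.≈ A.0#
      1-homo    : s B.1# A.≈ A.1#

    isRingMonomorphism : RingMorphisms.IsRingMonomorphism B.rawRing A.rawRing s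
    isRingMonomorphism = record
      { isRingHomomorphism = record
        { isSemiringHomomorphism = record
          { isNearSemiringHomomorphism = record
            { +-isMonoidHomomorphism = record
              { isMagmaHomomorphism = record { isRelHomomorphism = record { cong = cong } ; homo = +-homo }
              ; ε-homo = 0-homo
              }
            ; *-homo = *-homo
            }
          ; 1#-homo = 1-homo
          }
        ; -‿homo = neg-homo
        }
      ; injective = injective
      }

    isLeftModuleMonomorphism :
      LeftModuleMorphisms.IsLeftModuleMonomorphism B.rawLeftModule A.rawLeftModule s
    isLeftModuleMonomorphism = record
      { isLeftModuleHomomorphism = record
        { +ᴹ-isGroupHomomorphism = record
          { isMonoidHomomorphism = record
            { isMagmaHomomorphism = record { isRelHomomorphism = record { cong = cong } ; homo = +-homo }
            ; ε-homo = 0-homo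
            }
          ; ⁻¹-homo = neg-homo
          }
        ; *ₗ-homo = *ₗ-homo
        }
      ; injective = injective
      }

    isAlgebra : IsAlgebra A → IsAlgebra B
    isAlgebra algebra = record
      { isRing = RingMono.isRing isRingMonomorphism isRing
      ; isLeftModule = LeftModuleMono.isLeftModule isLeftModuleMonomorphism R.isRing isLeftModule
      ; *ₗ-*-assoc = λ k x y → injective (trans (*-homo _ y) (trans (*-cong (*ₗ-homo k x) refl)
          (trans (*ₗ-*-assoc k _ _) (sym (trans (*ₗ-homo k _) (*ₗ-cong R.refl (*-homo x y)))))))
      ; *-*ₗ-comm = λ k x y → injective (trans (*-homo x _) (trans (*-cong refl (*ₗ-homo k y))
          (trans (*-*ₗ-comm k _ _) (sym (trans (*ₗ-homo k _) (*ₗ-cong R.refl (*-homo x y)))))))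
      }
      where
      open IsAlgebra algebra
      open IsLeftModule isLeftModule using (*ₗ-cong)
      open IsRing isRing using (refl; sym; trans; *-cong)

    isIsomorphism : IsAlgebra B → IsAlgebra A → (∀ y → ∃ λ x → s x A.≈ y) → AlgebraIsomorphism B A
    isIsomorphism algB algA onto = record
      { isAlgebra₁ = algB
      ; isAlgebra₂ = algA
      ; ⟦_⟧ = s
      ; isRingIsomorphism = record { isRingMonomorphism = isRingMonomorphism ; surjective = surjective }
      ; isLeftModuleIsomorphism =
          record { isLeftModuleMonomorphism = isLeftModuleMonomorphism ; surjective = surjective }
      }
      where
      surjective : ∀ y → ∃ λ x → ∀ {z} → z B.≈ x → s z A.≈ y
      surjective y = proj₁ (onto y) , λ z≈x → IsRing.trans (IsAlgebra.isRing algA) (cong z≈x) (proj₂ (onto y))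

  module HopfRetract {a b ℓa ℓb} {A : RawBialgebra a ℓa} {B : RawBialgebra b ℓb}
                     (isHopfAlgebraᴬ : IsHopfAlgebra A) where
    private
      module A where
        open RawBialgebra A public
        open IsHopfAlgebra isHopfAlgebraᴬ public
      module B = RawBialgebra B

    𝓐 : Module a ℓa
    𝓐 = record { isLeftModule = IsAlgebra.isLeftModule A.isAlgebra }

    -- B is a retract of A with section `s` and retraction `f`. Identities between elements are
    -- pulled back along the injective `s`; identities between tensors are pushed forward along
    -- `f ⟨⊗⟩ f`, which undoes `s ⟨⊗⟩ s`.
    module _ {s : B.Carrier → A.Carrier} {f : A.Carrier → B.Carrier}
             (mono : IsMonomorphism B.rawAlgebra A.rawAlgebra s)
             (s-Δ : ∀ x → TensorEq A.rawLeftModule A.rawLeftModule ((s ⟨⊗⟩ s) (B.Δ x)) (A.Δ (s x)))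
             (s-ε : ∀ x → B.ε x R.≈ A.ε (s x))
             (f-cong : ∀ {x y} → x A.≈ y → f x B.≈ f y)
             (f-+ : ∀ x y → f (x A.+ y) B.≈ f x B.+ f y)
             (f-*ₗ : ∀ k x → f (k A.*ₗ x) B.≈ k B.*ₗ f x)
             (f-* : ∀ x y → f (x A.* y) B.≈ f x B.* f y)
             (fs : ∀ x → f (s x) B.≈ x) where
      private
        module s = IsMonomorphism mono

      isAlgebraᴮ : IsAlgebra B.rawAlgebra
      isAlgebraᴮ = s.isAlgebra A.isAlgebra

      𝓑 : Module b ℓb
      𝓑 = record { isLeftModule = IsAlgebra.isLeftModule isAlgebraᴮ }

      private
        module 𝓐 = ModuleReasoning 𝓐
        module 𝓑 = ModuleReasoning 𝓑
        module 𝓑² = ModuleReasoning (𝓑 ⊗ᴹ 𝓑)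
        module 𝓑³ = ModuleReasoning (𝓑 ⊗ᴹ (𝓑 ⊗ᴹ 𝓑))

        S : Linear 𝓑 𝓐 s
        S = record { cong = s.cong ; +-homo = s.+-homo ; *ₗ-homo = s.*ₗ-homo }

        F : Linear 𝓐 𝓑 f
        F = record { cong = f-cong ; +-homo = f-+ ; *ₗ-homo = f-*ₗ }

        Δᴬ : Linear 𝓐 (𝓐 ⊗ᴹ 𝓐) A.Δ
        Δᴬ = fromHomomorphism A.Δ-linear

        SS : Linear (𝓑 ⊗ᴹ 𝓑) (𝓐 ⊗ᴹ 𝓐) (s ⟨⊗⟩ s)
        SS = ⟨⊗⟩-linear S S

        FF : Linear (𝓐 ⊗ᴹ 𝓐) (𝓑 ⊗ᴹ 𝓑) (f ⟨⊗⟩ f)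
        FF = ⟨⊗⟩-linear F F

        FFF : Linear (𝓐 ⊗ᴹ (𝓐 ⊗ᴹ 𝓐)) (𝓑 ⊗ᴹ (𝓑 ⊗ᴹ 𝓑)) (f ⟨⊗⟩ (f ⟨⊗⟩ f))
        FFF = ⟨⊗⟩-linear F FF

        ff-ss : ∀ t → (f ⟨⊗⟩ f) ((s ⟨⊗⟩ s) t) 𝓑².≈ᴹ t
        ff-ss = ⊗-ext (FF ∘ᴸ SS) id-linear (λ x y → ⊗-cong (fs x) (fs y))

        -- Presents the coproduct of B as a composite of linear maps. Its linearity follows,
        -- although for a subbialgebra it is given by chosen witnesses and for a quotient it has to
        -- respect a coarser equality.
        Δ-via-A : ∀ x → (f ⟨⊗⟩ f) (A.Δ (s x)) 𝓑².≈ᴹ B.Δ x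
        Δ-via-A x = ≈-trans (Linear.cong FF (≈-sym (s-Δ x))) (ff-ss _)

        Δᴮ : Linear 𝓑 (𝓑 ⊗ᴹ 𝓑) B.Δ
        Δᴮ = linear-≈ (FF ∘ᴸ Δᴬ ∘ᴸ S) Δ-via-A

        εᴬ : Linear 𝓐 scalars A.ε
        εᴬ = fromHomomorphism A.ε-linear

        εᴮ : Linear 𝓑 scalars B.ε
        εᴮ = linear-≈ (εᴬ ∘ᴸ S) (λ x → R.sym (s-ε x))

        *ᴬ : Bilinear 𝓐 𝓐 𝓐 A._*_
        *ᴬ = algebra-bilinear A.isAlgebra

        *ᴮ : Bilinear 𝓑 𝓑 𝓑 B._*_
        *ᴮ = algebra-bilinear isAlgebraᴮ

        module *ᴬ = Bilinear *ᴬ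
        module *ᴮ = Bilinear *ᴮ

        *ᴮ-cong : ∀ {x x′ y y′} → x B.≈ x′ → y B.≈ y′ → x B.* y B.≈ x′ B.* y′
        *ᴮ-cong = IsRing.*-cong (IsAlgebra.isRing isAlgebraᴮ)

        f-1 : f A.1# B.≈ B.1#
        f-1 = 𝓑.≈ᴹ-trans (f-cong (𝓐.≈ᴹ-sym s.1-homo)) (fs B.1#)

        f-*-s : ∀ x y → f (s x A.* s y) B.≈ x B.* y
        f-*-s x y = 𝓑.≈ᴹ-trans (f-* _ _) (*ᴮ-cong (fs x) (fs y))

        ⊛-via-A : ∀ t t′ → (f ⟨⊗⟩ f) (cartesianProductWith (Product.zip A._*_ A._*_) ((s ⟨⊗⟩ s) t) ((s ⟨⊗⟩ s) t′))
                  𝓑².≈ᴹ cartesianProductWith (Product.zip B._*_ B._*_) t t′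
        ⊛-via-A [] t′ = ≈-refl
        ⊛-via-A ((x , y) ∷ t) t′ = ≈-trans
          (Linear.+-homo FF (map (Product.zip A._*_ A._*_ (s x , s y)) ((s ⟨⊗⟩ s) t′)) _)
          (++-cong (row t′) (⊛-via-A t t′))
          where
          row : ∀ t′ → (f ⟨⊗⟩ f) (map (Product.zip A._*_ A._*_ (s x , s y)) ((s ⟨⊗⟩ s) t′)) 𝓑².≈ᴹ
                       map (Product.zip B._*_ B._*_ (x , y)) t′
          row []             = ≈-refl
          row ((v , w) ∷ t′) = ++-cong (⊗-cong (f-*-s x v) (f-*-s y w)) (row t′)

        Δ-*-homo : ∀ x y → B.Δ (x B.* y) 𝓑².≈ᴹ cartesianProductWith (Product.zip B._*_ B._*_) (B.Δ x) (B.Δ y)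
        Δ-*-homo x y = ≈-trans (≈-sym (Δ-via-A _)) (≈-trans
          (Linear.cong FF (≈-trans (Linear.cong Δᴬ (s.*-homo x y)) (≈-trans (A.Δ-*-homo _ _)
            (≈-trans (Linear.cong (⊛ˡ (A.Δ (s y))) (≈-sym (s-Δ x)))
                     (Linear.cong (⊛ʳ ((s ⟨⊗⟩ s) (B.Δ x))) (≈-sym (s-Δ y)))))))
          (⊛-via-A (B.Δ x) (B.Δ y)))
          where open Bilinear (⊛-bilinear *ᴬ) renaming (linearˡ to ⊛ˡ; linearʳ to ⊛ʳ)

        coassoc : ∀ x → reassociate ((B.Δ ⟨⊗⟩ id) (B.Δ x)) 𝓑³.≈ᴹ (id ⟨⊗⟩ B.Δ) (B.Δ x)
        coassoc x = 𝓑³.begin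
          reassociate ((B.Δ ⟨⊗⟩ id) (B.Δ x))
            𝓑³.≈⟨ ⊗-ext (reassocᴮ ∘ᴸ ⟨⊗⟩-linear Δᴮ id-linear)
                        (FFF ∘ᴸ reassocᴬ ∘ᴸ ⟨⊗⟩-linear Δᴬ id-linear ∘ᴸ SS) left (B.Δ x) ⟩
          (f ⟨⊗⟩ (f ⟨⊗⟩ f)) (reassociate ((A.Δ ⟨⊗⟩ id) ((s ⟨⊗⟩ s) (B.Δ x))))
            𝓑³.≈⟨ Linear.cong (FFF ∘ᴸ reassocᴬ ∘ᴸ ⟨⊗⟩-linear Δᴬ id-linear) (s-Δ x) ⟩
          (f ⟨⊗⟩ (f ⟨⊗⟩ f)) (reassociate ((A.Δ ⟨⊗⟩ id) (A.Δ (s x))))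
            𝓑³.≈⟨ Linear.cong FFF (A.coassoc (s x)) ⟩
          (f ⟨⊗⟩ (f ⟨⊗⟩ f)) ((id ⟨⊗⟩ A.Δ) (A.Δ (s x)))
            𝓑³.≈⟨ Linear.cong (FFF ∘ᴸ ⟨⊗⟩-linear id-linear Δᴬ) (s-Δ x) ⟨
          (f ⟨⊗⟩ (f ⟨⊗⟩ f)) ((id ⟨⊗⟩ A.Δ) ((s ⟨⊗⟩ s) (B.Δ x)))
            𝓑³.≈⟨ ⊗-ext (FFF ∘ᴸ ⟨⊗⟩-linear id-linear Δᴬ ∘ᴸ SS) (⟨⊗⟩-linear id-linear Δᴮ)
                        (λ y z → ⊗-cong (fs y) (Δ-via-A z)) (B.Δ x) ⟩
          (id ⟨⊗⟩ B.Δ) (B.Δ x) 𝓑³.∎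
          where
          reassocᴬ : Linear ((𝓐 ⊗ᴹ 𝓐) ⊗ᴹ 𝓐) (𝓐 ⊗ᴹ (𝓐 ⊗ᴹ 𝓐)) reassociate
          reassocᴬ = reassociate-linear {M = 𝓐} {N = 𝓐} {P = 𝓐}
          reassocᴮ : Linear ((𝓑 ⊗ᴹ 𝓑) ⊗ᴹ 𝓑) (𝓑 ⊗ᴹ (𝓑 ⊗ᴹ 𝓑)) reassociate
          reassocᴮ = reassociate-linear {M = 𝓑} {N = 𝓑} {P = 𝓑}
          bracketᴬ : ∀ z → Linear (𝓐 ⊗ᴹ 𝓐) (𝓐 ⊗ᴹ (𝓐 ⊗ᴹ 𝓐)) (λ t → reassociate [ t , z ])
          bracketᴬ z = reassocᴬ ∘ᴸ Bilinear.linearˡ (pure-bilinear {M = 𝓐 ⊗ᴹ 𝓐} {N = 𝓐}) z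
          bracketᴮ : ∀ z → Linear (𝓑 ⊗ᴹ 𝓑) (𝓑 ⊗ᴹ (𝓑 ⊗ᴹ 𝓑)) (λ t → reassociate [ t , z ])
          bracketᴮ z = reassocᴮ ∘ᴸ Bilinear.linearˡ (pure-bilinear {M = 𝓑 ⊗ᴹ 𝓑} {N = 𝓑}) z
          left : ∀ y z → reassociate [ B.Δ y , z ] 𝓑³.≈ᴹ
                         (f ⟨⊗⟩ (f ⟨⊗⟩ f)) (reassociate [ A.Δ (s y) , s z ])
          left y z = 𝓑³.≈ᴹ-trans
            (⊗-ext (bracketᴮ z) (FFF ∘ᴸ bracketᴬ (s z) ∘ᴸ SS)
              (λ v w → ≈-sym (⊗-cong (fs v) (⊗-cong (fs w) (fs z)))) (B.Δ y))
            (Linear.cong (FFF ∘ᴸ bracketᴬ (s z)) (s-Δ y))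

        s-fold : ∀ {b b′} → Bilinear 𝓐 𝓐 𝓐 b → Bilinear 𝓑 𝓑 𝓑 b′ → (∀ x y → s (b′ x y) A.≈ b (s x) (s y)) →
                 ∀ x → s (B.⟦ b′ ⟧⊗ (B.Δ x)) A.≈ A.⟦ b ⟧⊗ (A.Δ (s x))
        s-fold bilin bilin′ e x = 𝓐.≈ᴹ-trans
          (⊗-ext (S ∘ᴸ fold-linear bilin′) (fold-linear bilin ∘ᴸ SS)
            (λ y z → 𝓐.≈ᴹ-trans (s.cong (𝓑.+ᴹ-identityʳ _)) (𝓐.≈ᴹ-trans (e y z) (𝓐.≈ᴹ-sym (𝓐.+ᴹ-identityʳ _)))) (B.Δ x))
          (Linear.cong (fold-linear bilin) (s-Δ x))

        -- The counterpart of `s-fold` for the antipode: `antipodeᴮ` ends with an application of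
        -- `f`, so its laws are compared after `f`.
        fold-f : ∀ {b b′} → Bilinear 𝓐 𝓐 𝓐 b → Bilinear 𝓑 𝓑 𝓑 b′ → (∀ x y → b′ x y B.≈ f (b (s x) (s y))) →
                 ∀ x → B.⟦ b′ ⟧⊗ (B.Δ x) B.≈ f (A.⟦ b ⟧⊗ (A.Δ (s x)))
        fold-f bilin bilin′ e x = 𝓑.≈ᴹ-trans
          (⊗-ext (fold-linear bilin′) (F ∘ᴸ fold-linear bilin ∘ᴸ SS)
            (λ y z → 𝓑.≈ᴹ-trans (𝓑.+ᴹ-identityʳ _) (𝓑.≈ᴹ-trans (e y z) (f-cong (𝓐.≈ᴹ-sym (𝓐.+ᴹ-identityʳ _))))) (B.Δ x))
          (Linear.cong (F ∘ᴸ fold-linear bilin) (s-Δ x))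

        s-counit : ∀ x y → s (B.ε x B.*ₗ y) A.≈ A.ε (s x) A.*ₗ s y
        s-counit x y = 𝓐.≈ᴹ-trans (s.*ₗ-homo _ y) (𝓐.*ₗ-cong (s-ε x) 𝓐.≈ᴹ-refl)

      antipodeᴮ : B.Carrier → B.Carrier
      antipodeᴮ x = f (A.antipode (s x))

      private
        Tᴬ : Linear 𝓐 𝓐 A.antipode
        Tᴬ = fromHomomorphism A.antipode-linear

        Tᴮ : Linear 𝓑 𝓑 antipodeᴮ
        Tᴮ = F ∘ᴸ Tᴬ ∘ᴸ S

        f-unit : ∀ x → f (A.ε (s x) A.*ₗ A.1#) B.≈ B.ε x B.*ₗ B.1#
        f-unit x = 𝓑.≈ᴹ-trans (f-*ₗ _ _) (𝓑.*ₗ-cong (R.sym (s-ε x)) f-1)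

      isHopfAlgebra : IsHopfAlgebra B
      isHopfAlgebra = record
        { isAlgebra = isAlgebraᴮ
        ; Δ-linear = Linear.isHomomorphism Δᴮ
        ; ε-linear = Linear.isHomomorphism εᴮ
        ; coassoc = coassoc
        ; counitˡ = λ x → s.injective (𝓐.≈ᴹ-trans
            (s-fold (ε*ˡ εᴬ) (ε*ˡ εᴮ) s-counit x) (A.counitˡ (s x)))
        ; counitʳ = λ x → s.injective (𝓐.≈ᴹ-trans
            (s-fold (ε*ʳ εᴬ) (ε*ʳ εᴮ) (λ y z → s-counit z y) x) (A.counitʳ (s x)))
        ; Δ-*-homo = Δ-*-homo
        ; Δ-1#-homo = ≈-trans (≈-sym (Δ-via-A B.1#)) (≈-trans
            (Linear.cong FF (≈-trans (Linear.cong Δᴬ s.1-homo) A.Δ-1#-homo)) (⊗-cong f-1 f-1))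
        ; ε-*-homo = λ x y → R.trans (s-ε _) (R.trans (Linear.cong εᴬ (s.*-homo x y))
            (R.trans (A.ε-*-homo _ _) (R.sym (R.*-cong (s-ε x) (s-ε y)))))
        ; ε-1#-homo = R.trans (s-ε _) (R.trans (Linear.cong εᴬ s.1-homo) A.ε-1#-homo)
        ; antipode = antipodeᴮ
        ; antipode-linear = Linear.isHomomorphism Tᴮ
        ; antipodeˡ = λ x → 𝓑.≈ᴹ-trans
            (fold-f (bilinear-∘₂ *ᴬ Tᴬ id-linear) (bilinear-∘₂ *ᴮ Tᴮ id-linear)
              (λ y z → 𝓑.≈ᴹ-sym (𝓑.≈ᴹ-trans (f-* _ _) (*ᴮ-cong 𝓑.≈ᴹ-refl (fs z)))) x)
            (𝓑.≈ᴹ-trans (f-cong (A.antipodeˡ (s x))) (f-unit x))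
        ; antipodeʳ = λ x → 𝓑.≈ᴹ-trans
            (fold-f (bilinear-∘₂ *ᴬ id-linear Tᴬ) (bilinear-∘₂ *ᴮ id-linear Tᴮ)
              (λ y z → 𝓑.≈ᴹ-sym (𝓑.≈ᴹ-trans (f-* _ _) (*ᴮ-cong (fs y) 𝓑.≈ᴹ-refl))) x)
            (𝓑.≈ᴹ-trans (f-cong (A.antipodeʳ (s x))) (f-unit x))
        }

-- The isomorphisms W♯ ≅ W / J

module QuotientIsomorphism {c ℓ} (R : CommutativeRing c ℓ) where
  open LinearAlgebra R
  open PackedWordBialgebras R
  open FallingPowers R
  open Retracts R

  module Isomorphisms
    {a ℓa} {A : RawBialgebra a ℓa} {N _⋆_ extend} (isPWB : IsPackedWordBialgebra A N _⋆_ extend)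
    (ι⁻¹ : ∀ i → ∃ λ k → k R.* ι (suc i) R.≈ R.1#)
    (coef : ℕ → R.Carrier) (coef-0 : coef 0 R.≈ R.1#)
    (coef-suc : ∀ i → coef (suc i) R.* ι (suc i) R.≈ R.- coef i) where

    open RawBialgebra A
    open IsPackedWordBialgebra isPWB
    open Basis isPWB using (⋆-cong; *-cong; isHopfAlgebra; antipode; antipode-linear; ⋆-linearˡ; ⋆-linearʳ)
    open SharpMap.Sharp R isPWB ι⁻¹ coef coef-0 coef-suc
    open LeftModule 𝓐 using (≈ᴹ-refl; ≈ᴹ-sym; ≈ᴹ-trans; +ᴹ-cong; *ₗ-cong; -ᴹ‿cong)
    private
      module ♯ = Linear ♯-linear

    W♯ : Pred Carrier _
    W♯ F = ∃ λ G → F ≈ G ♯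

    W♯₍_₎ : ℕ → Pred Carrier _
    W♯₍ n ₎ F = ∃ λ G → W₍ n ₎ G × F ≈ G ♯

    J₍_₎ : ℕ → Pred Carrier _
    J₍ n ₎ = J ∩ W₍ n ₎

    internal : Carrier → RawAlgebra a ℓa
    internal e = record
      { RawAlgebra rawAlgebra hiding (_*_; 1#; rawRing; rawLeftModule; ⟦_⟧⊗)
      ; _*_ = _⋆_
      ; 1#  = e
      }

    ♯-fixes : ∀ {x} → W♯ x → x ♯ ≈ x
    ♯-fixes (G , p) = ≈ᴹ-trans (♯.cong p) (≈ᴹ-trans (♯-idem G) (≈ᴹ-sym p))

    J-≈ : ∀ {x y} → x ≈ y → J (x + - y)
    J-≈ p = Equivalence.from (J-difference _ _) (♯.cong p)

    J-♯ : ∀ x → J (x ♯ + - x)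
    J-♯ x = Equivalence.from (J-difference _ _) (♯-idem x)

    W♯-isSubalgebra : IsSubalgebra rawAlgebra W♯
    W♯-isSubalgebra = record
      { +-closed  = λ (G , p) (H , q) → G + H , ≈ᴹ-trans (+ᴹ-cong p q) (≈ᴹ-sym (♯.+-homo G H))
      ; *-closed  = λ (G , p) (H , q) → G * H , ≈ᴹ-trans (*-cong p q) (≈ᴹ-sym (♯-* G H))
      ; *ₗ-closed = λ k (G , p) → k *ₗ G , ≈ᴹ-trans (*ₗ-cong R.refl p) (≈ᴹ-sym (♯.*ₗ-homo k G))
      ; -‿closed  = λ (G , p) → - G , ≈ᴹ-trans (-ᴹ‿cong p) (≈ᴹ-sym (♯.neg-homo G))
      ; 0#-closed = 0# , ≈ᴹ-sym ♯.zero-homo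
      ; 1#-closed = 1# , ≈ᴹ-sym ♯-1
      }

    toW♯ : Carrier → ∃ W♯
    toW♯ x = x ♯ , x , ≈ᴹ-refl

    W♯-isSubbialgebra : IsSubbialgebra A W♯
    W♯-isSubbialgebra = record
      { isSubalgebra = W♯-isSubalgebra
      -- As ♯ fixes x, Δ x = Δ (x ♯) = (♯ ⊗ ♯) (Δ x), and every tensor factor on the right lies in
      -- the image of ♯.
      ; Δ-closed = λ x p → (toW♯ ⟨⊗⟩ toW♯) (Δ x) ,
          ≈-trans (≡.subst (λ t → TensorEq _ _ t ((_♯ ⟨⊗⟩ _♯) (Δ x))) (List.map-∘ (Δ x)) ≈-refl)
          (≈-trans (≈-sym (Δ-♯ x)) (Linear.cong Δ-linear (♯-fixes p)))
      }

    private
      W♯ᴴ : RawBialgebra _ _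
      W♯ᴴ = subbialgebra A W♯-isSubbialgebra

      inclusion : IsMonomorphism (subalgebra rawAlgebra W♯-isSubalgebra) rawAlgebra proj₁
      inclusion = record
        { cong = id ; injective = id ; +-homo = λ _ _ → ≈ᴹ-refl ; *-homo = λ _ _ → ≈ᴹ-refl
        ; *ₗ-homo = λ _ _ → ≈ᴹ-refl ; neg-homo = λ _ → ≈ᴹ-refl ; 0-homo = ≈ᴹ-refl ; 1-homo = ≈ᴹ-refl }

      W♯-isHopfAlgebra : IsHopfAlgebra W♯ᴴ
      W♯-isHopfAlgebra = HopfRetract.isHopfAlgebra {B = W♯ᴴ} isHopfAlgebra {f = toW♯} inclusion
        (λ (x , p) → proj₂ (IsSubbialgebra.Δ-closed W♯-isSubbialgebra x p)) (λ _ → R.refl)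
        ♯.cong ♯.+-homo ♯.*ₗ-homo ♯-* (λ (x , p) → ♯-fixes p)

      quotient : IsMonomorphism (rawAlgebra /ᴬ J) rawAlgebra _♯
      quotient = record
        { cong = Equivalence.to (J-difference _ _) ; injective = Equivalence.from (J-difference _ _)
        ; +-homo = ♯.+-homo ; *-homo = ♯-* ; *ₗ-homo = ♯.*ₗ-homo ; neg-homo = ♯.neg-homo
        ; 0-homo = ♯.zero-homo ; 1-homo = ♯-1 }

      -- The section is ♯, well defined and injective by `J-difference`; the retraction is the
      -- residue map, which is the identity on representatives.
      W/J-isHopfAlgebra : IsHopfAlgebra (A /ᴴ J)
      W/J-isHopfAlgebra = HopfRetract.isHopfAlgebra {B = A /ᴴ J} isHopfAlgebra {f = id} quotient
        (λ x → ≈-sym (Δ-♯ x)) (λ x → R.sym (ε-♯ x))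
        J-≈ (λ _ _ → J-≈ ≈ᴹ-refl) (λ _ _ → J-≈ ≈ᴹ-refl) (λ _ _ → J-≈ ≈ᴹ-refl) J-♯

      W/J : Module a _
      W/J = record { isLeftModule = IsAlgebra.isLeftModule (IsHopfAlgebra.isAlgebra W/J-isHopfAlgebra) }

      residue : Linear 𝓐 W/J id
      residue = record { cong = J-≈ ; +-homo = λ _ _ → J-≈ ≈ᴹ-refl ; *ₗ-homo = λ _ _ → J-≈ ≈ᴹ-refl }

      -- Functoriality of the tensor product for the residue map, whose effect on lists of
      -- representatives is the identity.
      residue⊗ : ∀ {s t} → TensorEq (raw 𝓐) (raw 𝓐) s t → TensorEq (raw W/J) (raw W/J) s t
      residue⊗ {s} {t} p = ≡.subst₂ (TensorEq (raw W/J) (raw W/J)) (List.map-id s) (List.map-id t)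
        (Linear.cong (⟨⊗⟩-linear residue residue) p)

      W♯→W/J : IsMonomorphism (subalgebra rawAlgebra W♯-isSubalgebra) (rawAlgebra /ᴬ J) proj₁
      W♯→W/J = record
        { cong = J-≈
        ; injective = λ { {_ , p} {_ , q} r → ≈ᴹ-trans (≈ᴹ-sym (♯-fixes p))
            (≈ᴹ-trans (Equivalence.to (J-difference _ _) r) (♯-fixes q)) }
        ; +-homo = λ _ _ → J-≈ ≈ᴹ-refl ; *-homo = λ _ _ → J-≈ ≈ᴹ-refl ; *ₗ-homo = λ _ _ → J-≈ ≈ᴹ-refl
        ; neg-homo = λ _ → J-≈ ≈ᴹ-refl ; 0-homo = J-≈ ≈ᴹ-refl ; 1-homo = J-≈ ≈ᴹ-refl }

    hopfAlgebraIsomorphism : HopfAlgebraIsomorphism (subbialgebra A W♯-isSubbialgebra) (A /ᴴ J)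
    hopfAlgebraIsomorphism = record
      { isHopfAlgebra₁ = W♯-isHopfAlgebra
      ; isHopfAlgebra₂ = W/J-isHopfAlgebra
      ; algebraIsomorphism = IsMonomorphism.isIsomorphism W♯→W/J
          (IsHopfAlgebra.isAlgebra W♯-isHopfAlgebra) (IsHopfAlgebra.isAlgebra W/J-isHopfAlgebra)
          (λ y → toW♯ y , J-♯ y)
      ; Δ-homo = λ (x , p) → residue⊗ (proj₂ (IsSubbialgebra.Δ-closed W♯-isSubbialgebra x p))
      ; ε-homo = λ _ → R.refl
      -- The antipode of W♯ sends x to (antipode x) ♯, that of W / J sends it to antipode (x ♯).
      -- Since x ♯ = x, both have the same image under ♯.
      ; antipode-homo = λ (x , p) → Equivalence.from (J-difference _ _) (≈ᴹ-trans (♯-idem (antipode x))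
          (♯.cong (Linear.cong antipode-linear (≈ᴹ-sym (♯-fixes p)))))
      }

    -- The internal product in degree n

    S♯≈S-♯ : ∀ n → S♯ n ≈ S n ♯
    S♯≈S-♯ n = ≈ᴹ-sym (≈ᴹ-trans (♯-W (W-S n)) (⋆-identityˡ (W-S♯ n)))

    -- ♯ is a homomorphism for `⋆` that maps S n to S♯ n, so it carries the neutrality of S n in
    -- degree n to its image.
    S♯-neutral : ∀ n F → W♯₍ n ₎ F → (S♯ n ⋆ F) ≈ F × (F ⋆ S♯ n) ≈ F
    S♯-neutral n F (G , w , p) =
      ≈ᴹ-trans (⋆-cong (S♯≈S-♯ n) p) (≈ᴹ-trans (≈ᴹ-sym (♯-⋆-♯ (S n) G))
        (≈ᴹ-trans (♯.cong (⋆-identityˡ w)) (≈ᴹ-sym p))) ,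
      ≈ᴹ-trans (⋆-cong p (S♯≈S-♯ n)) (≈ᴹ-trans (≈ᴹ-sym (♯-⋆-♯ G (S n)))
        (≈ᴹ-trans (♯.cong (⋆-identityʳ w)) (≈ᴹ-sym p)))

    W♯ₙ-isSubalgebra : ∀ n → IsSubalgebra (internal (S♯ n)) W♯₍ n ₎
    W♯ₙ-isSubalgebra n = record
      { +-closed  = λ (G , v , p) (H , w , q) → G + H , add v w , ≈ᴹ-trans (+ᴹ-cong p q) (≈ᴹ-sym (♯.+-homo G H))
      ; *-closed  = λ (G , v , p) (H , w , q) → (G ⋆ H) , W-⋆ v w , ≈ᴹ-trans (⋆-cong p q) (≈ᴹ-sym (♯-⋆-♯ G H))
      ; *ₗ-closed = λ k (G , v , p) → k *ₗ G , scale k v , ≈ᴹ-trans (*ₗ-cong R.refl p) (≈ᴹ-sym (♯.*ₗ-homo k G))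
      ; -‿closed  = λ (G , v , p) → - G , Span-neg v , ≈ᴹ-trans (-ᴹ‿cong p) (≈ᴹ-sym (♯.neg-homo G))
      ; 0#-closed = 0# , zero , ≈ᴹ-sym ♯.zero-homo
      ; 1#-closed = S n , W-S n , S♯≈S-♯ n
      }

    Wₙ-isSubalgebra : ∀ n → IsSubalgebra (internal (S n)) W₍ n ₎
    Wₙ-isSubalgebra n = record
      { +-closed  = add
      ; *-closed  = W-⋆
      ; *ₗ-closed = scale
      ; -‿closed  = Span-neg
      ; 0#-closed = zero
      ; 1#-closed = W-S n
      }

    private
      W♯ₙ : ℕ → RawAlgebra _ _
      W♯ₙ n = subalgebra (internal (S♯ n)) (W♯ₙ-isSubalgebra n)

      Wₙ/Jₙ : ℕ → RawAlgebra _ _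
      Wₙ/Jₙ n = subalgebra (internal (S n)) (Wₙ-isSubalgebra n) /ᴬ (J₍ n ₎ ∘ proj₁)

      -- `internal (S♯ n)` is not an algebra, its unit being neutral on W♯ₙ only. So the module
      -- structure alone is pulled back along the inclusion, and the ring laws are supplied
      -- directly.
      W♯ₙ-isAlgebra : ∀ n → IsAlgebra (W♯ₙ n)
      W♯ₙ-isAlgebra n = record
        { isRing = record
          { +-isAbelianGroup = IsLeftModule.+ᴹ-isAbelianGroup isLeftModuleₙ
          ; *-cong = ⋆-cong
          ; *-assoc = λ (x , _) (y , _) (z , _) → ⋆-assoc x y z
          ; *-identity = (λ (x , p) → proj₁ (S♯-neutral n x p)) , (λ (x , p) → proj₂ (S♯-neutral n x p))
          ; distrib = (λ (x , _) (y , _) (z , _) → Linear.+-homo (⋆-linearʳ x) y z)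
                    , (λ (x , _) (y , _) (z , _) → Linear.+-homo (⋆-linearˡ x) y z)
          }
        ; isLeftModule = isLeftModuleₙ
        ; *ₗ-*-assoc = λ k (x , _) (y , _) → Linear.*ₗ-homo (⋆-linearˡ y) k x
        ; *-*ₗ-comm = λ k (x , _) (y , _) → Linear.*ₗ-homo (⋆-linearʳ x) k y
        }
        where
        inclusionₙ : IsMonomorphism (W♯ₙ n) (internal (S♯ n)) proj₁
        inclusionₙ = record
          { cong = id ; injective = id ; +-homo = λ _ _ → ≈ᴹ-refl ; *-homo = λ _ _ → ≈ᴹ-refl
          ; *ₗ-homo = λ _ _ → ≈ᴹ-refl ; neg-homo = λ _ → ≈ᴹ-refl ; 0-homo = ≈ᴹ-refl ; 1-homo = ≈ᴹ-refl }
        isLeftModuleₙ = LeftModuleMono.isLeftModule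
          (IsMonomorphism.isLeftModuleMonomorphism inclusionₙ) R.isRing isLeftModule

      Jₙ⁺ : ∀ {n x y} → W₍ n ₎ x → W₍ n ₎ y → J (x + - y) → J₍ n ₎ (x + - y)
      Jₙ⁺ v w p = p , add v (Span-neg w)

      Wₙ/Jₙ-isAlgebra : ∀ n → IsAlgebra (Wₙ/Jₙ n)
      Wₙ/Jₙ-isAlgebra n = IsMonomorphism.isAlgebra quotientₙ (W♯ₙ-isAlgebra n)
        where
        quotientₙ : IsMonomorphism (Wₙ/Jₙ n) (W♯ₙ n) (λ (x , w) → x ♯ , x , w , ≈ᴹ-refl)
        quotientₙ = record
          { cong = λ (p , _) → Equivalence.to (J-difference _ _) p
          ; injective = λ { {_ , v} {_ , w} p → Jₙ⁺ v w (Equivalence.from (J-difference _ _) p) }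
          ; +-homo = λ (x , _) (y , _) → ♯.+-homo x y
          ; *-homo = λ (x , _) (y , _) → ♯-⋆-♯ x y
          ; *ₗ-homo = λ k (x , _) → ♯.*ₗ-homo k x
          ; neg-homo = λ (x , _) → ♯.neg-homo x
          ; 0-homo = ♯.zero-homo
          ; 1-homo = ≈ᴹ-sym (S♯≈S-♯ n)
          }

    algebraIsomorphism : ∀ n → AlgebraIsomorphism (subalgebra (internal (S♯ n)) (W♯ₙ-isSubalgebra n))
      (subalgebra (internal (S n)) (Wₙ-isSubalgebra n) /ᴬ (J₍ n ₎ ∘ proj₁))
    algebraIsomorphism n = IsMonomorphism.isIsomorphism W♯ₙ→Wₙ/Jₙ (W♯ₙ-isAlgebra n) (Wₙ/Jₙ-isAlgebra n)
      (λ (y , w) → (y ♯ , y , w , ≈ᴹ-refl) , Jₙ⁺ (W-♯ w) w (J-♯ y))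
      where
      degree : ∀ {x} → W♯₍ n ₎ x → W₍ n ₎ x
      degree (G , w , p) = respects (≈ᴹ-sym p) (W-♯ w)
      forget : ∀ {x} → W♯₍ n ₎ x → W♯ x
      forget (G , _ , p) = G , p
      module Wₙ = IsSubalgebra (Wₙ-isSubalgebra n)
      module W♯ₙ = IsSubalgebra (W♯ₙ-isSubalgebra n)
      W♯ₙ→Wₙ/Jₙ : IsMonomorphism (W♯ₙ n) (Wₙ/Jₙ n) (λ (x , p) → x , degree p)
      W♯ₙ→Wₙ/Jₙ = record
        { cong = λ { {_ , p} {_ , q} r → Jₙ⁺ (degree p) (degree q) (J-≈ r) }
        ; injective = λ { {_ , p} {_ , q} (r , _) → ≈ᴹ-trans (≈ᴹ-sym (♯-fixes (forget p)))
            (≈ᴹ-trans (Equivalence.to (J-difference _ _) r) (♯-fixes (forget q))) }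
        ; +-homo = λ (_ , p) (_ , q) → Jₙ⁺ (add (degree p) (degree q)) (add (degree p) (degree q)) (J-≈ ≈ᴹ-refl)
        ; *-homo = λ (_ , p) (_ , q) → Jₙ⁺ (W-⋆ (degree p) (degree q)) (W-⋆ (degree p) (degree q)) (J-≈ ≈ᴹ-refl)
        ; *ₗ-homo = λ k (_ , p) → Jₙ⁺ (scale k (degree p)) (scale k (degree p)) (J-≈ ≈ᴹ-refl)
        ; neg-homo = λ (_ , p) → Jₙ⁺ (Span-neg (degree p)) (Span-neg (degree p)) (J-≈ ≈ᴹ-refl)
        ; 0-homo = Jₙ⁺ zero zero (J-≈ ≈ᴹ-refl)
        ; 1-homo = Jₙ⁺ (W-S♯ n) (W-S n) (Equivalence.from (J-difference _ _)
            (≈ᴹ-trans (♯.cong (S♯≈S-♯ n)) (♯-idem (S n))))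
        }

-- Formal sums of packed words

module FormalSums {c ℓ₁ ℓ₂} (K : HeytingField c ℓ₁ ℓ₂) (char0 : CharacteristicZero K) where
  R : CommutativeRing c ℓ₁
  R = HeytingCommutativeRing.commutativeRing (HeytingField.heytingCommutativeRing K)

  open LinearAlgebra R hiding (module R)
  open PackedWordBialgebras R
  open FallingPowers R
  open WQSymDual K char0
    using (FormalSum; coefficient; N; _∙_; linear; bilinear; W; _⋆_; inverseFactorial)
  open RawBialgebra W using (_≈_; _*_; Δ; ε; rawAlgebra)
  private
    module K = CommutativeRing R
    open module KRing = RingProperties K.ring using (-‿distribˡ-*; -0#≈0#; -‿+-comm)

  neg : FormalSum → FormalSum
  neg = map (Product.map₁ (λ k → K.- k))

  at : PackedWord → PackedWord → K.Carrier → K.Carrier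
  at u w k = if does (u ≟ᵂ w) then k else K.0#

  at-≡ : ∀ {u w} k → u ≡ w → at u w k K.≈ k
  at-≡ {u} {w} k eq = K.reflexive (≡.cong (λ b → if b then k else K.0#) (dec-true (u ≟ᵂ w) eq))

  at-≢ : ∀ {u w} k → u ≢ w → at u w k K.≈ K.0#
  at-≢ {u} {w} k neq = K.reflexive (≡.cong (λ b → if b then k else K.0#) (dec-false (u ≟ᵂ w) neq))

  at-cong : ∀ u w {j k} → j K.≈ k → at u w j K.≈ at u w k
  at-cong u w p with does (u ≟ᵂ w)
  ... | true  = p
  ... | false = K.refl

  at-* : ∀ u w j k → at u w (j K.* k) K.≈ j K.* at u w k
  at-* u w j k with does (u ≟ᵂ w)
  ... | true  = K.refl
  ... | false = K.sym (K.zeroʳ j)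

  at-neg : ∀ u w k → at u w (K.- k) K.≈ K.- at u w k
  at-neg u w k with does (u ≟ᵂ w)
  ... | true  = K.refl
  ... | false = K.sym -0#≈0#

  coefficient-++ : ∀ F G w → coefficient (F ++ G) w K.≈ coefficient F w K.+ coefficient G w
  coefficient-++ []            G w = K.sym (K.+-identityˡ _)
  coefficient-++ ((k , u) ∷ F) G w = K.trans (K.+-congˡ (coefficient-++ F G w)) (K.sym (K.+-assoc _ _ _))

  coefficient-∙ : ∀ k F w → coefficient (k ∙ F) w K.≈ k K.* coefficient F w
  coefficient-∙ k []            w = K.sym (K.zeroʳ k)
  coefficient-∙ k ((j , u) ∷ F) w = K.trans (K.+-cong (at-* u w k j) (coefficient-∙ k F w)) (K.sym (K.distribˡ k _ _))

  coefficient-neg : ∀ F w → coefficient (neg F) w K.≈ K.- coefficient F w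
  coefficient-neg []            w = K.sym -0#≈0#
  coefficient-neg ((k , u) ∷ F) w = K.trans (K.+-cong (at-neg u w k) (coefficient-neg F w)) (-‿+-comm _ _)

  isLeftModule : IsLeftModule K.ring _≈_ _++_ [] neg _∙_
  isLeftModule = record
    { isLeftSemimodule = record
      { +ᴹ-isCommutativeMonoid = record
        { isMonoid = record
          { isSemigroup = record
            { isMagma = record
              { isEquivalence = record
                { refl = λ _ → K.refl ; sym = λ p w → K.sym (p w) ; trans = λ p q w → K.trans (p w) (q w) }
              ; ∙-cong = λ {F} {F′} {G} {G′} p q w → K.trans (coefficient-++ F G w)
                  (K.trans (K.+-cong (p w) (q w)) (K.sym (coefficient-++ F′ G′ w)))
              }
            ; assoc = λ F G H w → K.reflexive (≡.cong (λ E → coefficient E w) (List.++-assoc F G H))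
            }
          ; identity = (λ _ _ → K.refl) , (λ F w → K.reflexive (≡.cong (λ E → coefficient E w) (List.++-identityʳ F)))
          }
        ; comm = λ F G w → K.trans (coefficient-++ F G w) (K.trans (K.+-comm _ _) (K.sym (coefficient-++ G F w)))
        }
      ; isPreleftSemimodule = record
        { *ₗ-cong = λ {j} {k} {F} {G} p q w → K.trans (coefficient-∙ j F w)
            (K.trans (K.*-cong p (q w)) (K.sym (coefficient-∙ k G w)))
        ; *ₗ-zeroˡ = λ F w → K.trans (coefficient-∙ K.0# F w) (K.zeroˡ _)
        ; *ₗ-distribʳ = λ F j k w → K.trans (coefficient-∙ _ F w) (K.trans (K.distribʳ _ j k)
            (K.sym (K.trans (coefficient-++ (j ∙ F) (k ∙ F) w) (K.+-cong (coefficient-∙ j F w) (coefficient-∙ k F w)))))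
        ; *ₗ-identityˡ = λ F w → K.trans (coefficient-∙ K.1# F w) (K.*-identityˡ _)
        ; *ₗ-assoc = λ j k F w → K.trans (coefficient-∙ _ F w) (K.trans (K.*-assoc j k _)
            (K.sym (K.trans (coefficient-∙ j (k ∙ F) w) (K.*-congˡ (coefficient-∙ k F w)))))
        ; *ₗ-zeroʳ = λ _ _ → K.refl
        ; *ₗ-distribˡ = λ k F G w → K.reflexive (≡.cong (λ E → coefficient E w) (List.map-++ _ F G))
        }
      }
    ; -ᴹ‿cong = λ {F} {G} p w → K.trans (coefficient-neg F w) (K.trans (K.-‿cong (p w)) (K.sym (coefficient-neg G w)))
    ; -ᴹ‿inverse =
        (λ F w → K.trans (coefficient-++ (neg F) F w) (K.trans (K.+-congʳ (coefficient-neg F w)) (K.-‿inverseˡ _)))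
      , (λ F w → K.trans (coefficient-++ F (neg F) w) (K.trans (K.+-congˡ (coefficient-neg F w)) (K.-‿inverseʳ _)))
    }

  𝓦 : Module c ℓ₁
  𝓦 = record { isLeftModule = isLeftModule }

  private
    module 𝓦 = ModuleReasoning 𝓦

  remove : PackedWord → FormalSum → FormalSum
  remove-step : ∀ u v → Dec (v ≡ u) → K.Carrier → FormalSum → FormalSum
  remove u []            = []
  remove u ((k , v) ∷ F) = remove-step u v (v ≟ᵂ u) k (remove u F)
  remove-step u v (yes _) k F = F
  remove-step u v (no _)  k F = (k , v) ∷ F

  length-remove : ∀ u F → length (remove u F) ≤ length F
  length-remove u []            = z≤n
  length-remove u ((k , v) ∷ F) with v ≟ᵂ u
  ... | yes _ = ℕ.m≤n⇒m≤1+n (length-remove u F)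
  ... | no  _ = s≤s (length-remove u F)

  coefficient-remove-≡ : ∀ u F → coefficient (remove u F) u K.≈ K.0#
  coefficient-remove-≡ u [] = K.refl
  coefficient-remove-≡ u ((k , v) ∷ F) = go (v ≟ᵂ u)
    where
    go : ∀ d → coefficient (remove-step u v d k (remove u F)) u K.≈ K.0#
    go (yes _)  = coefficient-remove-≡ u F
    go (no v≢u) = K.trans (K.+-cong (at-≢ {v} {u} k v≢u) (coefficient-remove-≡ u F)) (K.+-identityˡ _)

  coefficient-remove-≢ : ∀ u F {w} → u ≢ w → coefficient (remove u F) w K.≈ coefficient F w
  coefficient-remove-≢ u [] u≢w = K.refl
  coefficient-remove-≢ u ((k , v) ∷ F) {w} u≢w = go (v ≟ᵂ u)
    where
    go : ∀ d → coefficient (remove-step u v d k (remove u F)) w K.≈ coefficient ((k , v) ∷ F) w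
    go (yes ≡.refl) = K.trans (coefficient-remove-≢ u F u≢w)
      (K.sym (K.trans (K.+-congʳ (at-≢ {u} {w} k u≢w)) (K.+-identityˡ _)))
    go (no _) = K.+-congˡ (coefficient-remove-≢ u F u≢w)

  module _ {m ℓm} {M : Module m ℓm} where
    private
      module M = ModuleReasoning M

    -- Equality of formal sums compares coefficients, not lists of terms, so the point is that `h`
    -- respects it. By linearity `h` only has to vanish on sums with zero coefficients: the terms at
    -- the first word are gathered, contribute their total coefficient 0, and are removed.
    linear-extension : ∀ {f : PackedWord → M.Carrierᴹ} {h : FormalSum → M.Carrierᴹ} → h [] M.≈ᴹ M.0ᴹ →
                       (∀ k u F → h ((k , u) ∷ F) M.≈ᴹ k M.*ₗ f u M.+ᴹ h F) → Linear 𝓦 M h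
    linear-extension {f} {h} h[] h∷ = record { cong = cong ; +-homo = h-++ ; *ₗ-homo = h-∙ }
      where
      h-++ : ∀ F G → h (F ++ G) M.≈ᴹ h F M.+ᴹ h G
      h-++ [] G = M.≈ᴹ-sym (M.≈ᴹ-trans (M.+ᴹ-congʳ h[]) (M.+ᴹ-identityˡ _))
      h-++ ((k , u) ∷ F) G = M.≈ᴹ-trans (h∷ k u _) (M.≈ᴹ-trans (M.+ᴹ-congˡ (h-++ F G))
        (M.≈ᴹ-trans (M.≈ᴹ-sym (M.+ᴹ-assoc _ _ _)) (M.+ᴹ-congʳ (M.≈ᴹ-sym (h∷ k u F)))))

      h-∙ : ∀ k F → h (k ∙ F) M.≈ᴹ k M.*ₗ h F
      h-∙ k [] = M.≈ᴹ-trans h[] (M.≈ᴹ-sym (M.≈ᴹ-trans (M.*ₗ-cong K.refl h[]) (M.*ₗ-zeroʳ k)))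
      h-∙ k ((j , u) ∷ F) = M.≈ᴹ-trans (h∷ _ u _) (M.≈ᴹ-trans (M.+ᴹ-cong (M.*ₗ-assoc k j _) (h-∙ k F))
        (M.≈ᴹ-trans (M.≈ᴹ-sym (M.*ₗ-distribˡ k _ _)) (M.*ₗ-cong K.refl (M.≈ᴹ-sym (h∷ j u F)))))

      h-neg : ∀ F → h (neg F) M.≈ᴹ M.-ᴹ h F
      h-neg F = M.≈ᴹ-trans (go F) (M.≈ᴹ-sym (M.-ᴹ≈-1*ₗ (h F)))
        where
        go : ∀ F → h (neg F) M.≈ᴹ (K.- K.1#) M.*ₗ h F
        go [] = h-∙ (K.- K.1#) []
        go ((k , u) ∷ F) = M.≈ᴹ-trans (h∷ _ u _) (M.≈ᴹ-trans
          (M.+ᴹ-cong (M.≈ᴹ-trans (M.*ₗ-cong (K.sym (K.trans (K.sym (-‿distribˡ-* K.1# k)) (K.-‿cong (K.*-identityˡ k))))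
                                            M.≈ᴹ-refl) (M.*ₗ-assoc _ k _)) (go F))
          (M.≈ᴹ-trans (M.≈ᴹ-sym (M.*ₗ-distribˡ _ _ _)) (M.*ₗ-cong K.refl (M.≈ᴹ-sym (h∷ k u F)))))

      h-remove : ∀ u F → h F M.≈ᴹ coefficient F u M.*ₗ f u M.+ᴹ h (remove u F)
      h-remove u [] = M.≈ᴹ-sym (M.≈ᴹ-trans (M.+ᴹ-congʳ (M.*ₗ-zeroˡ _)) (M.+ᴹ-identityˡ _))
      h-remove u ((k , v) ∷ F) = M.≈ᴹ-trans (h∷ k v F) (M.≈ᴹ-trans (M.+ᴹ-congˡ (h-remove u F)) (go (v ≟ᵂ u)))
        where
        go : ∀ d → k M.*ₗ f v M.+ᴹ (coefficient F u M.*ₗ f u M.+ᴹ h (remove u F)) M.≈ᴹ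
             coefficient ((k , v) ∷ F) u M.*ₗ f u M.+ᴹ h (remove-step u v d k (remove u F))
        go (yes ≡.refl) = M.≈ᴹ-trans (M.≈ᴹ-sym (M.+ᴹ-assoc _ _ _)) (M.+ᴹ-congʳ
          (M.≈ᴹ-trans (M.≈ᴹ-sym (M.*ₗ-distribʳ _ _ _)) (M.*ₗ-cong (K.+-congʳ (K.sym (at-≡ {u} {u} k ≡.refl))) M.≈ᴹ-refl)))
        go (no v≢u) = M.≈ᴹ-trans (M.≈ᴹ-sym (M.+ᴹ-assoc _ _ _)) (M.≈ᴹ-trans (M.+ᴹ-congʳ (M.+ᴹ-comm _ _))
          (M.≈ᴹ-trans (M.+ᴹ-assoc _ _ _) (M.+ᴹ-cong
            (M.*ₗ-cong (K.sym (K.trans (K.+-congʳ (at-≢ {v} {u} k v≢u)) (K.+-identityˡ _))) M.≈ᴹ-refl)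
            (M.≈ᴹ-sym (h∷ k v _)))))

      -- The recursion runs on a bound for the number of terms, since `remove u F` is shorter than
      -- the given sum but not a tail of it.
      vanish : ∀ n F → length F ≤ n → (∀ w → coefficient F w K.≈ K.0#) → h F M.≈ᴹ M.0ᴹ
      vanish n [] _ _ = h[]
      vanish (suc n) ((k , u) ∷ F) (s≤s len) z = M.≈ᴹ-trans (h-remove u ((k , u) ∷ F))
        (M.≈ᴹ-trans (M.+ᴹ-cong (M.≈ᴹ-trans (M.*ₗ-cong (z u) M.≈ᴹ-refl) (M.*ₗ-zeroˡ _)) (go (u ≟ᵂ u)))
          (M.+ᴹ-identityˡ _))
        where
        zero-remove : ∀ w → coefficient (remove u F) w K.≈ K.0#
        zero-remove w with u ≟ᵂ w
        ... | yes ≡.refl = coefficient-remove-≡ u F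
        ... | no u≢w = K.trans (coefficient-remove-≢ u F u≢w)
          (K.trans (K.sym (K.trans (K.+-congʳ (at-≢ {u} {w} k u≢w)) (K.+-identityˡ _))) (z w))
        go : ∀ d → h (remove-step u u d k (remove u F)) M.≈ᴹ M.0ᴹ
        go (yes _) = vanish n (remove u F) (ℕ.≤-trans (length-remove u F) len) zero-remove
        go (no u≢u) = contradiction ≡.refl u≢u

      cong : ∀ {F G} → F ≈ G → h F M.≈ᴹ h G
      cong {F} {G} p = M.x-y≈0⇒x≈y (M.≈ᴹ-trans (M.+ᴹ-congˡ (M.≈ᴹ-sym (h-neg G)))
        (M.≈ᴹ-trans (M.≈ᴹ-sym (h-++ F (neg G))) (vanish _ (F ++ neg G) ℕ.≤-refl (𝓦.x≈y⇒x-y≈0 {F} {G} p))))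

  linear-linear : ∀ f → Linear 𝓦 𝓦 (linear f)
  linear-linear f = linear-extension {M = 𝓦} {f} (λ _ → K.refl) (λ _ _ _ _ → K.refl)

  linear-N : ∀ f u → linear f (N u) ≈ f u
  linear-N f u = 𝓦.≈ᴹ-trans {K.1# ∙ f u ++ []} {K.1# ∙ f u} {f u}
    (𝓦.+ᴹ-identityʳ (K.1# ∙ f u)) (𝓦.*ₗ-identityˡ (f u))

  bilinear-bilinear : ∀ f → Bilinear 𝓦 𝓦 𝓦 (bilinear f)
  bilinear-bilinear f = record { linearˡ = λ G → linear-linear _ ; linearʳ = right }
    where
    right : ∀ F → Linear 𝓦 𝓦 (bilinear f F)
    right []            = 0-linear
    right ((k , u) ∷ F) = +-linear (*ₗ-linear k (linear-linear (f u))) (right F)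

  bilinear-N : ∀ f u v → bilinear f (N u) (N v) ≈ f u v
  bilinear-N f u v = 𝓦.≈ᴹ-trans {bilinear f (N u) (N v)} {linear (f u) (N v)} {f u v}
    (linear-N (λ u → linear (f u) (N v)) u) (linear-N (f u) v)

  spanning : ∀ F → Span rawAlgebra (λ F → ∃ λ u → F ≡ N u) F
  spanning []            = zero
  spanning ((k , u) ∷ F) = respects
    (λ w → K.+-congʳ (at-cong u w (K.*-identityʳ k)))
    (add (scale k (generator (u , ≡.refl))) (spanning F))

  private
    ≡⇒≈⊗ : ∀ {s t} → s ≡ t → TensorEq (raw 𝓦) (raw 𝓦) s t
    ≡⇒≈⊗ ≡.refl = ≈-refl

  Δ-linear : Linear 𝓦 (𝓦 ⊗ᴹ 𝓦) Δ
  Δ-linear = linear-extension {M = 𝓦 ⊗ᴹ 𝓦} {f = λ w → map (λ (a , b) → N a , N b) (deconcatenations w)} ≈-refl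
    (λ k u F → ≡⇒≈⊗ (≡.cong (_++ Δ F)
      (List.map-∘ {g = Product.map₁ (k ∙_)} {f = λ (a , b) → N a , N b} (deconcatenations u))))

  ε-linear : Linear 𝓦 scalars ε
  ε-linear = record
    { cong = λ p → p (ones 0)
    ; +-homo = λ F G → coefficient-++ F G (ones 0)
    ; *ₗ-homo = λ k F → coefficient-∙ k F (ones 0)
    }

  -- Product and coproduct of basis elements

  private
    module S = WordSums R 𝓦
    module S² = WordSums R (𝓦 ⊗ᴹ 𝓦)

    ≡⇒≈ : ∀ {F G : FormalSum} → F ≡ G → F ≈ G
    ≡⇒≈ ≡.refl w = K.refl

    shuffles-Ш : ∀ (G : List ℕ → FormalSum) xs ys →
                 concatMap (λ (w , _) → G w) (shuffles xs ys) ≈ S.Ш G xs ys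
    shuffles-Ш G [] [] = 𝓦.+ᴹ-identityʳ (G [])
    shuffles-Ш G (x ∷ xs) [] = 𝓦.≈ᴹ-trans
      {concatMap (λ (w , _) → G w) (shuffles (x ∷ xs) [])} {S.Ш (G ∘ (x ∷_)) xs []} {G (x ∷ xs)}
      (𝓦.≈ᴹ-trans {concatMap (λ (w , _) → G w) (shuffles (x ∷ xs) [])}
                   {concatMap (λ (w , _) → G (x ∷ w)) (shuffles xs [])} {S.Ш (G ∘ (x ∷_)) xs []}
        (≡⇒≈ (List.concatMap-map _ _ (shuffles xs []))) (shuffles-Ш (G ∘ (x ∷_)) xs []))
      (≡⇒≈ (S.Ш-[]ʳ (G ∘ (x ∷_)) xs))
    shuffles-Ш G [] (y ∷ ys) = 𝓦.≈ᴹ-trans {concatMap (λ (w , _) → G w) (shuffles [] (y ∷ ys))}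
        {concatMap (λ (w , _) → G (y ∷ w)) (shuffles [] ys)} {S.Ш (G ∘ (y ∷_)) [] ys}
        (≡⇒≈ (List.concatMap-map _ _ (shuffles [] ys))) (shuffles-Ш (G ∘ (y ∷_)) [] ys)
    shuffles-Ш G (x ∷ xs) (y ∷ ys) = 𝓦.≈ᴹ-trans
      {concatMap (λ (w , _) → G w) (shuffles (x ∷ xs) (y ∷ ys))}
      {concatMap (λ (w , _) → G (x ∷ w)) (shuffles xs (y ∷ ys)) ++
       concatMap (λ (w , _) → G (y ∷ w)) (shuffles (x ∷ xs) ys)}
      {S.Ш G (x ∷ xs) (y ∷ ys)}
      (≡⇒≈ (≡.trans (List.concatMap-++ _ (map _ (shuffles xs (y ∷ ys))) _)
        (≡.cong₂ _++_ (List.concatMap-map _ _ (shuffles xs (y ∷ ys))) (List.concatMap-map _ _ (shuffles (x ∷ xs) ys)))))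
      (𝓦.+ᴹ-cong {concatMap (λ (w , _) → G (x ∷ w)) (shuffles xs (y ∷ ys))} {S.Ш (G ∘ (x ∷_)) xs (y ∷ ys)}
                  {concatMap (λ (w , _) → G (y ∷ w)) (shuffles (x ∷ xs) ys)} {S.Ш (G ∘ (y ∷_)) (x ∷ xs) ys}
        (shuffles-Ш (G ∘ (x ∷_)) xs (y ∷ ys)) (shuffles-Ш (G ∘ (y ∷_)) (x ∷ xs) ys))

    -- The interleavings stored in `shuffles` serve to prove the words packed. As `packWord` leaves
    -- packed words unchanged, they can be forgotten.
    *-N : ∀ u v → (N u * N v) ≈ S.Ш (λ w → N (packWord w)) (word u) (shift (word u) (word v))
    *-N u v = 𝓦.≈ᴹ-trans {N u * N v} {concatMap N (shiftedShuffles u v)}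
      {S.Ш (λ w → N (packWord w)) (word u) (shift (word u) (word v))}
      (bilinear-N (λ u v → concatMap N (shiftedShuffles u v)) u v)
      (𝓦.≈ᴹ-trans {concatMap N (shiftedShuffles u v)}
        {concatMap (λ (w , _) → N (packWord w)) (shuffles (word u) (shift (word u) (word v)))}
        {S.Ш (λ w → N (packWord w)) (word u) (shift (word u) (word v))}
        (≡⇒≈ (≡.trans (List.concatMap-map N _ (shuffles (word u) (shift (word u) (word v))))
          (List.concatMap-cong (λ _ → ≡.cong N (≡.sym (packWord-word _))) (shuffles (word u) (shift (word u) (word v))))))
        (shuffles-Ш (λ w → N (packWord w)) (word u) (shift (word u) (word v))))

    zip-mapˡ : ∀ {X : Set c} (φ : List ℕ → List ℕ → X) (f : List ℕ → List ℕ) as bs →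
               map (λ (a , b) → φ a b) (zip (map f as) bs) ≡ map (λ (a , b) → φ (f a) b) (zip as bs)
    zip-mapˡ φ f []       bs       = ≡.refl
    zip-mapˡ φ f (a ∷ as) []       = ≡.refl
    zip-mapˡ φ f (a ∷ as) (b ∷ bs) = ≡.cong (φ (f a) b ∷_) (zip-mapˡ φ f as bs)

    cuts : ∀ (φ : List ℕ → List ℕ → FormalSum × FormalSum) w →
           map (λ (a , b) → φ a b) (zip (inits w) (tails w)) ≡ S².Cut (λ a b → [ φ a b ]) w
    cuts φ []      = ≡.refl
    cuts φ (x ∷ w) = ≡.cong (φ [] (x ∷ w) ∷_)
      (≡.trans (zip-mapˡ φ (x ∷_) (inits w) (tails w)) (cuts (φ ∘ (x ∷_)) w))

    Δ-N : ∀ w → TensorEq (raw 𝓦) (raw 𝓦) (Δ (N w))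
                  (S².Cut (λ a b → [ N (packWord a) , N (packWord b) ]) (word w))
    Δ-N w = ≈-trans
      (≡⇒≈⊗ (≡.trans (List.++-identityʳ _) (≡.trans (≡.sym (List.map-∘
          {g = λ (u , v) → K.1# ∙ N u , N v} {f = Product.map packWord packWord} (zip (inits (word w)) (tails (word w)))))
        (cuts (λ a b → K.1# ∙ N (packWord a) , N (packWord b)) (word w)))))
      (S².Cut-cong {h = λ a b → [ K.1# ∙ N (packWord a) , N (packWord b) ]}
                   {h′ = λ a b → [ N (packWord a) , N (packWord b) ]} (word w)
        (λ a b _ → ⊗-cong {m = K.1# ∙ N (packWord a)} {N (packWord a)} {N (packWord b)} {N (packWord b)}
          (𝓦.*ₗ-identityˡ (N (packWord a))) (λ _ → K.refl)))

    coefficient-N : ∀ u w → coefficient (N u) w K.≈ at u w K.1#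
    coefficient-N u w = K.+-identityʳ _

  star : PackedWord → PackedWord → FormalSum
  star u v = if does (length (word u) ℕ.≟ length (word v)) then N (packPair u v) else []

  isPackedWordBialgebra : IsPackedWordBialgebra W N _⋆_ linear
  isPackedWordBialgebra = record
    { isLeftModule  = isLeftModule
    ; spanning      = spanning
    ; extend-linear = linear-linear
    ; extend-N      = linear-N
    ; *-bilinear    = bilinear-bilinear _
    ; ⋆-bilinear    = bilinear-bilinear star
    ; Δ-linear      = Δ-linear
    ; ε-linear      = ε-linear
    ; 1-N           = λ _ → K.refl
    ; *-N           = *-N
    ; Δ-N           = Δ-N
    ; ε-N-empty     = K.trans (coefficient-N (ones 0) (ones 0)) (at-≡ {ones 0} {ones 0} K.1# ≡.refl)
    ; ε-N-nonempty  = λ u u≢[] → K.trans (coefficient-N u (ones 0)) (at-≢ {u} {ones 0} K.1# (λ eq → u≢[] (≡.cong word eq)))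
    ; ⋆-N           = λ u v eq → 𝓦.≈ᴹ-trans {N u ⋆ N v} {star u v} {N (packPair u v)} (bilinear-N star u v)
        (≡⇒≈ (≡.cong (λ b → if b then N (packPair u v) else []) (dec-true (length (word u) ℕ.≟ length (word v)) eq)))
    ; ⋆-N-≢         = λ u v neq → 𝓦.≈ᴹ-trans {N u ⋆ N v} {star u v} {[]} (bilinear-N star u v)
        (≡⇒≈ (≡.cong (λ b → if b then N (packPair u v) else []) (dec-false (length (word u) ℕ.≟ length (word v)) neq)))
    }

  -- Inverses of positive integers and of factorials

  open RawSemiringDefs (RawRing.rawSemiring K.rawRing) using (_^_)

  ι⁻¹ : ∀ i → ∃ λ k → k K.* ι (suc i) K.≈ K.1#
  -- Apartness from 0 gives an inverse of the difference with 0, so that 0 is subtracted away before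
  -- it is used.
  ι⁻¹ i = proj₁ inv , K.trans (K.*-congˡ (K.sym (K.trans (K.+-congˡ -0#≈0#) (K.+-identityʳ _)))) (proj₁ (proj₂ inv))
    where inv = HeytingField.#⇒invertible K (char0 (suc i))

  inverseFactorial-inverse : ∀ i → inverseFactorial i K.* ι (i !) K.≈ K.1#
  inverseFactorial-inverse i = K.trans (K.*-congˡ (K.sym (K.trans (K.+-congˡ -0#≈0#) (K.+-identityʳ _))))
    (proj₁ (proj₂ (HeytingField.#⇒invertible K (char0 (i !) {{i ℕ.!≢0}}))))

  coef : ℕ → K.Carrier
  coef i = (K.- K.1#) ^ i K.* inverseFactorial i

  coef-0 : coef 0 K.≈ K.1#
  coef-0 = K.trans (K.*-identityˡ _) (K.trans (K.sym (K.*-identityʳ _))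
    (K.trans (K.*-congˡ (K.sym (K.+-identityʳ K.1#))) (inverseFactorial-inverse 0)))

  -- The left side is multiplied by 1, written as the product of i! and its inverse; then (i + 1) i!
  -- = (i + 1)! cancels.
  inverseFactorial-suc : ∀ i → inverseFactorial (suc i) K.* ι (suc i) K.≈ inverseFactorial i
  inverseFactorial-suc i = K.trans (K.sym (K.*-identityʳ _)) (K.trans
    (K.*-congˡ (K.trans (K.sym (inverseFactorial-inverse i)) (K.*-comm _ _)))
    (K.trans (K.sym (K.*-assoc _ _ _)) (K.trans
      (K.*-congʳ (K.trans (K.*-assoc _ _ _) (K.trans (K.*-congˡ (K.sym (×1-homo-* (suc i) (i !)))) (inverseFactorial-inverse (suc i)))))
      (K.*-identityˡ _))))
    where open SemiringMult K.semiring using (×1-homo-*)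

  coef-suc : ∀ i → coef (suc i) K.* ι (suc i) K.≈ K.- coef i
  coef-suc i = K.trans (K.*-assoc _ _ _) (K.trans (K.*-congˡ (inverseFactorial-suc i))
    (K.trans (K.*-assoc _ _ _) (K.trans (K.sym (-‿distribˡ-* _ _)) (K.-‿cong (K.*-identityˡ _)))))

proposition3p4 : ∀ {c ℓ₁ ℓ₂} (K : HeytingField c ℓ₁ ℓ₂) (char0 : CharacteristicZero K) →
    let open WQSymDual K char0 in
    (∃ λ (closed : IsSubbialgebra W W♯) →
    HopfAlgebraIsomorphism (subbialgebra W closed) (W /ᴴ J))
    ×
    (∀ (n : ℕ) →
    (∃ λ (closed♯ : IsSubalgebra (internal (S♯ n)) W♯₍ n ₎) →
    ∃ λ (closed : IsSubalgebra (internal (S n)) W₍ n ₎) →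
    AlgebraIsomorphism
    (subalgebra (internal (S♯ n)) closed♯)
    (subalgebra (internal (S n)) closed /ᴬ (J₍ n ₎ ∘ proj₁)))
    × S♯ n ≈ S n ♯
    × (∀ F → W♯₍ n ₎ F → S♯ n ⋆ F ≈ F × F ⋆ S♯ n ≈ F))
proposition3p4 K char0 =
  (W♯-isSubbialgebra , hopfAlgebraIsomorphism) ,
  λ n → (W♯ₙ-isSubalgebra n , Wₙ-isSubalgebra n , algebraIsomorphism n) , S♯≈S-♯ n , S♯-neutral n
  where
  open FormalSums K char0
  -- With `coef i` equal to (-1)^i / i!, the abstract `S♯`, `_♯`, `W♯` and `J` unfold to those of
  -- the theorem.
  open QuotientIsomorphism.Isomorphisms R isPackedWordBialgebra ι⁻¹ coef coef-0 coef-suc
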